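{- There are, up to equivalence, exactly $15$ different $(20,8)$-codes of size $256$ with all distances divisible by $4$.
   Context: Let $\mathbb{F}_2=\{0,1\}$ be the field of two elements. The (Hamming) distance $d_H(u,v)$ of words $u,v\in\mathbb{F}_2^n$ is the number of $i$ with $u_i\neq v_i$. An $(n,d)$-code is a subset $C\subseteq\mathbb{F}_2^n$ (not necessarily linear) such that $d_H(u,v)\geq d$ for all distinct $u,v\in C$. "All distances divisible by $4$" means that $4\mid d_H(u,v)$ for all $u,v\in C$. Two binary codes $C,D\subseteq\mathbb{F}_2^n$ are equivalent if $D$ can be obtained from $C$ by first permuting the $n$ coordinates and subsequently permuting the alphabet $\{0,1\}$ in each coordinate separately. -}

module Defs where

open import Data.Bool using (Bool; T)
open import Data.Fin using (Fin; _≟_)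
open import Data.Fin.Permutation using (Permutation′; _⟨$⟩ʳ_)
open import Data.Nat using (ℕ; _≤_)
open import Data.Nat.Divisibility using (_∣_)
open import Data.Product using (Σ-syntax; ∃-syntax; _×_; _,_)
open import Data.Vec using (Vec; count; lookup; tabulate; zip)
open import Function.Bundles using (_⇔_; _↔_)
open import Relation.Binary.PropositionalEquality using (_≡_; _≢_)
open import Relation.Nullary.Decidable using (¬?)

𝔽₂ : Set
𝔽₂ = Fin 2

Word : ℕ → Set
Word n = Vec 𝔽₂ n

dH : ∀ {n} → Word n → Word n → ℕ
dH u v = count (λ (a , b) → ¬? (a ≟ b)) (zip u v)

-- Subsets of the finite set 𝔽₂ⁿ are given by their characteristic functions.
Code : ℕ → Set
Code n = Word n → Bool

infix 4 _∈_

_∈_ : ∀ {n} → Word n → Code n → Set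
w ∈ C = T (C w)

-- T is proof-irrelevant, so the right-hand side is in bijection with the
-- words of C themselves.
HasSize : ∀ {n} → Code n → ℕ → Set
HasSize C m = Fin m ↔ (∃[ w ] w ∈ C)

MinDistanceAtLeast : ∀ {n} → Code n → ℕ → Set
MinDistanceAtLeast C d = ∀ u v → u ∈ C → v ∈ C → u ≢ v → d ≤ dH u v

DistancesDivisibleBy : ∀ {n} → ℕ → Code n → Set
DistancesDivisibleBy k C = ∀ u v → u ∈ C → v ∈ C → k ∣ dH u v

permuteCoordinates : ∀ {n} → Permutation′ n → Word n → Word n
permuteCoordinates σ w = tabulate λ i → lookup w (σ ⟨$⟩ʳ i)

permuteAlphabets : ∀ {n} → (Fin n → Permutation′ 2) → Word n → Word n
permuteAlphabets τ w = tabulate λ i → τ i ⟨$⟩ʳ lookup w i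

-- D is the image of C under a coordinate permutation followed by a permutation
-- of the alphabet in each coordinate; equality of codes is extensional.
Equivalent : ∀ {n} → Code n → Code n → Set
Equivalent {n} C D =
  Σ[ σ ∈ Permutation′ n ] Σ[ τ ∈ (Fin n → Permutation′ 2) ]
    (∀ v → v ∈ D ⇔ (∃[ w ] (w ∈ C × permuteAlphabets τ (permuteCoordinates σ w) ≡ v)))

ExactlyUpToEquivalence : ∀ {n} → ℕ → (Code n → Set) → Set
ExactlyUpToEquivalence {n} m P =
  Σ[ c ∈ (Fin m → Code n) ]
    (∀ i → P (c i))
    × (∀ i j → Equivalent (c i) (c j) → i ≡ j)
    × (∀ D → P D → ∃[ i ] Equivalent (c i) D)

{-# OPTIONS --safe #-}
module Submission where

-- Read codewords as vectors of signs. With distances 8, 12, 16 and 20, the linear programming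
-- bound given by (t - 4)(t + 4)(t + 12) is exactly 256 (LinearProgramming). Equality makes all
-- character sums of weight 1, 2 and 3 vanish. It follows that every codeword has exactly five
-- codewords at distance 16, and that the squares of the character sums of weight four have
-- total 5 * 256 * 256.
--
-- The complement of the difference of two codewords at distance 16 is a tetrad, a set of four
-- coordinates. The five tetrads of a codeword are disjoint, because the minimum distance is 8.
-- Differences of codewords meet a tetrad evenly, because all distances are divisible by 4;
-- hence the square of the character sum of each tetrad is 256 * 256. By the total above, all
-- codewords have the same five tetrads (tetrads-agree), and adding the complement of a tetrad
-- to a codeword gives a codeword. After an isometry the code contains the zero word and the
-- tetrads are five consecutive blocks of coordinates (normalise).
--
-- A word that is even on each block consists of a glue vector of five labels, namely the classes
-- of even words of length four modulo complementation, and of five signs. Codewords with the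
-- same glue have the same parity of signs, and distinct glue vectors of codewords have Hamming
-- distance exactly 4 (different-glue⇒hamming-4). Counting gives sixteen glue vectors, which are
-- determined by any values of their first two labels (fill). Permuting the blocks and the
-- labels turns them into the shortened hexacode over the field of four elements. So every code
-- is equivalent to a code codeOf f, where f is a function from the shortened hexacode to the
-- field of two elements which prescribes the parity of the signs (good⇒codeOf); conversely all
-- codes codeOf f have the required parameters (codeOf-good).
--
-- Translations and permutations inside the blocks add an affine function to f, and the affine
-- semilinear group of the shortened hexacode acts on f (affine-≈, translate-≈, automorphism-≈).
-- Modulo affine functions 2048 functions remain. A list of sixteen group elements lowers each of
-- them, as a binary number, until one of fifteen representatives is reached (reducible,
-- classification).
--
-- Conversely, an equivalence between codeOf f and codeOf g preserves distance 16, hence the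
-- blocks, and induces a bijection of the glue vectors. This bijection preserves the sums of f
-- over quadruples with sum zero and the triples that agree in some block. The number of triples
-- that extend to a quadruple of odd sum, with larger weight for those that agree in some block,
-- is therefore an invariant (Comparison), and it takes distinct values at the representatives.

open import Data.Bool using (Bool; true; false; T; if_then_else_; _∧_; _∨_)
open import Data.Bool.Properties using (T-irrelevant)
open import Data.Empty using (⊥; ⊥-elim)
open import Data.Fin using (Fin; zero; suc; _≟_; toℕ; _↑ˡ_; _↑ʳ_; combine; quotient; remainder)
open import Data.Fin.Patterns using (0F; 1F; 2F; 3F; 4F)
import Data.Fin.Permutation as Perm
open import Data.Fin.Permutation using (Permutation′; _⟨$⟩ʳ_; _⟨$⟩ˡ_; permutation; flip; _∘ₚ_; inverseˡ; inverseʳ; transpose)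
import Data.Fin.Properties as Finₚ
open import Data.Fin.Properties using (any?; all?; remQuot-combine; combine-remQuot)
open import Data.Integer as ℤ using (ℤ; +_; -[1+_]) renaming (_+_ to _+ᶻ_; _*_ to _*ᶻ_; _-_ to _-ᶻ_; _≤_ to _≤ᶻ_)
import Data.Integer.Properties as ℤₚ
open import Data.Integer.Tactic.RingSolver using (solve-∀)
open import Data.Nat as ℕ using (ℕ; zero; suc; z≤n; s≤s; _≤?_)
open import Data.Nat.Divisibility using (_∣_; _∣?_; divides; ∣-trans; ∣m+n∣m⇒∣n; ∣m∣n⇒∣m+n; *-cancelˡ-∣)
import Data.Nat.Properties as ℕₚ
open import Data.Nat.Tactic.RingSolver using () renaming (solve-∀ to solveℕ-∀)
open import Data.Product using (Σ-syntax; ∃-syntax; _×_; _,_; proj₁; proj₂)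
open import Data.Sum using (_⊎_; inj₁; inj₂)
open import Data.Vec using (Vec; []; _∷_; head; tail; lookup; tabulate; zipWith; replicate)
open import Data.Vec.Properties using (≡-dec; zipWith-assoc; zipWith-comm; zipWith-identityˡ; lookup-zipWith; lookup∘tabulate; tabulate∘lookup; tabulate-cong; lookup-replicate)
open import Function using (_∘_; Injective)
open import Function.Bundles using (_⇔_; mk⇔; mk↔ₛ′; Equivalence; Inverse)
open import Relation.Binary.PropositionalEquality using (_≡_; _≢_; refl; sym; trans; cong; cong₂; subst; subst₂)
open import Relation.Nullary using (¬_; Dec; yes; no; does; contradiction)
open import Relation.Nullary.Decidable using (from-yes; from-no; _×-dec_; _⊎-dec_; _→-dec_; ¬?; dec-true; does-⇔)
import Algebra.Properties.CommutativeMonoid.Sum ℕₚ.+-0-commutativeMonoid as ℕΣ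
import Algebra.Properties.Semiring.Sum ℤₚ.+-*-semiring as ℤΣ
open import Defs


-- Characters and Krawtchouk polynomials

opaque
  -- Finite sums of integers. They are opaque because most of them have 256 terms,
  -- which must never be written out.
  ∑ : ∀ {n} → (Fin n → ℤ) → ℤ
  ∑ = ℤΣ.sum

  ∑-empty : (f : Fin 0 → ℤ) → ∑ f ≡ + 0
  ∑-empty f = refl

  ∑-suc : ∀ {n} (f : Fin (suc n) → ℤ) → ∑ f ≡ f zero +ᶻ ∑ (f ∘ suc)
  ∑-suc f = refl

  ∑-cong : ∀ {n} {f g : Fin n → ℤ} → (∀ i → f i ≡ g i) → ∑ f ≡ ∑ g
  ∑-cong = ℤΣ.sum-cong-≗

  ∑-+ : ∀ {n} (f g : Fin n → ℤ) → ∑ (λ i → f i +ᶻ g i) ≡ ∑ f +ᶻ ∑ g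
  ∑-+ = ℤΣ.∑-distrib-+

  ∑-*ˡ : ∀ {n} c (f : Fin n → ℤ) → ∑ (λ i → c *ᶻ f i) ≡ c *ᶻ ∑ f
  ∑-*ˡ c f = sym (ℤΣ.*-distribˡ-sum c f)

  ∑-*ʳ : ∀ {n} c (f : Fin n → ℤ) → ∑ (λ i → f i *ᶻ c) ≡ ∑ f *ᶻ c
  ∑-*ʳ c f = sym (ℤΣ.*-distribʳ-sum c f)

  ∑-zero : ∀ n → ∑ {n} (λ _ → + 0) ≡ + 0
  ∑-zero = ℤΣ.sum-replicate-zero

infixl 6 _⊕_ _⊞_

-- Addition in the field of two elements, and coordinatewise addition of words
_⊕_ : 𝔽₂ → 𝔽₂ → 𝔽₂
0F ⊕ b = b
1F ⊕ 0F = 1F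
1F ⊕ 1F = 0F

_⊞_ : ∀ {n} → Word n → Word n → Word n
_⊞_ = zipWith _⊕_

-- The Hamming weight
wt : ∀ {n} → Word n → ℕ
wt [] = 0
wt (0F ∷ w) = wt w
wt (1F ∷ w) = suc (wt w)

sgn : 𝔽₂ → ℤ
sgn 0F = + 1
sgn 1F = -[1+ 0 ]

-- The character χ x w is the sign of the inner product of x and w.
χ : ∀ {n} → Word n → Word n → ℤ
χ [] [] = + 1
χ (0F ∷ x) (_ ∷ w) = χ x w
χ (1F ∷ x) (b ∷ w) = sgn b *ᶻ χ x w

opaque
  -- The sum of F over all words of weight k, that is, over all k-element subsets
  -- of the coordinates
  ∑⊆ : (k : ℕ) {n : ℕ} → (Word n → ℤ) → ℤ
  ∑⊆ zero {n} F = F (replicate n 0F)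
  ∑⊆ (suc k) {zero} F = + 0
  ∑⊆ (suc k) {suc n} F = ∑⊆ k (F ∘ (1F ∷_)) +ᶻ ∑⊆ (suc k) (F ∘ (0F ∷_))

-- The sum of the entries of w read as signs, n minus twice the weight of w
trace : ∀ {n} → Word n → ℤ
trace [] = + 0
trace (b ∷ w) = sgn b +ᶻ trace w

-- The k-th elementary symmetric function of the entries of w read as signs, which is
-- the Krawtchouk polynomial of degree k at the weight of w
Kr : ℕ → ∀ {n} → Word n → ℤ
Kr k w = ∑⊆ k (λ x → χ x w)

opaque
  unfolding ∑⊆

  ∑⊆-cong : ∀ k {n} {F G : Word n → ℤ} → (∀ x → wt x ≡ k → F x ≡ G x) → ∑⊆ k F ≡ ∑⊆ k G
  ∑⊆-cong zero {n} h = h _ (wt-0 n)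
    where
    wt-0 : ∀ n → wt (replicate n 0F) ≡ 0
    wt-0 zero = refl
    wt-0 (suc n) = wt-0 n
  ∑⊆-cong (suc k) {zero} h = refl
  ∑⊆-cong (suc k) {suc n} h =
    cong₂ _+ᶻ_ (∑⊆-cong k {n} λ x e → h (1F ∷ x) (cong suc e)) (∑⊆-cong (suc k) {n} λ x e → h (0F ∷ x) e)

  ∑⊆-*ˡ : ∀ k {n} c (F : Word n → ℤ) → ∑⊆ k (λ x → c *ᶻ F x) ≡ c *ᶻ ∑⊆ k F
  ∑⊆-*ˡ zero c F = refl
  ∑⊆-*ˡ (suc k) {zero} c F = sym (ℤₚ.*-zeroʳ c)
  ∑⊆-*ˡ (suc k) {suc n} c F =
    trans (cong₂ _+ᶻ_ (∑⊆-*ˡ k c (F ∘ (1F ∷_))) (∑⊆-*ˡ (suc k) c (F ∘ (0F ∷_)))) (sym (ℤₚ.*-distribˡ-+ c _ _))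

  ∑⊆-0 : ∀ k {n} → ∑⊆ k {n} (λ _ → + 0) ≡ + 0
  ∑⊆-0 zero = refl
  ∑⊆-0 (suc k) {zero} = refl
  ∑⊆-0 (suc k) {suc n} = cong₂ _+ᶻ_ (∑⊆-0 k {n}) (∑⊆-0 (suc k) {n})

  ∑⊆-mono : ∀ k {n} {F G : Word n → ℤ} → (∀ x → F x ≤ᶻ G x) → ∑⊆ k F ≤ᶻ ∑⊆ k G
  ∑⊆-mono zero h = h _
  ∑⊆-mono (suc k) {zero} h = ℤₚ.≤-refl
  ∑⊆-mono (suc k) {suc n} h = ℤₚ.+-mono-≤ (∑⊆-mono k {n} λ x → h (1F ∷ x)) (∑⊆-mono (suc k) {n} λ x → h (0F ∷ x))

  ∑-∑⊆-comm : ∀ {m} k {n} (F : Fin m → Word n → ℤ) →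
              ∑ (λ a → ∑⊆ k (F a)) ≡ ∑⊆ k (λ x → ∑ (λ a → F a x))
  ∑-∑⊆-comm zero F = refl
  ∑-∑⊆-comm {m} (suc k) {zero} F = ∑-zero m
  ∑-∑⊆-comm (suc k) {suc n} F =
    trans (∑-+ (λ a → ∑⊆ k (F a ∘ (1F ∷_))) (λ a → ∑⊆ (suc k) (F a ∘ (0F ∷_))))
          (cong₂ _+ᶻ_ (∑-∑⊆-comm k (λ a → F a ∘ (1F ∷_))) (∑-∑⊆-comm (suc k) (λ a → F a ∘ (0F ∷_))))

sgn-⊕ : ∀ a b → sgn (a ⊕ b) ≡ sgn a *ᶻ sgn b
sgn-⊕ 0F 0F = refl
sgn-⊕ 0F 1F = refl
sgn-⊕ 1F 0F = refl
sgn-⊕ 1F 1F = refl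

interchange : ∀ a b c d → (a *ᶻ b) *ᶻ (c *ᶻ d) ≡ (a *ᶻ c) *ᶻ (b *ᶻ d)
interchange = solve-∀

χ-⊞ : ∀ {n} (x u v : Word n) → χ x (u ⊞ v) ≡ χ x u *ᶻ χ x v
χ-⊞ [] [] [] = refl
χ-⊞ (0F ∷ x) (_ ∷ u) (_ ∷ v) = χ-⊞ x u v
χ-⊞ (1F ∷ x) (a ∷ u) (b ∷ v) =
  trans (cong₂ _*ᶻ_ (sgn-⊕ a b) (χ-⊞ x u v)) (interchange (sgn a) (sgn b) (χ x u) (χ x v))

χ-0 : ∀ n (w : Word n) → χ (replicate n 0F) w ≡ + 1
χ-0 zero [] = refl
χ-0 (suc n) (_ ∷ w) = χ-0 n w

opaque
  unfolding ∑⊆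

  Kr-∷ : ∀ k {n} b (w : Word n) → Kr (suc k) (b ∷ w) ≡ sgn b *ᶻ Kr k w +ᶻ Kr (suc k) w
  Kr-∷ k b w = cong (ℤ._+ Kr (suc k) w) (∑⊆-*ˡ k (sgn b) (λ x → χ x w))

  Kr₁ : ∀ {n} (w : Word n) → Kr 1 w ≡ trace w
  Kr₁ [] = refl
  Kr₁ {suc n} (b ∷ w) = trans (Kr-∷ 0 b w)
    (cong₂ _+ᶻ_ (trans (cong (sgn b *ᶻ_) (χ-0 n w)) (ℤₚ.*-identityʳ (sgn b))) (Kr₁ w))


  -- Newton's identities express Kr 2, Kr 3 and Kr 4 by the power sum trace w,
  -- because the square of a sign is 1.
  Kr₂ : ∀ {n} (w : Word n) → + 2 *ᶻ Kr 2 w ≡ trace w *ᶻ trace w -ᶻ + n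
  Kr₂ {zero} [] = refl
  Kr₂ {suc n} (b ∷ w) rewrite Kr-∷ 1 b w | Kr₁ w =
    trans (ℤₚ.*-distribˡ-+ (+ 2) (sgn b *ᶻ trace w) (Kr 2 w))
    (trans (cong (+ 2 *ᶻ (sgn b *ᶻ trace w) +ᶻ_) (Kr₂ w)) (alg b (trace w) (+ n)))
    where
    alg : ∀ b t m → + 2 *ᶻ (sgn b *ᶻ t) +ᶻ (t *ᶻ t -ᶻ m) ≡ (sgn b +ᶻ t) *ᶻ (sgn b +ᶻ t) -ᶻ (+ 1 +ᶻ m)
    alg 0F = solve-∀
    alg 1F = solve-∀

  Kr₃ : ∀ {n} (w : Word n) →
        + 6 *ᶻ Kr 3 w ≡ trace w *ᶻ trace w *ᶻ trace w -ᶻ (+ 3 *ᶻ + n -ᶻ + 2) *ᶻ trace w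
  Kr₃ [] = refl
  Kr₃ {suc n} (b ∷ w) rewrite Kr-∷ 2 b w =
    trans (pre (sgn b) (Kr 2 w) (Kr 3 w))
    (trans (cong₂ (λ x y → + 3 *ᶻ sgn b *ᶻ x +ᶻ y) (Kr₂ w) (Kr₃ w)) (alg b (trace w) (+ n)))
    where
    pre : ∀ s x y → + 6 *ᶻ (s *ᶻ x +ᶻ y) ≡ + 3 *ᶻ s *ᶻ (+ 2 *ᶻ x) +ᶻ + 6 *ᶻ y
    pre = solve-∀
    alg : ∀ b t m → + 3 *ᶻ sgn b *ᶻ (t *ᶻ t -ᶻ m) +ᶻ (t *ᶻ t *ᶻ t -ᶻ (+ 3 *ᶻ m -ᶻ + 2) *ᶻ t) ≡
          (sgn b +ᶻ t) *ᶻ (sgn b +ᶻ t) *ᶻ (sgn b +ᶻ t) -ᶻ (+ 3 *ᶻ (+ 1 +ᶻ m) -ᶻ + 2) *ᶻ (sgn b +ᶻ t)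
    alg 0F = solve-∀
    alg 1F = solve-∀

  Kr₄ : ∀ {n} (w : Word n) →
        + 24 *ᶻ Kr 4 w ≡ trace w *ᶻ trace w *ᶻ trace w *ᶻ trace w -ᶻ (+ 6 *ᶻ + n -ᶻ + 8) *ᶻ (trace w *ᶻ trace w)
                         +ᶻ (+ 3 *ᶻ (+ n *ᶻ + n) -ᶻ + 6 *ᶻ + n)
  Kr₄ [] = refl
  Kr₄ {suc n} (b ∷ w) rewrite Kr-∷ 3 b w =
    trans (pre (sgn b) (Kr 3 w) (Kr 4 w))
    (trans (cong₂ (λ x y → + 4 *ᶻ sgn b *ᶻ x +ᶻ y) (Kr₃ w) (Kr₄ w)) (alg b (trace w) (+ n)))
    where
    pre : ∀ s x y → + 24 *ᶻ (s *ᶻ x +ᶻ y) ≡ + 4 *ᶻ s *ᶻ (+ 6 *ᶻ x) +ᶻ + 24 *ᶻ y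
    pre = solve-∀
    alg : ∀ b t m → + 4 *ᶻ sgn b *ᶻ (t *ᶻ t *ᶻ t -ᶻ (+ 3 *ᶻ m -ᶻ + 2) *ᶻ t) +ᶻ
            (t *ᶻ t *ᶻ t *ᶻ t -ᶻ (+ 6 *ᶻ m -ᶻ + 8) *ᶻ (t *ᶻ t) +ᶻ (+ 3 *ᶻ (m *ᶻ m) -ᶻ + 6 *ᶻ m)) ≡
          (sgn b +ᶻ t) *ᶻ (sgn b +ᶻ t) *ᶻ (sgn b +ᶻ t) *ᶻ (sgn b +ᶻ t)
            -ᶻ (+ 6 *ᶻ (+ 1 +ᶻ m) -ᶻ + 8) *ᶻ ((sgn b +ᶻ t) *ᶻ (sgn b +ᶻ t))
            +ᶻ (+ 3 *ᶻ ((+ 1 +ᶻ m) *ᶻ (+ 1 +ᶻ m)) -ᶻ + 6 *ᶻ (+ 1 +ᶻ m))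
    alg 0F = solve-∀
    alg 1F = solve-∀


-- The dual distance distribution

∑-mono : ∀ {m} {f g : Fin m → ℤ} → (∀ i → f i ≤ᶻ g i) → ∑ f ≤ᶻ ∑ g
∑-mono {zero} {f} {g} h = ℤₚ.≤-reflexive (trans (∑-empty f) (sym (∑-empty g)))
∑-mono {suc m} {f} {g} h =
  subst₂ _≤ᶻ_ (sym (∑-suc f)) (sym (∑-suc g)) (ℤₚ.+-mono-≤ (h zero) (∑-mono (h ∘ suc)))

∑-const : ∀ m c → ∑ {m} (λ _ → c) ≡ + m *ᶻ c
∑-const zero c = trans (∑-empty (λ _ → c)) (sym (ℤₚ.*-zeroˡ c))
∑-const (suc m) c = trans (∑-suc {m} (λ _ → c)) (trans (cong (c +ᶻ_) (∑-const m c)) (sym (ℤₚ.suc-* (+ m) c)))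

∑-lin : ∀ {m} p q r s (A B C : Fin m → ℤ) →
        ∑ (λ i → p *ᶻ A i +ᶻ q *ᶻ B i +ᶻ r *ᶻ C i +ᶻ s) ≡ p *ᶻ ∑ A +ᶻ q *ᶻ ∑ B +ᶻ r *ᶻ ∑ C +ᶻ + m *ᶻ s
∑-lin {m} p q r s A B C =
  trans (∑-+ (λ i → p *ᶻ A i +ᶻ q *ᶻ B i +ᶻ r *ᶻ C i) (λ _ → s)) (cong₂ _+ᶻ_
    (trans (∑-+ (λ i → p *ᶻ A i +ᶻ q *ᶻ B i) (λ i → r *ᶻ C i)) (cong₂ _+ᶻ_
      (trans (∑-+ (λ i → p *ᶻ A i) (λ i → q *ᶻ B i))
        (cong₂ _+ᶻ_ ((∑-*ˡ p A)) ((∑-*ˡ q B))))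
      ((∑-*ˡ r C))))
    (∑-const m s))

-- The integer 1 if the property holds, and 0 otherwise
indicator : ∀ {ℓ} {P : Set ℓ} → Dec P → ℤ
indicator d = if does d then + 1 else + 0

∑-indicator : ∀ {m} (a : Fin m) → ∑ (λ b → indicator (a ≟ b)) ≡ + 1
∑-indicator {suc m} zero = trans (∑-suc {m} (λ b → indicator (zero ≟ b))) (cong (+ 1 +ᶻ_) (∑-zero m))
∑-indicator {suc m} (suc a) =
  trans (∑-suc {m} (λ b → indicator (suc a ≟ b))) (trans (ℤₚ.+-identityˡ _) (∑-indicator a))

∑⊆-nonNeg : ∀ k {n} {F : Word n → ℤ} → (∀ x → + 0 ≤ᶻ F x) → + 0 ≤ᶻ ∑⊆ k F
∑⊆-nonNeg k {n} {F} h = subst (_≤ᶻ ∑⊆ k F) (∑⊆-0 k {n}) (∑⊆-mono k h)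

sum-of-nonNeg-zero : ∀ {x y} → + 0 ≤ᶻ x → + 0 ≤ᶻ y → x +ᶻ y ≤ᶻ + 0 → x ≡ + 0 × y ≡ + 0
sum-of-nonNeg-zero {x} {y} 0≤x 0≤y h =
  ℤₚ.≤-antisym (ℤₚ.≤-trans (subst (_≤ᶻ x +ᶻ y) (ℤₚ.+-identityʳ x) (ℤₚ.+-monoʳ-≤ x 0≤y)) h) 0≤x ,
  ℤₚ.≤-antisym (ℤₚ.≤-trans (subst (_≤ᶻ x +ᶻ y) (ℤₚ.+-identityˡ y) (ℤₚ.+-monoˡ-≤ y 0≤x)) h) 0≤y

opaque
  unfolding ∑⊆

  ∑⊆-zero⁻¹ : ∀ k {n} {F : Word n → ℤ} → (∀ x → + 0 ≤ᶻ F x) → ∑⊆ k F ≤ᶻ + 0 → ∀ x → wt x ≡ k → F x ≡ + 0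
  ∑⊆-zero⁻¹ zero {n} {F} F≥0 h x e = trans (cong F (wt≡0 x e)) (ℤₚ.≤-antisym h (F≥0 _))
    where
    wt≡0 : ∀ {n} (x : Word n) → wt x ≡ 0 → x ≡ replicate n 0F
    wt≡0 [] _ = refl
    wt≡0 (0F ∷ x) e = cong (0F ∷_) (wt≡0 x e)
    wt≡0 (1F ∷ x) ()
  ∑⊆-zero⁻¹ (suc k) {suc n} F≥0 h (b ∷ x) e
    with sum-of-nonNeg-zero (∑⊆-nonNeg k (F≥0 ∘ (1F ∷_))) (∑⊆-nonNeg (suc k) (F≥0 ∘ (0F ∷_))) h
  ∑⊆-zero⁻¹ (suc k) F≥0 h (0F ∷ x) e | _ , h₀ = ∑⊆-zero⁻¹ (suc k) (F≥0 ∘ (0F ∷_)) (ℤₚ.≤-reflexive h₀) x e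
  ∑⊆-zero⁻¹ (suc k) F≥0 h (1F ∷ x) e | h₁ , _ =
    ∑⊆-zero⁻¹ k (F≥0 ∘ (1F ∷_)) (ℤₚ.≤-reflexive h₁) x (ℕₚ.suc-injective e)

square-nonNeg : ∀ i → + 0 ≤ᶻ i *ᶻ i
square-nonNeg (+ m) = subst (+ 0 ≤ᶻ_) (ℤₚ.pos-* m m) (ℤ.+≤+ z≤n)
square-nonNeg -[1+ m ] = ℤ.+≤+ z≤n

scaled-zero : ∀ c {x} .{{_ : ℤ.NonZero c}} → c *ᶻ x ≡ + 0 → x ≡ + 0
scaled-zero c {x} h = ℤₚ.*-cancelˡ-≡ c x (+ 0) (trans h (sym (ℤₚ.*-zeroʳ c)))

square-zero : ∀ i → i *ᶻ i ≡ + 0 → i ≡ + 0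
square-zero i h with ℤₚ.i*j≡0⇒i≡0∨j≡0 i h
... | inj₁ e = e
... | inj₂ e = e

module _ {m n : ℕ} (cw : Fin m → Word n) where

  -- The character sum over the code; its square is the contribution of x to the
  -- dual distance distribution.
  charSum : Word n → ℤ
  charSum x = ∑ (λ a → χ x (cw a))

  -- The contribution of one fixed word u to the transform of the distance distribution
  row-sum : ∀ k u → ∑ (λ b → Kr k (u ⊞ cw b)) ≡ ∑⊆ k (λ x → χ x u *ᶻ charSum x)
  row-sum k u = trans (∑-∑⊆-comm k (λ b x → χ x (u ⊞ cw b)))
    (∑⊆-cong k λ x _ → trans (∑-cong (λ b → χ-⊞ x u (cw b)))
                             ((∑-*ˡ (χ x u) (λ b → χ x (cw b)))))

  -- The MacWilliams transform of the distance distribution is a sum of squares.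
  gram-sum : ∀ k → ∑ (λ a → ∑ (λ b → Kr k (cw a ⊞ cw b))) ≡ ∑⊆ k (λ x → charSum x *ᶻ charSum x)
  gram-sum k = trans (∑-cong (λ a → row-sum k (cw a)))
    (trans (∑-∑⊆-comm k (λ a x → χ x (cw a) *ᶻ charSum x))
           (∑⊆-cong k λ x _ → (∑-*ʳ (charSum x) (λ a → χ x (cw a)))))

  gram-sum-nonNeg : ∀ k → + 0 ≤ᶻ ∑ (λ a → ∑ (λ b → Kr k (cw a ⊞ cw b)))
  gram-sum-nonNeg k = subst (+ 0 ≤ᶻ_) (sym (gram-sum k)) (∑⊆-nonNeg k λ x → square-nonNeg (charSum x))

  charSum-zero : ∀ k → ∑ (λ a → ∑ (λ b → Kr k (cw a ⊞ cw b))) ≡ + 0 → ∀ x → wt x ≡ k → charSum x ≡ + 0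
  charSum-zero k h x e = square-zero _
    (∑⊆-zero⁻¹ k (λ x → square-nonNeg (charSum x)) (ℤₚ.≤-reflexive (trans (sym (gram-sum k)) h)) x e)

  row-sum-zero : ∀ k → ∑ (λ a → ∑ (λ b → Kr k (cw a ⊞ cw b))) ≡ + 0 → ∀ u → ∑ (λ b → Kr k (u ⊞ cw b)) ≡ + 0
  row-sum-zero k h u = trans (row-sum k u)
    (trans (∑⊆-cong k λ x e → trans (cong (χ x u *ᶻ_) (charSum-zero k h x e)) (ℤₚ.*-zeroʳ (χ x u))) (∑⊆-0 k {n}))

-- Inner products of codewords as sign vectors take the values 20, 4, -4, -12 and -20.
-- F vanishes at 4, -4, -12 and is negative at -20; G vanishes at all of them except
-- 20 and -12; H vanishes at all of them except 20.
F-poly G-poly H-poly : ℤ → ℤ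
F-poly t = (t -ᶻ + 4) *ᶻ (t +ᶻ + 4) *ᶻ (t +ᶻ + 12)
G-poly t = (t -ᶻ + 4) *ᶻ (t +ᶻ + 4) *ᶻ (t +ᶻ + 20)
H-poly t = (t -ᶻ + 4) *ᶻ (t +ᶻ + 4) *ᶻ (t +ᶻ + 12) *ᶻ (t +ᶻ + 20)

-- All coefficients are positive, and F-poly 20 is 256 times the constant one: the linear
-- programming bound is 256.
F-expansion : ∀ (w : Word 20) →
  + 6 *ᶻ Kr 3 w +ᶻ + 24 *ᶻ Kr 2 w +ᶻ + 42 *ᶻ Kr 1 w +ᶻ + 48 ≡ F-poly (trace w)
F-expansion w = trans (pre (Kr 3 w) (Kr 2 w) (Kr 1 w))
  (trans (cong (λ p → p +ᶻ + 12 *ᶻ (+ 2 *ᶻ Kr 2 w) +ᶻ + 42 *ᶻ Kr 1 w +ᶻ + 48) (Kr₃ w))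
  (trans (cong₂ (λ p q → (t *ᶻ t *ᶻ t -ᶻ + 58 *ᶻ t) +ᶻ + 12 *ᶻ p +ᶻ + 42 *ᶻ q +ᶻ + 48) (Kr₂ w) (Kr₁ w)) (post t)))
  where
  t : ℤ
  t = trace w
  pre : ∀ x y z → + 6 *ᶻ x +ᶻ + 24 *ᶻ y +ᶻ + 42 *ᶻ z +ᶻ + 48 ≡ + 6 *ᶻ x +ᶻ + 12 *ᶻ (+ 2 *ᶻ y) +ᶻ + 42 *ᶻ z +ᶻ + 48
  pre = solve-∀
  post : ∀ t → (t *ᶻ t *ᶻ t -ᶻ + 58 *ᶻ t) +ᶻ + 12 *ᶻ (t *ᶻ t -ᶻ + 20) +ᶻ + 42 *ᶻ t +ᶻ + 48 ≡
               (t -ᶻ + 4) *ᶻ (t +ᶻ + 4) *ᶻ (t +ᶻ + 12)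
  post = solve-∀

G-expansion : ∀ (w : Word 20) →
  + 6 *ᶻ Kr 3 w +ᶻ + 40 *ᶻ Kr 2 w +ᶻ + 42 *ᶻ Kr 1 w +ᶻ + 80 ≡ G-poly (trace w)
G-expansion w = trans (pre (Kr 3 w) (Kr 2 w) (Kr 1 w))
  (trans (cong (λ p → p +ᶻ + 20 *ᶻ (+ 2 *ᶻ Kr 2 w) +ᶻ + 42 *ᶻ Kr 1 w +ᶻ + 80) (Kr₃ w))
  (trans (cong₂ (λ p q → (t *ᶻ t *ᶻ t -ᶻ + 58 *ᶻ t) +ᶻ + 20 *ᶻ p +ᶻ + 42 *ᶻ q +ᶻ + 80) (Kr₂ w) (Kr₁ w)) (post t)))
  where
  t : ℤ
  t = trace w
  pre : ∀ x y z → + 6 *ᶻ x +ᶻ + 40 *ᶻ y +ᶻ + 42 *ᶻ z +ᶻ + 80 ≡ + 6 *ᶻ x +ᶻ + 20 *ᶻ (+ 2 *ᶻ y) +ᶻ + 42 *ᶻ z +ᶻ + 80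
  pre = solve-∀
  post : ∀ t → (t *ᶻ t *ᶻ t -ᶻ + 58 *ᶻ t) +ᶻ + 20 *ᶻ (t *ᶻ t -ᶻ + 20) +ᶻ + 42 *ᶻ t +ᶻ + 80 ≡
               (t -ᶻ + 4) *ᶻ (t +ᶻ + 4) *ᶻ (t +ᶻ + 20)
  post = solve-∀

H-expansion : ∀ (w : Word 20) →
  + 1 *ᶻ (+ 24 *ᶻ Kr 4 w +ᶻ + 192 *ᶻ Kr 3 w) +ᶻ + 672 *ᶻ Kr 2 w +ᶻ + 1344 *ᶻ Kr 1 w +ᶻ + 1800 ≡ H-poly (trace w)
H-expansion w = trans (pre (Kr 4 w) (Kr 3 w) (Kr 2 w) (Kr 1 w))
  (trans (cong₂ (λ p q → p +ᶻ + 32 *ᶻ q +ᶻ + 336 *ᶻ (+ 2 *ᶻ Kr 2 w) +ᶻ + 1344 *ᶻ Kr 1 w +ᶻ + 1800) (Kr₄ w) (Kr₃ w))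
  (trans (cong₂ (λ p q → (t *ᶻ t *ᶻ t *ᶻ t -ᶻ + 112 *ᶻ (t *ᶻ t) +ᶻ + 1080) +ᶻ + 32 *ᶻ (t *ᶻ t *ᶻ t -ᶻ + 58 *ᶻ t)
                         +ᶻ + 336 *ᶻ p +ᶻ + 1344 *ᶻ q +ᶻ + 1800) (Kr₂ w) (Kr₁ w)) (post t)))
  where
  t : ℤ
  t = trace w
  pre : ∀ u x y z → + 1 *ᶻ (+ 24 *ᶻ u +ᶻ + 192 *ᶻ x) +ᶻ + 672 *ᶻ y +ᶻ + 1344 *ᶻ z +ᶻ + 1800 ≡
                    + 24 *ᶻ u +ᶻ + 32 *ᶻ (+ 6 *ᶻ x) +ᶻ + 336 *ᶻ (+ 2 *ᶻ y) +ᶻ + 1344 *ᶻ z +ᶻ + 1800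
  pre = solve-∀
  post : ∀ t → (t *ᶻ t *ᶻ t *ᶻ t -ᶻ + 112 *ᶻ (t *ᶻ t) +ᶻ + 1080) +ᶻ + 32 *ᶻ (t *ᶻ t *ᶻ t -ᶻ + 58 *ᶻ t)
               +ᶻ + 336 *ᶻ (t *ᶻ t -ᶻ + 20) +ᶻ + 1344 *ᶻ t +ᶻ + 1800 ≡
               (t -ᶻ + 4) *ᶻ (t +ᶻ + 4) *ᶻ (t +ᶻ + 12) *ᶻ (t +ᶻ + 20)
  post = solve-∀


-- The linear programming bound and the case of equality

-- The possible inner products of distinct codewords, for the distances 8, 12, 16 and 20
AllowedTrace : ℤ → Set
AllowedTrace t = t ≡ + 4 ⊎ t ≡ ℤ.- + 4 ⊎ t ≡ ℤ.- + 12 ⊎ t ≡ ℤ.- + 20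

nonNeg-*ˡ : ∀ c {x} → + 0 ≤ᶻ x → + 0 ≤ᶻ + c *ᶻ x
nonNeg-*ˡ c {x} h = subst (_≤ᶻ + c *ᶻ x) (ℤₚ.*-zeroʳ (+ c)) (ℤₚ.*-monoˡ-≤-nonNeg (+ c) h)

+-cancel-right : ∀ x c → x +ᶻ c -ᶻ c ≡ x
+-cancel-right = solve-∀

≤-cancel-right : ∀ {x c} → x +ᶻ c ≤ᶻ c → x ≤ᶻ + 0
≤-cancel-right {x} {c} h = subst₂ _≤ᶻ_ (+-cancel-right x c) (ℤₚ.+-inverseʳ c) (ℤₚ.+-monoˡ-≤ (ℤ.- c) h)

three-zero : ∀ {x y z c} → + 0 ≤ᶻ x → + 0 ≤ᶻ y → + 0 ≤ᶻ z → + 6 *ᶻ x +ᶻ + 24 *ᶻ y +ᶻ + 42 *ᶻ z +ᶻ c ≤ᶻ c →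
             x ≡ + 0 × y ≡ + 0 × z ≡ + 0
three-zero 0≤x 0≤y 0≤z h
  with pq , r ← sum-of-nonNeg-zero (ℤₚ.+-mono-≤ (nonNeg-*ˡ 6 0≤x) (nonNeg-*ˡ 24 0≤y)) (nonNeg-*ˡ 42 0≤z)
                  (≤-cancel-right h)
  with p , q ← sum-of-nonNeg-zero (nonNeg-*ˡ 6 0≤x) (nonNeg-*ˡ 24 0≤y) (ℤₚ.≤-reflexive pq)
  = scaled-zero (+ 6) p , scaled-zero (+ 24) q , scaled-zero (+ 42) r

F-values : ∀ {ℓ} {P : Set ℓ} {t} (d : Dec P) → (P → t ≡ + 20) → (¬ P → AllowedTrace t) →
           F-poly t ≤ᶻ + 12288 *ᶻ indicator d
F-values (yes p) h _ = ℤₚ.≤-reflexive (cong F-poly (h p))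
F-values (no ¬p) _ h with h ¬p
... | inj₁ refl = ℤₚ.≤-refl
... | inj₂ (inj₁ refl) = ℤₚ.≤-refl
... | inj₂ (inj₂ (inj₁ refl)) = ℤₚ.≤-refl
... | inj₂ (inj₂ (inj₂ refl)) = ℤ.-≤+

G-values : ∀ {ℓ} {P : Set ℓ} {t} (d : Dec P) → (P → t ≡ + 20) → (¬ P → AllowedTrace t) →
           + 1024 *ᶻ indicator (t ℤ.≟ ℤ.- + 12) +ᶻ + 15360 *ᶻ indicator d ≡ G-poly t
G-values (yes p) h _ with refl ← h p = refl
G-values (no ¬p) _ h with h ¬p
... | inj₁ refl = refl
... | inj₂ (inj₁ refl) = refl
... | inj₂ (inj₂ (inj₁ refl)) = refl
... | inj₂ (inj₂ (inj₂ refl)) = refl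

H-values : ∀ {ℓ} {P : Set ℓ} {t} (d : Dec P) → (P → t ≡ + 20) → (¬ P → AllowedTrace t) →
           + 491520 *ᶻ indicator d ≡ H-poly t
H-values (yes p) h _ = cong H-poly (sym (h p))
H-values (no ¬p) _ h = zero-at (h ¬p)
  where
  zero-at : ∀ {t} → AllowedTrace t → + 491520 *ᶻ + 0 ≡ H-poly t
  zero-at (inj₁ refl) = refl
  zero-at (inj₂ (inj₁ refl)) = refl
  zero-at (inj₂ (inj₂ (inj₁ refl))) = refl
  zero-at (inj₂ (inj₂ (inj₂ refl))) = refl

-- The number of codewords is a variable m with a proof of m ≡ 256, so that sums over the
-- code stay symbolic.
module LinearProgramming
  {m : ℕ} (m≡256 : m ≡ 256)
  (cw : Fin m → Word 20)
  (trace-self : ∀ a → trace (cw a ⊞ cw a) ≡ + 20)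
  (trace-distinct : ∀ {a b} → a ≢ b → AllowedTrace (trace (cw a ⊞ cw b)))
  where

  tr : Fin m → Fin m → ℤ
  tr a b = trace (cw a ⊞ cw b)

  trace-equal : ∀ a b → a ≡ b → tr a b ≡ + 20
  trace-equal a _ refl = trace-self a

  -- The k-th entry of the dual distance distribution, up to normalisation
  gram : ℕ → ℤ
  gram k = ∑ (λ a → ∑ (λ b → Kr k (cw a ⊞ cw b)))

  S : Word 20 → ℤ
  S = charSum cw

  F-bound : ∀ a b → F-poly (tr a b) ≤ᶻ + 12288 *ᶻ indicator (a ≟ b)
  F-bound a b = F-values (a ≟ b) (trace-equal a b) trace-distinct

  double-lin : ∀ p q r s (A B C : Fin m → Fin m → ℤ) →
    ∑ (λ a → ∑ (λ b → p *ᶻ A a b +ᶻ q *ᶻ B a b +ᶻ r *ᶻ C a b +ᶻ s)) ≡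
    p *ᶻ ∑ (λ a → ∑ (A a)) +ᶻ q *ᶻ ∑ (λ a → ∑ (B a)) +ᶻ r *ᶻ ∑ (λ a → ∑ (C a)) +ᶻ + m *ᶻ (+ m *ᶻ s)
  double-lin p q r s A B C = trans (∑-cong (λ a → ∑-lin p q r s (A a) (B a) (C a)))
    (∑-lin p q r (+ m *ᶻ s) (λ a → ∑ (A a)) (λ a → ∑ (B a)) (λ a → ∑ (C a)))

  diagonal-sum : ∀ c → ∑ (λ a → ∑ (λ b → c *ᶻ indicator (a ≟ b))) ≡ + m *ᶻ c
  diagonal-sum c = trans
    (∑-cong {m} (λ a → trans ((∑-*ˡ c (λ b → indicator (a ≟ b))))
                             (trans (cong (c *ᶻ_) (∑-indicator a)) (ℤₚ.*-identityʳ c))))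
    (∑-const m c)

  -- Averaging F over all pairs of codewords: 3145728 is both 48 times 256 squared and
  -- 12288 times 256.
  lp-inequality : + 6 *ᶻ gram 3 +ᶻ + 24 *ᶻ gram 2 +ᶻ + 42 *ᶻ gram 1 +ᶻ + 3145728 ≤ᶻ + 3145728
  lp-inequality = ℤₚ.≤-trans (ℤₚ.≤-reflexive (trans
      (trans (cong (λ l → + 6 *ᶻ gram 3 +ᶻ + 24 *ᶻ gram 2 +ᶻ + 42 *ᶻ gram 1 +ᶻ + l *ᶻ (+ l *ᶻ + 48)) (sym m≡256))
             (sym (double-lin (+ 6) (+ 24) (+ 42) (+ 48) (K 3) (K 2) (K 1))))
      (∑-cong (λ a → ∑-cong (λ b → F-expansion (cw a ⊞ cw b))))))
    (ℤₚ.≤-trans (∑-mono (λ a → ∑-mono (F-bound a))) (ℤₚ.≤-reflexive (trans (diagonal-sum (+ 12288)) (cong (λ l → + l *ᶻ + 12288) m≡256))))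
    where
    K : ℕ → Fin m → Fin m → ℤ
    K k a b = Kr k (cw a ⊞ cw b)

  -- Equality holds, so the code is an orthogonal array of strength three.
  gram-zero : gram 3 ≡ + 0 × gram 2 ≡ + 0 × gram 1 ≡ + 0
  gram-zero = three-zero (gram-sum-nonNeg cw 3) (gram-sum-nonNeg cw 2) (gram-sum-nonNeg cw 1) lp-inequality

  row-zero : ∀ u → ∑ (λ b → Kr 3 (u ⊞ cw b)) ≡ + 0 × ∑ (λ b → Kr 2 (u ⊞ cw b)) ≡ + 0 × ∑ (λ b → Kr 1 (u ⊞ cw b)) ≡ + 0
  row-zero u = row-sum-zero cw 3 (proj₁ gram-zero) u ,
               row-sum-zero cw 2 (proj₁ (proj₂ gram-zero)) u ,
               row-sum-zero cw 1 (proj₂ (proj₂ gram-zero)) u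

  far? : ∀ a b → Dec (tr a b ≡ ℤ.- + 12)
  far? a b = tr a b ℤ.≟ ℤ.- + 12

  G-value : ∀ a b → + 1024 *ᶻ indicator (far? a b) +ᶻ + 15360 *ᶻ indicator (a ≟ b) ≡ G-poly (tr a b)
  G-value a b = G-values (a ≟ b) (trace-equal a b) trace-distinct

  -- Every codeword has exactly five codewords at distance 16: summing G over a row gives
  -- 80 * 256 = 20480 = 15360 + 1024 * 5.
  five-far : ∀ a → ∑ (λ b → indicator (far? a b)) ≡ + 5
  five-far a = ℤₚ.*-cancelˡ-≡ (+ 1024) far (+ 5) (cancel (trans (sym lhs) (trans
      (∑-cong (λ b → trans (G-value a b) (sym (G-expansion (cw a ⊞ cw b))))) rhs)))
    where
    far : ℤ
    far = ∑ (λ b → indicator (far? a b))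
    lhs : ∑ (λ b → + 1024 *ᶻ indicator (far? a b) +ᶻ + 15360 *ᶻ indicator (a ≟ b)) ≡ + 1024 *ᶻ far +ᶻ + 15360
    lhs = trans (∑-+ (λ b → + 1024 *ᶻ indicator (far? a b)) (λ b → + 15360 *ᶻ indicator (a ≟ b)))
      (cong₂ _+ᶻ_ ((∑-*ˡ (+ 1024) (λ b → indicator (far? a b))))
        (trans ((∑-*ˡ (+ 15360) (λ b → indicator (a ≟ b)))) (cong (+ 15360 *ᶻ_) (∑-indicator a))))
    rhs : ∑ (λ b → + 6 *ᶻ Kr 3 (cw a ⊞ cw b) +ᶻ + 40 *ᶻ Kr 2 (cw a ⊞ cw b) +ᶻ + 42 *ᶻ Kr 1 (cw a ⊞ cw b) +ᶻ + 80) ≡ + 20480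
    rhs = trans (∑-lin (+ 6) (+ 40) (+ 42) (+ 80)
                   (λ b → Kr 3 (cw a ⊞ cw b)) (λ b → Kr 2 (cw a ⊞ cw b)) (λ b → Kr 1 (cw a ⊞ cw b)))
      (trans (cong (rows +ᶻ_) (cong (λ l → + l *ᶻ + 80) m≡256)) (cong (_+ᶻ + 20480) (cong₂ _+ᶻ_
        (cong₂ _+ᶻ_ (cong (+ 6 *ᶻ_) (proj₁ (row-zero (cw a)))) (cong (+ 40 *ᶻ_) (proj₁ (proj₂ (row-zero (cw a))))))
        (cong (+ 42 *ᶻ_) (proj₂ (proj₂ (row-zero (cw a))))))))
      where
      rows : ℤ
      rows = + 6 *ᶻ ∑ (λ b → Kr 3 (cw a ⊞ cw b)) +ᶻ + 40 *ᶻ ∑ (λ b → Kr 2 (cw a ⊞ cw b)) +ᶻ + 42 *ᶻ ∑ (λ b → Kr 1 (cw a ⊞ cw b))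
    cancel : ∀ {x} → x +ᶻ + 15360 ≡ + 20480 → x ≡ + 1024 *ᶻ + 5
    cancel {x} h = trans (sym (+-cancel-right x (+ 15360))) (cong (_-ᶻ + 15360) h)

  H-value : ∀ a b → + 491520 *ᶻ indicator (a ≟ b) ≡ H-poly (tr a b)
  H-value a b = H-values (a ≟ b) (trace-equal a b) trace-distinct

  -- The characters of weight four have total mass 327680 = 5 * 65536.
  dual-weight-four : ∑⊆ 4 (λ x → S x *ᶻ S x) ≡ + 327680
  dual-weight-four = trans (sym (gram-sum cw 4)) (ℤₚ.*-cancelˡ-≡ (+ 24) (gram 4) (+ 327680) (cancel (trans (sym rhs) (trans
      (∑-cong (λ a → ∑-cong (λ b → trans (H-expansion (cw a ⊞ cw b)) (sym (H-value a b)))))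
      (trans (diagonal-sum (+ 491520)) (cong (λ l → + l *ᶻ + 491520) m≡256))))))
    where
    K : ℕ → Fin m → Fin m → ℤ
    K k a b = Kr k (cw a ⊞ cw b)
    K43 : Fin m → Fin m → ℤ
    K43 a b = + 24 *ᶻ K 4 a b +ᶻ + 192 *ᶻ K 3 a b
    g43 : ∑ (λ a → ∑ (K43 a)) ≡ + 24 *ᶻ gram 4
    g43 = trans (∑-cong {m} (λ a → trans
        (∑-+ (λ b → + 24 *ᶻ K 4 a b) (λ b → + 192 *ᶻ K 3 a b))
        (cong₂ _+ᶻ_ ((∑-*ˡ (+ 24) (K 4 a)))
          (trans ((∑-*ˡ (+ 192) (K 3 a))) (cong (+ 192 *ᶻ_) (proj₁ (row-zero (cw a))))))))
      (trans (∑-cong (λ a → ℤₚ.+-identityʳ (+ 24 *ᶻ ∑ (K 4 a))))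
             ((∑-*ˡ (+ 24) (λ a → ∑ (K 4 a)))))
    rhs : ∑ (λ a → ∑ (λ b → + 1 *ᶻ K43 a b +ᶻ + 672 *ᶻ K 2 a b +ᶻ + 1344 *ᶻ K 1 a b +ᶻ + 1800)) ≡
          + 24 *ᶻ gram 4 +ᶻ + 117964800
    rhs = trans (double-lin (+ 1) (+ 672) (+ 1344) (+ 1800) K43 (K 2) (K 1))
      (cong₂ _+ᶻ_ (trans (cong₂ _+ᶻ_
        (cong₂ _+ᶻ_ (trans (ℤₚ.*-identityˡ (∑ (λ a → ∑ (K43 a)))) g43) (cong (+ 672 *ᶻ_) (proj₁ (proj₂ gram-zero))))
        (cong (+ 1344 *ᶻ_) (proj₂ (proj₂ gram-zero))))
        (lem (+ 24 *ᶻ gram 4))) (cong (λ l → + l *ᶻ (+ l *ᶻ + 1800)) m≡256))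
      where
      lem : ∀ x → x +ᶻ + 672 *ᶻ + 0 +ᶻ + 1344 *ᶻ + 0 ≡ x
      lem = solve-∀
    cancel : ∀ {x} → x +ᶻ + 117964800 ≡ + 125829120 → x ≡ + 24 *ᶻ + 327680
    cancel {x} h = trans (sym (+-cancel-right x (+ 117964800))) (cong (_-ᶻ + 117964800) h)


-- Words, weights and intersections

⊕-comm : ∀ a b → a ⊕ b ≡ b ⊕ a
⊕-comm 0F 0F = refl
⊕-comm 0F 1F = refl
⊕-comm 1F 0F = refl
⊕-comm 1F 1F = refl

⊕-assoc : ∀ a b c → (a ⊕ b) ⊕ c ≡ a ⊕ (b ⊕ c)
⊕-assoc 0F b c = refl
⊕-assoc 1F 0F c = refl
⊕-assoc 1F 1F 0F = refl
⊕-assoc 1F 1F 1F = refl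

⊕-self : ∀ a → a ⊕ a ≡ 0F
⊕-self 0F = refl
⊕-self 1F = refl

𝟎 𝟏 : ∀ {n} → Word n
𝟎 {n} = replicate n 0F
𝟏 {n} = replicate n 1F

⊞-comm : ∀ {n} (u v : Word n) → u ⊞ v ≡ v ⊞ u
⊞-comm = zipWith-comm ⊕-comm

⊞-assoc : ∀ {n} (u v w : Word n) → (u ⊞ v) ⊞ w ≡ u ⊞ (v ⊞ w)
⊞-assoc = zipWith-assoc ⊕-assoc

⊞-identityˡ : ∀ {n} (u : Word n) → 𝟎 ⊞ u ≡ u
⊞-identityˡ = zipWith-identityˡ λ _ → refl

⊞-self : ∀ {n} (u : Word n) → u ⊞ u ≡ 𝟎
⊞-self [] = refl
⊞-self (a ∷ u) = cong₂ _∷_ (⊕-self a) (⊞-self u)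

⊞-cancel : ∀ {n} (u v : Word n) → u ⊞ (u ⊞ v) ≡ v
⊞-cancel u v = trans (sym (⊞-assoc u u v)) (trans (cong (_⊞ v) (⊞-self u)) (⊞-identityˡ v))

⊞-translate : ∀ {n} (u v w : Word n) → (u ⊞ v) ⊞ (u ⊞ w) ≡ v ⊞ w
⊞-translate u v w = trans (cong (_⊞ (u ⊞ w)) (⊞-comm u v)) (trans (⊞-assoc v u (u ⊞ w)) (cong (v ⊞_) (⊞-cancel u w)))

dH≡wt : ∀ {n} (u v : Word n) → dH u v ≡ wt (u ⊞ v)
dH≡wt [] [] = refl
dH≡wt (0F ∷ u) (0F ∷ v) = dH≡wt u v
dH≡wt (0F ∷ u) (1F ∷ v) = cong suc (dH≡wt u v)
dH≡wt (1F ∷ u) (0F ∷ v) = cong suc (dH≡wt u v)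
dH≡wt (1F ∷ u) (1F ∷ v) = dH≡wt u v

wt-≤ : ∀ {n} (w : Word n) → wt w ℕ.≤ n
wt-≤ [] = z≤n
wt-≤ (0F ∷ w) = ℕₚ.m≤n⇒m≤1+n (wt-≤ w)
wt-≤ (1F ∷ w) = s≤s (wt-≤ w)

wt-𝟎 : ∀ n → wt (𝟎 {n}) ≡ 0
wt-𝟎 zero = refl
wt-𝟎 (suc n) = wt-𝟎 n

wt-complement : ∀ {n} (w : Word n) → wt (𝟏 ⊞ w) ℕ.+ wt w ≡ n
wt-complement [] = refl
wt-complement (0F ∷ w) = cong suc (wt-complement w)
wt-complement (1F ∷ w) = trans (ℕₚ.+-suc _ _) (cong suc (wt-complement w))

trace-wt : ∀ {n} (w : Word n) → trace w ≡ + n -ᶻ + 2 *ᶻ + wt w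
trace-wt [] = refl
trace-wt {suc n} (0F ∷ w) = trans (cong (+ 1 +ᶻ_) (trace-wt w)) (lem (+ n) (+ wt w))
  where
  lem : ∀ x y → + 1 +ᶻ (x -ᶻ + 2 *ᶻ y) ≡ (+ 1 +ᶻ x) -ᶻ + 2 *ᶻ y
  lem = solve-∀
trace-wt {suc n} (1F ∷ w) = trans (cong (-[1+ 0 ] +ᶻ_) (trace-wt w)) (lem (+ n) (+ wt w))
  where
  lem : ∀ x y → -[1+ 0 ] +ᶻ (x -ᶻ + 2 *ᶻ y) ≡ (+ 1 +ᶻ x) -ᶻ + 2 *ᶻ (+ 1 +ᶻ y)
  lem = solve-∀

-- The number of coordinates in which both words have a 1.
inter : ∀ {n} → Word n → Word n → ℕ
inter [] [] = 0
inter (0F ∷ x) (_ ∷ y) = inter x y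
inter (1F ∷ x) (0F ∷ y) = inter x y
inter (1F ∷ x) (1F ∷ y) = suc (inter x y)

wt-⊞ : ∀ {n} (x y : Word n) → wt (x ⊞ y) ℕ.+ 2 ℕ.* inter x y ≡ wt x ℕ.+ wt y
wt-⊞ [] [] = refl
wt-⊞ (0F ∷ x) (0F ∷ y) = wt-⊞ x y
wt-⊞ (0F ∷ x) (1F ∷ y) = trans (cong suc (wt-⊞ x y)) (sym (ℕₚ.+-suc (wt x) (wt y)))
wt-⊞ (1F ∷ x) (0F ∷ y) = cong suc (wt-⊞ x y)
wt-⊞ (1F ∷ x) (1F ∷ y) = trans (lem (wt (x ⊞ y)) (inter x y)) (trans (cong (2 ℕ.+_) (wt-⊞ x y)) (cong suc (sym (ℕₚ.+-suc (wt x) (wt y)))))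
  where
  lem : ∀ a b → a ℕ.+ 2 ℕ.* (1 ℕ.+ b) ≡ 2 ℕ.+ (a ℕ.+ 2 ℕ.* b)
  lem = solveℕ-∀

-- The n-th power of -1
altSign : ℕ → ℤ
altSign zero = + 1
altSign (suc n) = -[1+ 0 ] *ᶻ altSign n

altSign-even : ∀ {n} → 2 ∣ n → altSign n ≡ + 1
altSign-even (divides q refl) = go q
  where
  go : ∀ q → altSign (q ℕ.* 2) ≡ + 1
  go zero = refl
  go (suc q) = trans (lem (altSign (q ℕ.* 2))) (go q)
    where
    lem : ∀ x → -[1+ 0 ] *ᶻ (-[1+ 0 ] *ᶻ x) ≡ x
    lem = solve-∀

χ-inter : ∀ {n} (x y : Word n) → χ x y ≡ altSign (inter x y)
χ-inter [] [] = refl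
χ-inter (0F ∷ x) (_ ∷ y) = χ-inter x y
χ-inter (1F ∷ x) (0F ∷ y) = trans (ℤₚ.*-identityˡ _) (χ-inter x y)
χ-inter (1F ∷ x) (1F ∷ y) = cong (-[1+ 0 ] *ᶻ_) (χ-inter x y)

χ-complement : ∀ {n} (x y : Word n) → χ (𝟏 ⊞ x) y ≡ χ x y *ᶻ altSign (wt y)
χ-complement [] [] = refl
χ-complement (0F ∷ x) (0F ∷ y) = trans (ℤₚ.*-identityˡ _) (χ-complement x y)
χ-complement (0F ∷ x) (1F ∷ y) = trans (cong (-[1+ 0 ] *ᶻ_) (χ-complement x y)) (lem (χ x y) (altSign (wt y)))
  where
  lem : ∀ a b → -[1+ 0 ] *ᶻ (a *ᶻ b) ≡ a *ᶻ (-[1+ 0 ] *ᶻ b)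
  lem = solve-∀
χ-complement (1F ∷ x) (0F ∷ y) = trans (χ-complement x y) (cong (_*ᶻ altSign (wt y)) (sym (ℤₚ.*-identityˡ (χ x y))))
χ-complement (1F ∷ x) (1F ∷ y) = trans (χ-complement x y) (lem (χ x y) (altSign (wt y)))
  where
  lem : ∀ a b → a *ᶻ b ≡ (-[1+ 0 ] *ᶻ a) *ᶻ (-[1+ 0 ] *ᶻ b)
  lem = solve-∀

χ-square : ∀ {n} (x y : Word n) → χ x y *ᶻ χ x y ≡ + 1
χ-square [] [] = refl
χ-square (0F ∷ x) (_ ∷ y) = χ-square x y
χ-square (1F ∷ x) (b ∷ y) = trans (interchange (sgn b) (χ x y) (sgn b) (χ x y))
  (trans (cong₂ _*ᶻ_ (sgn-square b) (χ-square x y)) refl)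
  where
  sgn-square : ∀ b → sgn b *ᶻ sgn b ≡ + 1
  sgn-square 0F = refl
  sgn-square 1F = refl

1+x-1≡x : ∀ x → + 1 +ᶻ x -ᶻ + 1 ≡ x
1+x-1≡x = solve-∀

-- If a sum of indicators equals k, there are k distinct indices at which the property holds.
choose : ∀ {m ℓ} {P : Fin m → Set ℓ} (P? : ∀ b → Dec (P b)) k → ∑ (λ b → indicator (P? b)) ≡ + k →
         Σ[ e ∈ (Fin k → Fin m) ] Injective _≡_ _≡_ e × (∀ j → P (e j))
choose {zero} P? k h with refl ← ℤₚ.+-injective (trans (sym h) (∑-empty (λ b → indicator (P? b)))) =
  (λ ()) , (λ { {()} }) , λ ()
choose {suc m} {P = P} P? k h with P? zero | trans (sym (∑-suc (λ b → indicator (P? b)))) h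
... | no _ | h′ with choose (P? ∘ suc) k (trans (sym (ℤₚ.+-identityˡ _)) h′)
...   | e , inj , all = suc ∘ e , (λ eq → inj (Finₚ.suc-injective eq)) , all
choose {suc m} {P = P} P? zero h | yes p | h′ = contradiction (ℤₚ.≤-reflexive h′) (ℤₚ.<⇒≱ (ℤₚ.<-≤-trans (ℤ.+<+ (s≤s z≤n))
  (ℤₚ.+-monoʳ-≤ (+ 1) (subst (_≤ᶻ ∑ (λ b → indicator (P? (suc b)))) (∑-zero m) (∑-mono (λ b → indicator-nonNeg (P? (suc b))))))))
  where
  indicator-nonNeg : ∀ {ℓ} {P : Set ℓ} (d : Dec P) → + 0 ≤ᶻ indicator d
  indicator-nonNeg (yes _) = ℤ.+≤+ z≤n
  indicator-nonNeg (no _) = ℤ.+≤+ z≤n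
choose {suc m} {P = P} P? (suc k) h | yes p | h′
  with e , inj , all ← choose (P? ∘ suc) k (trans (sym (1+x-1≡x (∑ (λ b → indicator (P? (suc b)))))) (cong (_-ᶻ + 1) h′)) = f , f-inj , f-all
  where
  f : Fin (suc k) → Fin (suc m)
  f zero = zero
  f (suc j) = suc (e j)
  f-inj : Injective _≡_ _≡_ f
  f-inj {zero} {zero} _ = refl
  f-inj {suc i} {suc j} eq = cong suc (inj (Finₚ.suc-injective eq))
  f-all : ∀ j → P (f j)
  f-all zero = p
  f-all (suc j) = all j

infix 4 _≟ʷ_

_≟ʷ_ : ∀ {n} (u v : Word n) → Dec (u ≡ v)
_≟ʷ_ = ≡-dec _≟_

-- The function F, set to zero at y
remove : ∀ {n} → Word n → (Word n → ℤ) → Word n → ℤ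
remove y F x = if does (x ≟ʷ y) then + 0 else F x

opaque
  unfolding ∑⊆

  ∑⊆-remove : ∀ k {n} (F : Word n → ℤ) y → wt y ≡ k → ∑⊆ k F ≡ F y +ᶻ ∑⊆ k (remove y F)
  ∑⊆-remove zero {zero} F [] e = sym (ℤₚ.+-identityʳ (F []))
  ∑⊆-remove zero {suc n} F (0F ∷ y) e = ∑⊆-remove zero {n} (F ∘ (0F ∷_)) y e
  ∑⊆-remove zero {suc n} F (1F ∷ y) ()
  ∑⊆-remove (suc k) {suc n} F (0F ∷ y) e =
    trans (cong (∑⊆ k (F ∘ (1F ∷_)) +ᶻ_) (∑⊆-remove (suc k) (F ∘ (0F ∷_)) y e))
          (lem (∑⊆ k (F ∘ (1F ∷_))) (F (0F ∷ y)) (∑⊆ (suc k) (remove y (F ∘ (0F ∷_)))))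
    where
    lem : ∀ a b c → a +ᶻ (b +ᶻ c) ≡ b +ᶻ (a +ᶻ c)
    lem = solve-∀
  ∑⊆-remove (suc k) {suc n} F (1F ∷ y) e =
    trans (cong (_+ᶻ ∑⊆ (suc k) (F ∘ (0F ∷_))) (∑⊆-remove k (F ∘ (1F ∷_)) y (ℕₚ.suc-injective e)))
          (ℤₚ.+-assoc (F (1F ∷ y)) (∑⊆ k (remove y (F ∘ (1F ∷_)))) (∑⊆ (suc k) (F ∘ (0F ∷_))))

-- If a nonnegative function has the value c at m distinct words of weight k, then its sum
-- over the words of weight k is at least m times c.
mass-bound : ∀ {m} k {n} {F : Word n → ℤ} c (y : Fin m → Word n) → Injective _≡_ _≡_ y →
             (∀ x → + 0 ≤ᶻ F x) → (∀ j → wt (y j) ≡ k) → (∀ j → F (y j) ≡ c) → + m *ᶻ c ≤ᶻ ∑⊆ k F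
mass-bound {zero} k {F = F} c y _ F≥0 _ _ = subst (_≤ᶻ ∑⊆ k F) (sym (ℤₚ.*-zeroˡ c)) (∑⊆-nonNeg k F≥0)
mass-bound {suc m} k {n} {F} c y inj F≥0 wts vals =
  subst₂ _≤ᶻ_ (sym (ℤₚ.suc-* (+ m) c)) (sym (trans (∑⊆-remove k F (y zero) (wts zero)) (cong (_+ᶻ _) (vals zero))))
    (ℤₚ.+-monoʳ-≤ c (mass-bound k c (y ∘ suc) (λ eq → Finₚ.suc-injective (inj eq)) F′≥0 (wts ∘ suc) vals′))
  where
  F′≥0 : ∀ x → + 0 ≤ᶻ remove (y zero) F x
  F′≥0 x with does (x ≟ʷ y zero)
  ... | true = ℤₚ.≤-refl
  ... | false = F≥0 x
  vals′ : ∀ j → remove (y zero) F (y (suc j)) ≡ c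
  vals′ j with y (suc j) ≟ʷ y zero
  ... | yes eq = contradiction (inj eq) λ ()
  ... | no _ = vals (suc j)


-- Tetrads

allowed-trace : (w : Word 20) → 8 ℕ.≤ wt w → 4 ∣ wt w → AllowedTrace (trace w)
allowed-trace w 8≤ (divides q eq) = go q eq
  where
  tr-is : ∀ {k} → wt w ≡ k → trace w ≡ + 20 -ᶻ + 2 *ᶻ + k
  tr-is refl = trace-wt w
  go : ∀ q → wt w ≡ q ℕ.* 4 → AllowedTrace (trace w)
  go 0 e = contradiction (subst (8 ℕ.≤_) e 8≤) (from-no (8 ≤? 0))
  go 1 e = contradiction (subst (8 ℕ.≤_) e 8≤) (from-no (8 ≤? 4))
  go 2 e = inj₁ (tr-is e)
  go 3 e = inj₂ (inj₁ (tr-is e))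
  go 4 e = inj₂ (inj₂ (inj₁ (tr-is e)))
  go 5 e = inj₂ (inj₂ (inj₂ (tr-is e)))
  go (suc (suc (suc (suc (suc (suc q)))))) e =
    contradiction (ℕₚ.≤-trans (ℕₚ.m≤m+n 24 (q ℕ.* 4)) (subst (ℕ._≤ 20) e (wt-≤ w))) (from-no (24 ≤? 20))

trace-16 : (w : Word 20) → 4 ∣ wt w → trace w ≡ ℤ.- + 12 → wt w ≡ 16
trace-16 w (divides q e) h = trans e (go q (trans (sym (tr-is e)) h) (subst (ℕ._≤ 20) e (wt-≤ w)))
  where
  tr-is : ∀ {k} → wt w ≡ k → trace w ≡ + 20 -ᶻ + 2 *ᶻ + k
  tr-is refl = trace-wt w
  go : ∀ q → + 20 -ᶻ + 2 *ᶻ + (q ℕ.* 4) ≡ ℤ.- + 12 → q ℕ.* 4 ℕ.≤ 20 → q ℕ.* 4 ≡ 16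
  go 0 () _
  go 1 () _
  go 2 () _
  go 3 () _
  go 4 _ _ = refl
  go 5 () _
  go (suc (suc (suc (suc (suc (suc q)))))) _ h = contradiction (ℕₚ.≤-trans (ℕₚ.m≤m+n 24 (q ℕ.* 4)) h) (from-no (24 ≤? 20))

-- The codes to be classified, with the size kept as a parameter
GoodCode : ∀ {n} → ℕ → Code n → Set
GoodCode m D = MinDistanceAtLeast D 8 × HasSize D m × DistancesDivisibleBy 4 D

-- Doubly even words with doubly even sum meet in an even number of coordinates.
even-inter : ∀ {n} (x y : Word n) → 4 ∣ wt x → 4 ∣ wt y → 4 ∣ wt (x ⊞ y) → 2 ∣ inter x y
even-inter x y 4∣x 4∣y 4∣xy = *-cancelˡ-∣ 2
  (∣m+n∣m⇒∣n (subst (4 ∣_) (sym (wt-⊞ x y)) (∣m∣n⇒∣m+n 4∣x 4∣y)) 4∣xy)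

-- Membership is proof-irrelevant.
member-≡ : ∀ {n} {C : Code n} {p q : ∃[ w ] w ∈ C} → proj₁ p ≡ proj₁ q → p ≡ q
member-≡ {p = _ , p} {_ , q} refl = cong (_ ,_) (T-irrelevant p q)

module Tetrads {m : ℕ} (m≡256 : m ≡ 256) (D : Code 20) (good : GoodCode m D) where

  codeword : Fin m → Word 20
  codeword a = proj₁ (Inverse.to (proj₁ (proj₂ good)) a)

  codeword∈ : ∀ a → codeword a ∈ D
  codeword∈ a = proj₂ (Inverse.to (proj₁ (proj₂ good)) a)

  index : ∀ {v} → v ∈ D → ∃[ a ] codeword a ≡ v
  index {v} p = Inverse.from (proj₁ (proj₂ good)) (v , p) ,
                cong proj₁ (Inverse.strictlyInverseˡ (proj₁ (proj₂ good)) (v , p))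

  codeword-injective : ∀ {a b} → codeword a ≡ codeword b → a ≡ b
  codeword-injective {a} {b} eq = trans (sym (Inverse.strictlyInverseʳ (proj₁ (proj₂ good)) a))
    (trans (cong (Inverse.from (proj₁ (proj₂ good))) (member-≡ {C = D} eq)) (Inverse.strictlyInverseʳ (proj₁ (proj₂ good)) b))

  4∣wt : ∀ a b → 4 ∣ wt (codeword a ⊞ codeword b)
  4∣wt a b = subst (4 ∣_) (dH≡wt (codeword a) (codeword b)) (proj₂ (proj₂ good) _ _ (codeword∈ a) (codeword∈ b))

  8≤wt : ∀ {a b} → a ≢ b → 8 ℕ.≤ wt (codeword a ⊞ codeword b)
  8≤wt {a} {b} a≢b = subst (8 ℕ.≤_) (dH≡wt (codeword a) (codeword b))
    (proj₁ good _ _ (codeword∈ a) (codeword∈ b) (a≢b ∘ codeword-injective))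

  trace-self : ∀ a → trace (codeword a ⊞ codeword a) ≡ + 20
  trace-self a = trans (cong trace (⊞-self (codeword a))) refl

  open LinearProgramming m≡256 codeword trace-self
    (λ {a} {b} a≢b → allowed-trace (codeword a ⊞ codeword b) (8≤wt a≢b) (4∣wt a b))
    using (S; far?; five-far; dual-weight-four)

  opaque
    -- The five codewords at distance 16 from a given one. Opaque, since unfolding the
    -- choice would unfold the proof that there are five.
    far : ∀ a → Σ[ e ∈ (Fin 5 → Fin m) ] Injective _≡_ _≡_ e × (∀ j → trace (codeword a ⊞ codeword (e j)) ≡ ℤ.- + 12)
    far a = choose (far? a) 5 (five-far a)

  far-index : ∀ a → Fin 5 → Fin m
  far-index a = proj₁ (far a)

  far-index-injective : ∀ a → Injective _≡_ _≡_ (far-index a)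
  far-index-injective a = proj₁ (proj₂ (far a))

  far-weight : ∀ a j → wt (codeword a ⊞ codeword (far-index a j)) ≡ 16
  far-weight a j = trace-16 (codeword a ⊞ codeword (far-index a j)) (4∣wt a (far-index a j)) (proj₂ (proj₂ (far a)) j)

  -- The complement of the difference to a codeword at distance 16, a set of four coordinates
  tetrad : Fin m → Fin 5 → Word 20
  tetrad a j = 𝟏 ⊞ (codeword a ⊞ codeword (far-index a j))

  tetrad-weight : ∀ a j → wt (tetrad a j) ≡ 4
  tetrad-weight a j = ℕₚ.+-cancelʳ-≡ 16 (wt (tetrad a j)) 4 (trans (cong (wt (tetrad a j) ℕ.+_) (sym (far-weight a j)))
    (wt-complement (codeword a ⊞ codeword (far-index a j))))

  tetrad-⊞ : ∀ a i j → tetrad a i ⊞ tetrad a j ≡ codeword (far-index a i) ⊞ codeword (far-index a j)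
  tetrad-⊞ a i j = trans
    (⊞-translate 𝟏 (codeword a ⊞ codeword (far-index a i)) (codeword a ⊞ codeword (far-index a j)))
    (⊞-translate (codeword a) (codeword (far-index a i)) (codeword (far-index a j)))

  tetrad-disjoint : ∀ a {i j} → i ≢ j → inter (tetrad a i) (tetrad a j) ≡ 0
  tetrad-disjoint a {i} {j} i≢j = halves-zero (subst (8 ℕ.≤_) (cong wt (sym (tetrad-⊞ a i j))) (8≤wt (i≢j ∘ far-index-injective a)))
    (trans (wt-⊞ (tetrad a i) (tetrad a j)) (cong₂ ℕ._+_ (tetrad-weight a i) (tetrad-weight a j)))
    where
    halves-zero : ∀ {w k} → 8 ℕ.≤ w → w ℕ.+ 2 ℕ.* k ≡ 8 → k ≡ 0
    halves-zero {w} {zero} _ _ = refl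
    halves-zero {w} {suc k} 8≤w e = contradiction (ℕₚ.≤-trans (ℕₚ.+-mono-≤ 8≤w (s≤s (z≤n {k ℕ.+ suc (k ℕ.+ 0)}))) (ℕₚ.≤-reflexive e)) (from-no (9 ≤? 8))

  tetrad-injective : ∀ a → Injective _≡_ _≡_ (tetrad a)
  tetrad-injective a {i} {j} eq with i ≟ j
  ... | yes e = e
  ... | no i≢j = contradiction (8≤wt (i≢j ∘ far-index-injective a))
    (subst (λ k → ¬ 8 ℕ.≤ k) (sym (trans (cong wt (trans (sym (tetrad-⊞ a i j))
      (trans (cong (_⊞ tetrad a j) eq) (⊞-self (tetrad a j))))) (wt-𝟎 20))) (from-no (8 ≤? 0)))

  -- All differences of codewords meet a tetrad evenly.
  tetrad-dual : ∀ a j c → χ (tetrad a j) (codeword a ⊞ codeword c) ≡ + 1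
  tetrad-dual a j c = trans (χ-complement y z) (cong₂ _*ᶻ_
      (trans (χ-inter y z) (altSign-even (even-inter y z (4∣wt a (far-index a j)) (4∣wt a c)
        (subst (4 ∣_) (cong wt (sym (⊞-translate (codeword a) (codeword (far-index a j)) (codeword c)))) (4∣wt (far-index a j) c)))))
      (altSign-even (∣-trans (divides 2 refl) (4∣wt a c))))
    where
    y z : Word 20
    y = codeword a ⊞ codeword (far-index a j)
    z = codeword a ⊞ codeword c

  tetrad-charSum : ∀ a j → S (tetrad a j) *ᶻ S (tetrad a j) ≡ + 65536
  tetrad-charSum a j = trans (cong (λ s → s *ᶻ s) S≡) (trans (interchange (+ m) χₐ (+ m) χₐ)
    (trans (cong₂ _*ᶻ_ (cong (λ l → + l *ᶻ + l) m≡256) (χ-square (tetrad a j) (codeword a))) refl))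
    where
    χₐ : ℤ
    χₐ = χ (tetrad a j) (codeword a)
    constant : ∀ c → χ (tetrad a j) (codeword c) ≡ χₐ
    constant c = trans (cong (χ (tetrad a j)) (sym (⊞-cancel (codeword a) (codeword c))))
      (trans (χ-⊞ (tetrad a j) (codeword a) (codeword a ⊞ codeword c))
      (trans (cong (χₐ *ᶻ_) (tetrad-dual a j c)) (ℤₚ.*-identityʳ χₐ)))
    S≡ : S (tetrad a j) ≡ + m *ᶻ χₐ
    S≡ = trans (∑-cong constant) (∑-const m χₐ)

  -- All codewords have the same five tetrads: each tetrad contributes 65536 to the total mass
  -- 327680 of the characters of weight four, so there is no room for a sixth one.
  tetrads-agree : ∀ a b i → ∃[ j ] tetrad b j ≡ tetrad a i
  tetrads-agree a b i with any? (λ j → tetrad b j ≟ʷ tetrad a i)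
  ... | yes found = found
  ... | no none = contradiction
    (subst (+ 393216 ≤ᶻ_) dual-weight-four
      (mass-bound 4 (+ 65536) six six-injective (λ x → square-nonNeg (S x)) six-weight six-mass))
    (from-no (+ 393216 ℤ.≤? + 327680))
    where
    six : Fin 6 → Word 20
    six zero = tetrad a i
    six (suc j) = tetrad b j
    six-injective : Injective _≡_ _≡_ six
    six-injective {zero} {zero} _ = refl
    six-injective {zero} {suc j} eq = contradiction (j , sym eq) none
    six-injective {suc j} {zero} eq = contradiction (j , eq) none
    six-injective {suc j} {suc k} eq = cong suc (tetrad-injective b eq)
    six-weight : ∀ j → wt (six j) ≡ 4
    six-weight zero = tetrad-weight a i
    six-weight (suc j) = tetrad-weight b j
    six-mass : ∀ j → S (six j) *ᶻ S (six j) ≡ + 65536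
    six-mass zero = tetrad-charSum a i
    six-mass (suc j) = tetrad-charSum b j

  tetrad-closed : ∀ a i b → codeword b ⊞ (𝟏 ⊞ tetrad a i) ∈ D
  tetrad-closed a i b with j , eq ← tetrads-agree a b i =
    subst (_∈ D) (sym (trans (cong (λ t → codeword b ⊞ (𝟏 ⊞ t)) (sym eq))
      (trans (cong (codeword b ⊞_) (⊞-cancel 𝟏 (codeword b ⊞ codeword (far-index b j)))) (⊞-cancel (codeword b) (codeword (far-index b j)))))) (codeword∈ (far-index b j))


-- Isometries and equivalence

≡-lookup : ∀ {n} {u v : Word n} → (∀ i → lookup u i ≡ lookup v i) → u ≡ v
≡-lookup {u = u} {v} h = trans (sym (tabulate∘lookup u)) (trans (tabulate-cong h) (tabulate∘lookup v))

⊕-cancelʳ : ∀ a b → (a ⊕ b) ⊕ b ≡ a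
⊕-cancelʳ 0F b = ⊕-self b
⊕-cancelʳ 1F 0F = refl
⊕-cancelʳ 1F 1F = refl

permute-lookup : ∀ {n} (σ : Permutation′ n) w i → lookup (permuteCoordinates σ w) i ≡ lookup w (σ ⟨$⟩ʳ i)
permute-lookup σ w i = lookup∘tabulate (λ i → lookup w (σ ⟨$⟩ʳ i)) i

-- Permutation of the coordinates followed by translation. For the alphabet of two letters
-- these are exactly the maps in the definition of equivalence.
isometry : ∀ {n} → Permutation′ n → Word n → Word n → Word n
isometry σ a w = permuteCoordinates σ w ⊞ a

isometry-lookup : ∀ {n} (σ : Permutation′ n) a w i →
                  lookup (isometry σ a w) i ≡ lookup w (σ ⟨$⟩ʳ i) ⊕ lookup a i
isometry-lookup σ a w i = trans (lookup-zipWith _⊕_ i (permuteCoordinates σ w) a)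
  (cong (_⊕ lookup a i) (permute-lookup σ w i))

permute-⊞ : ∀ {n} (σ : Permutation′ n) u v → permuteCoordinates σ (u ⊞ v) ≡ permuteCoordinates σ u ⊞ permuteCoordinates σ v
permute-⊞ σ u v = ≡-lookup λ i → trans (permute-lookup σ (u ⊞ v) i) (trans (lookup-zipWith _⊕_ (σ ⟨$⟩ʳ i) u v)
  (sym (trans (lookup-zipWith _⊕_ i (permuteCoordinates σ u) (permuteCoordinates σ v))
              (cong₂ _⊕_ (permute-lookup σ u i) (permute-lookup σ v i)))))

isometry-⊞ : ∀ {n} (σ : Permutation′ n) a u v → isometry σ a u ⊞ isometry σ a v ≡ permuteCoordinates σ (u ⊞ v)
isometry-⊞ σ a u v = trans (cong₂ _⊞_ (⊞-comm (permuteCoordinates σ u) a) (⊞-comm (permuteCoordinates σ v) a))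
  (trans (⊞-translate a (permuteCoordinates σ u) (permuteCoordinates σ v)) (sym (permute-⊞ σ u v)))

wt-sum : ∀ {n} (w : Word n) → wt w ≡ ℕΣ.sum (λ i → toℕ (lookup w i))
wt-sum [] = refl
wt-sum (0F ∷ w) = wt-sum w
wt-sum (1F ∷ w) = cong suc (wt-sum w)

wt-permute : ∀ {n} (σ : Permutation′ n) w → wt (permuteCoordinates σ w) ≡ wt w
wt-permute σ w = trans (wt-sum (permuteCoordinates σ w))
  (trans (ℕΣ.sum-cong-≗ (λ i → cong toℕ (permute-lookup σ w i)))
  (trans (sym (ℕΣ.sum-permute (λ i → toℕ (lookup w i)) σ)) (sym (wt-sum w))))

dH-isometry : ∀ {n} (σ : Permutation′ n) a u v → dH (isometry σ a u) (isometry σ a v) ≡ dH u v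
dH-isometry σ a u v = trans (dH≡wt (isometry σ a u) (isometry σ a v))
  (trans (cong wt (isometry-⊞ σ a u v)) (trans (wt-permute σ (u ⊞ v)) (sym (dH≡wt u v))))

-- The translation part of the inverse isometry
inverseWord : ∀ {n} → Permutation′ n → Word n → Word n
inverseWord σ a = permuteCoordinates (flip σ) a

isometry-inverse : ∀ {n} (σ : Permutation′ n) a v → isometry σ a (isometry (flip σ) (inverseWord σ a) v) ≡ v
isometry-inverse σ a v = ≡-lookup λ i → trans (isometry-lookup σ a (isometry (flip σ) (inverseWord σ a) v) i)
  (trans (cong (_⊕ lookup a i) (trans (isometry-lookup (flip σ) (inverseWord σ a) v (σ ⟨$⟩ʳ i))
           (cong₂ _⊕_ (cong (lookup v) (inverseˡ σ)) (trans (permute-lookup (flip σ) a (σ ⟨$⟩ʳ i)) (cong (lookup a) (inverseˡ σ))))))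
         (⊕-cancelʳ (lookup v i) (lookup a i)))

isometry-inverse′ : ∀ {n} (σ : Permutation′ n) a w → isometry (flip σ) (inverseWord σ a) (isometry σ a w) ≡ w
isometry-inverse′ σ a w = ≡-lookup λ i → trans (isometry-lookup (flip σ) (inverseWord σ a) (isometry σ a w) i)
  (trans (cong₂ _⊕_ (trans (isometry-lookup σ a w (σ ⟨$⟩ˡ i)) (cong (_⊕ lookup a (σ ⟨$⟩ˡ i)) (cong (lookup w) (inverseʳ σ))))
                    (permute-lookup (flip σ) a i))
         (⊕-cancelʳ (lookup w i) (lookup a (σ ⟨$⟩ˡ i))))

infix 4 _≈_

-- Equivalence by an isometry, stated with characteristic functions
record _≈_ {n} (C D : Code n) : Set where
  constructor iso
  field
    σ : Permutation′ n
    a : Word n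
    agree : ∀ w → C w ≡ D (isometry σ a w)

≈-sym : ∀ {n} {C D : Code n} → C ≈ D → D ≈ C
≈-sym {D = D} (iso σ a h) = iso (flip σ) (inverseWord σ a)
  λ v → sym (trans (h (isometry (flip σ) (inverseWord σ a) v)) (cong D (isometry-inverse σ a v)))

≈-trans : ∀ {n} {C D E : Code n} → C ≈ D → D ≈ E → C ≈ E
≈-trans {E = E} (iso σ a h) (iso ρ b k) = iso (ρ ∘ₚ σ) (permuteCoordinates ρ a ⊞ b) λ w →
  trans (h w) (trans (k (isometry σ a w)) (cong E (trans
    (cong (_⊞ b) (permute-⊞ ρ (permuteCoordinates σ w) a))
    (trans (⊞-assoc (permuteCoordinates ρ (permuteCoordinates σ w)) (permuteCoordinates ρ a) b)
      (cong (_⊞ (permuteCoordinates ρ a ⊞ b)) (≡-lookup λ i →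
        trans (permute-lookup ρ (permuteCoordinates σ w) i) (trans (permute-lookup σ w (ρ ⟨$⟩ʳ i)) (sym (permute-lookup (ρ ∘ₚ σ) w i)))))))))

-- The image of a code under an isometry
image : ∀ {n} → Permutation′ n → Word n → Code n → Code n
image σ a D v = D (isometry (flip σ) (inverseWord σ a) v)

≈-image : ∀ {n} (σ : Permutation′ n) a (D : Code n) → D ≈ image σ a D
≈-image σ a D = iso σ a λ w → cong D (sym (isometry-inverse′ σ a w))

≈-refl : ∀ {n} (D : Code n) → D ≈ D
≈-refl D = ≈-trans (≈-image Perm.id 𝟎 D) (≈-sym (≈-image Perm.id 𝟎 D))

-- The permutation of the alphabet that adds a given element
alphabet : 𝔽₂ → Permutation′ 2
alphabet 0F = Perm.id
alphabet 1F = transpose 0F 1F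

alphabet-⊕ : ∀ a x → alphabet a ⟨$⟩ʳ x ≡ x ⊕ a
alphabet-⊕ 0F 0F = refl
alphabet-⊕ 0F 1F = refl
alphabet-⊕ 1F 0F = refl
alphabet-⊕ 1F 1F = refl

permutation-⊕ : (π : Permutation′ 2) → ∀ x → π ⟨$⟩ʳ x ≡ x ⊕ (π ⟨$⟩ʳ 0F)
permutation-⊕ π 0F = refl
permutation-⊕ π 1F = differ (π ⟨$⟩ʳ 1F) (π ⟨$⟩ʳ 0F) λ eq → case-0≡1 (trans (sym (inverseˡ π)) (trans (cong (π ⟨$⟩ˡ_) eq) (inverseˡ π)))
  where
  case-0≡1 : ¬ (_≡_ {A = Fin 2} 1F 0F)
  case-0≡1 ()
  differ : ∀ x y → x ≢ y → x ≡ 1F ⊕ y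
  differ 0F 0F h = contradiction refl h
  differ 0F 1F h = refl
  differ 1F 0F h = refl
  differ 1F 1F h = contradiction refl h

≈⇒Equivalent : ∀ {n} {C D : Code n} → C ≈ D → Equivalent C D
≈⇒Equivalent {n} {C} {D} (iso σ a h) = σ , (alphabet ∘ lookup a) , λ v → mk⇔
  (λ v∈D → isometry (flip σ) (inverseWord σ a) v ,
     subst T (sym (trans (h (isometry (flip σ) (inverseWord σ a) v)) (cong D (isometry-inverse σ a v)))) v∈D ,
     trans (agree (isometry (flip σ) (inverseWord σ a) v)) (isometry-inverse σ a v))
  (λ { (w , w∈C , refl) → subst T (trans (h w) (cong D (sym (agree w)))) w∈C })
  where
  agree : ∀ w → permuteAlphabets (alphabet ∘ lookup a) (permuteCoordinates σ w) ≡ isometry σ a w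
  agree w = ≡-lookup λ i → trans (lookup∘tabulate (λ i → alphabet (lookup a i) ⟨$⟩ʳ lookup (permuteCoordinates σ w) i) i)
    (trans (alphabet-⊕ (lookup a i) (lookup (permuteCoordinates σ w) i))
           (sym (lookup-zipWith _⊕_ i (permuteCoordinates σ w) a)))

T-≡ : ∀ {x y : Bool} → (T x → T y) → (T y → T x) → x ≡ y
T-≡ {false} {false} _ _ = refl
T-≡ {false} {true} _ g = ⊥-elim (g _)
T-≡ {true} {false} f _ = ⊥-elim (f _)
T-≡ {true} {true} _ _ = refl

Equivalent⇒≈ : ∀ {n} {C D : Code n} → Equivalent C D → C ≈ D
Equivalent⇒≈ {n} {C} {D} (σ , τ , h) = iso σ a λ w → T-≡
  (λ w∈C → Equivalence.from (h (isometry σ a w)) (w , w∈C , agree w))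
  (λ p → back w (Equivalence.to (h (isometry σ a w)) p))
  where
  a : Word n
  a = tabulate (λ i → τ i ⟨$⟩ʳ 0F)
  agree : ∀ w → permuteAlphabets τ (permuteCoordinates σ w) ≡ isometry σ a w
  agree w = ≡-lookup λ i → trans (lookup∘tabulate (λ i → τ i ⟨$⟩ʳ lookup (permuteCoordinates σ w) i) i)
    (trans (permutation-⊕ (τ i) (lookup (permuteCoordinates σ w) i))
    (trans (cong (lookup (permuteCoordinates σ w) i ⊕_) (sym (lookup∘tabulate (λ i → τ i ⟨$⟩ʳ 0F) i)))
           (sym (lookup-zipWith _⊕_ i (permuteCoordinates σ w) a))))
  back : ∀ w → ∃[ u ] (u ∈ C × permuteAlphabets τ (permuteCoordinates σ u) ≡ isometry σ a w) → w ∈ C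
  back w (u , u∈C , eq) = subst (_∈ C) (trans (sym (isometry-inverse′ σ a u))
    (trans (cong (isometry (flip σ) (inverseWord σ a)) (trans (sym (agree u)) eq)) (isometry-inverse′ σ a w))) u∈C

GoodCode-≈ : ∀ {n m} {C D : Code n} → C ≈ D → GoodCode m C → GoodCode m D
GoodCode-≈ {n} {m} {C} {D} (iso σ a h) (dist , size , div) =
  (λ u v u∈D v∈D u≢v → subst (8 ℕ.≤_) (dH-isometry (flip σ) (inverseWord σ a) u v)
     (dist (Ψ u) (Ψ v) (back u u∈D) (back v v∈D)
        (λ eq → u≢v (trans (sym (isometry-inverse σ a u)) (trans (cong Φ eq) (isometry-inverse σ a v)))))) ,
  mk↔ₛ′ to from to-from from-to ,
  (λ u v u∈D v∈D → subst (4 ∣_) (dH-isometry (flip σ) (inverseWord σ a) u v) (div (Ψ u) (Ψ v) (back u u∈D) (back v v∈D)))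
  where
  Φ Ψ : Word n → Word n
  Φ = isometry σ a
  Ψ = isometry (flip σ) (inverseWord σ a)
  back : ∀ v → v ∈ D → Ψ v ∈ C
  back v p = subst T (sym (trans (h (Ψ v)) (cong D (isometry-inverse σ a v)))) p
  forth : ∀ w → w ∈ C → Φ w ∈ D
  forth w p = subst T (h w) p
  to : Fin m → ∃[ w ] w ∈ D
  to i = Φ (proj₁ (Inverse.to size i)) , forth _ (proj₂ (Inverse.to size i))
  from : ∃[ w ] w ∈ D → Fin m
  from (v , p) = Inverse.from size (Ψ v , back v p)
  to-from : ∀ p → to (from p) ≡ p
  to-from (v , p) = member-≡ {C = D} (trans (cong (Φ ∘ proj₁) (Inverse.strictlyInverseˡ size (Ψ v , back v p))) (isometry-inverse σ a v))
  from-to : ∀ i → from (to i) ≡ i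
  from-to i = trans (cong (Inverse.from size) (member-≡ {C = C} (isometry-inverse′ σ a (proj₁ (Inverse.to size i))))) (Inverse.strictlyInverseʳ size i)

injective⇒hit : ∀ {n} {f : Fin n → Fin n} → Injective _≡_ _≡_ f → ∀ y → ∃[ x ] f x ≡ y
injective⇒hit {n} {f} inj y with any? (λ x → f x ≟ y)
... | yes hit = hit
... | no miss = contradiction (Finₚ.injective⇒≤ g-inj) ℕₚ.1+n≰n
  where
  g : Fin (suc n) → Fin n
  g zero = y
  g (suc x) = f x
  g-inj : Injective _≡_ _≡_ g
  g-inj {zero} {zero} _ = refl
  g-inj {zero} {suc x} eq = contradiction (x , sym eq) miss
  g-inj {suc x} {zero} eq = contradiction (x , eq) miss
  g-inj {suc x} {suc z} eq = cong suc (inj eq)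

injective⇒permutation : ∀ {n} (f : Fin n → Fin n) → Injective _≡_ _≡_ f → Permutation′ n
injective⇒permutation f inj = permutation f (proj₁ ∘ injective⇒hit inj)
  (λ y → proj₂ (injective⇒hit inj y)) (λ x → inj (proj₂ (injective⇒hit inj (f x))))


-- Codes with standard tetrads

-- The twenty coordinates are arranged in five blocks of four; at w i j is the j-th entry
-- of the i-th block.
at : Word 20 → Fin 5 → Fin 4 → 𝔽₂
at w i j = lookup w (combine i j)

-- The word with prescribed entries in the blocks
fromBlocks : (Fin 5 → Fin 4 → 𝔽₂) → Word 20
fromBlocks F = tabulate (λ p → F (quotient 4 p) (remainder {5} 4 p))

at-fromBlocks : ∀ F i j → at (fromBlocks F) i j ≡ F i j
at-fromBlocks F i j = trans (lookup∘tabulate (λ p → F (quotient 4 p) (remainder {5} 4 p)) (combine i j))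
  (cong (λ p → F (proj₁ p) (proj₂ p)) (remQuot-combine i j))

≡-at : ∀ {u v : Word 20} → (∀ i j → at u i j ≡ at v i j) → u ≡ v
≡-at {u} {v} h = ≡-lookup λ p → trans (cong (lookup u) (sym (combine-remQuot {5} 4 p)))
  (trans (h (quotient 4 p) (remainder {5} 4 p)) (cong (lookup v) (combine-remQuot {5} 4 p)))

at-⊞ : ∀ u v i j → at (u ⊞ v) i j ≡ at u i j ⊕ at v i j
at-⊞ u v i j = lookup-zipWith _⊕_ (combine i j) u v

-- The indicator word of a block
block : Fin 5 → Word 20
block i = fromBlocks (λ i′ _ → if does (i ≟ i′) then 1F else 0F)

-- Codes containing the zero word whose tetrads are the five blocks
record Tetradic (D : Code 20) : Set where
  field
    good : GoodCode 256 D
    zero∈ : 𝟎 ∈ D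
    closed : ∀ i v → v ∈ D → v ⊞ (𝟏 ⊞ block i) ∈ D

disjoint-words : ∀ {n} (x y : Word n) → inter x y ≡ 0 → ∀ p → lookup x p ≡ 1F → lookup y p ≡ 1F → ⊥
disjoint-words (1F ∷ x) (1F ∷ y) () zero refl refl
disjoint-words (0F ∷ x) (_ ∷ y) e (suc p) h k = disjoint-words x y e p h k
disjoint-words (1F ∷ x) (0F ∷ y) e (suc p) h k = disjoint-words x y e p h k
disjoint-words (1F ∷ x) (1F ∷ y) () (suc p) h k

wt-indicator : ∀ {n} (w : Word n) → ∑ (λ p → indicator (lookup w p ≟ 1F)) ≡ + wt w
wt-indicator [] = ∑-empty (λ p → indicator (lookup [] p ≟ 1F))
wt-indicator (0F ∷ w) = trans (∑-suc (λ p → indicator (lookup (0F ∷ w) p ≟ 1F)))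
  (trans (ℤₚ.+-identityˡ _) (wt-indicator w))
wt-indicator (1F ∷ w) = trans (∑-suc (λ p → indicator (lookup (1F ∷ w) p ≟ 1F))) (cong (+ 1 +ᶻ_) (wt-indicator w))

-- An enumeration of the support of a word of weight k
support : ∀ {n} (w : Word n) k → wt w ≡ k → Σ[ e ∈ (Fin k → Fin n) ] Injective _≡_ _≡_ e × (∀ j → lookup w (e j) ≡ 1F)
support w k h = choose (λ p → lookup w p ≟ 1F) k (trans (wt-indicator w) (cong +_ h))

not-one : ∀ {b : 𝔽₂} → (b ≡ 1F → ⊥) → b ≡ 0F
not-one {0F} _ = refl
not-one {1F} h = ⊥-elim (h refl)

remQuot-injective : ∀ {p q : Fin 20} → quotient {5} 4 p ≡ quotient 4 q → remainder {5} 4 p ≡ remainder {5} 4 q → p ≡ q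
remQuot-injective {p} {q} h k = trans (sym (combine-remQuot {5} 4 p)) (trans (cong₂ combine h k) (combine-remQuot {5} 4 q))

-- Any five disjoint tetrads are carried to the blocks by a coordinate permutation.
module Straighten (T : Fin 5 → Word 20) (wt-T : ∀ i → wt (T i) ≡ 4)
                  (disjoint : ∀ {i j} → i ≢ j → inter (T i) (T j) ≡ 0) where

  -- The j-th coordinate of block i goes to the j-th element of T i.
  place : Fin 20 → Fin 20
  place p = proj₁ (support (T (quotient 4 p)) 4 (wt-T (quotient 4 p))) (remainder {5} 4 p)

  place∈ : ∀ p → lookup (T (quotient 4 p)) (place p) ≡ 1F
  place∈ p = proj₂ (proj₂ (support (T (quotient 4 p)) 4 (wt-T (quotient 4 p)))) (remainder {5} 4 p)

  place∉ : ∀ p i → i ≢ quotient 4 p → lookup (T i) (place p) ≡ 0F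
  place∉ p i i≢ = not-one λ eq → disjoint-words (T i) (T (quotient 4 p)) (disjoint i≢) (place p) eq (place∈ p)

  same-block : ∀ p q → place p ≡ place q → quotient {5} 4 p ≡ quotient 4 q
  same-block p q eq with quotient {5} 4 p ≟ quotient 4 q
  ... | yes e = e
  ... | no ne = contradiction (trans (sym (place∈ p)) (trans (cong (lookup (T (quotient 4 p))) eq) (place∉ q (quotient 4 p) ne))) λ ()

  place-injective : Injective _≡_ _≡_ place
  place-injective {p} {q} eq = remQuot-injective {p} {q} (same-block p q eq) (rem-≡ (quotient 4 p) (quotient 4 q) (same-block p q eq) eq)
    where
    rem-≡ : ∀ i i′ {j j′} → i ≡ i′ → proj₁ (support (T i) 4 (wt-T i)) j ≡ proj₁ (support (T i′) 4 (wt-T i′)) j′ → j ≡ j′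
    rem-≡ i .i refl h = proj₁ (proj₂ (support (T i) 4 (wt-T i))) h

  straighten : Permutation′ 20
  straighten = injective⇒permutation place place-injective

  straighten-block : ∀ i → permuteCoordinates straighten (T i) ≡ block i
  straighten-block i = ≡-lookup λ p → trans (permute-lookup straighten (T i) p)
    (trans (value p) (sym (lookup∘tabulate (λ p → if does (i ≟ quotient 4 p) then 1F else 0F) p)))
    where
    value : ∀ p → lookup (T i) (place p) ≡ (if does (i ≟ quotient 4 p) then 1F else 0F)
    value p with i ≟ quotient 4 p
    ... | yes refl = place∈ p
    ... | no ne = place∉ p i ne

permute-𝟏 : ∀ {n} (σ : Permutation′ n) → permuteCoordinates σ 𝟏 ≡ 𝟏
permute-𝟏 σ = ≡-lookup λ p → trans (permute-lookup σ 𝟏 p) (trans (lookup-replicate (σ ⟨$⟩ʳ p) 1F) (sym (lookup-replicate p 1F)))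

permute-𝟎 : ∀ {n} (σ : Permutation′ n) → permuteCoordinates σ 𝟎 ≡ 𝟎
permute-𝟎 σ = ≡-lookup λ p → trans (permute-lookup σ 𝟎 p) (trans (lookup-replicate (σ ⟨$⟩ʳ p) 0F) (sym (lookup-replicate p 0F)))

module Normalise {m : ℕ} (m≡256 : m ≡ 256) (D : Code 20) (good : GoodCode m D) (a : Fin m) where

  open Tetrads m≡256 D good
  open Straighten (tetrad a) (tetrad-weight a) (λ {i} {j} → tetrad-disjoint a {i} {j})

  offset : Word 20
  offset = permuteCoordinates straighten (codeword a)

  straightened : Code 20
  straightened = image straighten offset D

  D≈straightened : D ≈ straightened
  D≈straightened = ≈-image straighten offset D

  Φ : Word 20 → Word 20
  Φ = isometry straighten offset

  Φ∈ : ∀ v → v ∈ D → Φ v ∈ straightened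
  Φ∈ v = subst T (cong D (sym (isometry-inverse′ straighten offset v)))

  Φ-translate : ∀ v i → Φ (v ⊞ (𝟏 ⊞ tetrad a i)) ≡ Φ v ⊞ (𝟏 ⊞ block i)
  Φ-translate v i = trans (cong (_⊞ offset) (trans (permute-⊞ straighten v (𝟏 ⊞ tetrad a i))
      (cong (permuteCoordinates straighten v ⊞_) (trans (permute-⊞ straighten 𝟏 (tetrad a i))
        (cong₂ _⊞_ (permute-𝟏 straighten) (straighten-block i))))))
    (trans (⊞-assoc (permuteCoordinates straighten v) (𝟏 ⊞ block i) offset)
    (trans (cong (permuteCoordinates straighten v ⊞_) (⊞-comm (𝟏 ⊞ block i) offset))
           (sym (⊞-assoc (permuteCoordinates straighten v) offset (𝟏 ⊞ block i)))))

  straightened-zero : 𝟎 ∈ straightened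
  straightened-zero = subst (_∈ straightened) (⊞-self offset) (Φ∈ (codeword a) (codeword∈ a))

  straightened-closed : ∀ i v → v ∈ straightened → v ⊞ (𝟏 ⊞ block i) ∈ straightened
  straightened-closed i v v∈ = step (index v∈)
    where
    Ψ : Word 20 → Word 20
    Ψ = isometry (flip straighten) (inverseWord straighten offset)
    step : ∃[ b ] codeword b ≡ Ψ v → v ⊞ (𝟏 ⊞ block i) ∈ straightened
    step (b , eq) = subst (_∈ straightened)
      (trans (Φ-translate (codeword b) i) (cong (_⊞ (𝟏 ⊞ block i)) (trans (cong Φ eq) (isometry-inverse straighten offset v))))
      (Φ∈ (codeword b ⊞ (𝟏 ⊞ tetrad a i)) (tetrad-closed a i b))

normalise : ∀ {m} → m ≡ 256 → Fin m → (D : Code 20) → GoodCode m D → ∃[ D′ ] D ≈ D′ × Tetradic D′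
normalise refl a D good = straightened , D≈straightened , record
  { good = GoodCode-≈ D≈straightened good
  ; zero∈ = straightened-zero
  ; closed = straightened-closed
  }
  where open Normalise refl D good a

-- The parity of the number of ones in a block
blockSum : Word 20 → Fin 5 → 𝔽₂
blockSum w i = at w i 0F ⊕ at w i 1F ⊕ at w i 2F ⊕ at w i 3F

sgn-quad : ∀ a b c d → sgn a *ᶻ (sgn b *ᶻ (sgn c *ᶻ (sgn d *ᶻ + 1))) ≡ + 1 → a ⊕ b ⊕ c ⊕ d ≡ 0F
sgn-quad 0F 0F 0F 0F _ = refl
sgn-quad 0F 0F 0F 1F ()
sgn-quad 0F 0F 1F 0F ()
sgn-quad 0F 0F 1F 1F _ = refl
sgn-quad 0F 1F 0F 0F ()
sgn-quad 0F 1F 0F 1F _ = refl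
sgn-quad 0F 1F 1F 0F _ = refl
sgn-quad 0F 1F 1F 1F ()
sgn-quad 1F 0F 0F 0F ()
sgn-quad 1F 0F 0F 1F _ = refl
sgn-quad 1F 0F 1F 0F _ = refl
sgn-quad 1F 0F 1F 1F ()
sgn-quad 1F 1F 0F 0F _ = refl
sgn-quad 1F 1F 0F 1F ()
sgn-quad 1F 1F 1F 0F ()
sgn-quad 1F 1F 1F 1F _ = refl

χ-block : ∀ w i → χ (block i) w ≡ + 1 → blockSum w i ≡ 0F
χ-block (a ∷ b ∷ c ∷ d ∷ e ∷ f ∷ g ∷ h ∷ k ∷ l ∷ m ∷ n ∷ o ∷ p ∷ q ∷ r ∷ s ∷ t ∷ u ∷ v ∷ []) 0F = sgn-quad a b c d
χ-block (a ∷ b ∷ c ∷ d ∷ e ∷ f ∷ g ∷ h ∷ k ∷ l ∷ m ∷ n ∷ o ∷ p ∷ q ∷ r ∷ s ∷ t ∷ u ∷ v ∷ []) 1F = sgn-quad e f g h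
χ-block (a ∷ b ∷ c ∷ d ∷ e ∷ f ∷ g ∷ h ∷ k ∷ l ∷ m ∷ n ∷ o ∷ p ∷ q ∷ r ∷ s ∷ t ∷ u ∷ v ∷ []) 2F = sgn-quad k l m n
χ-block (a ∷ b ∷ c ∷ d ∷ e ∷ f ∷ g ∷ h ∷ k ∷ l ∷ m ∷ n ∷ o ∷ p ∷ q ∷ r ∷ s ∷ t ∷ u ∷ v ∷ []) 3F = sgn-quad o p q r
χ-block (a ∷ b ∷ c ∷ d ∷ e ∷ f ∷ g ∷ h ∷ k ∷ l ∷ m ∷ n ∷ o ∷ p ∷ q ∷ r ∷ s ∷ t ∷ u ∷ v ∷ []) 4F = sgn-quad s t u v

-- The complement of a block is a codeword, so all codewords meet every block evenly.
block-even : ∀ {D} → Tetradic D → ∀ v → v ∈ D → ∀ i → blockSum v i ≡ 0F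
block-even {D} tet v v∈ i = χ-block v i (trans (cong (λ y → χ y v) (sym (⊞-cancel 𝟏 (block i))))
  (trans (χ-complement (𝟏 ⊞ block i) v) (cong₂ _*ᶻ_
    (trans (χ-inter (𝟏 ⊞ block i) v) (altSign-even (even-inter (𝟏 ⊞ block i) v (weight (𝟏 ⊞ block i) c∈) (weight v v∈)
      (subst (4 ∣_) (dH≡wt (𝟏 ⊞ block i) v) (div (𝟏 ⊞ block i) v c∈ v∈)))))
    (altSign-even (∣-trans (divides 2 refl) (weight v v∈))))))
  where
  open Tetradic tet
  div : DistancesDivisibleBy 4 D
  div = proj₂ (proj₂ good)
  c∈ : 𝟏 ⊞ block i ∈ D
  c∈ = subst (_∈ D) (⊞-identityˡ (𝟏 ⊞ block i)) (closed i 𝟎 zero∈)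
  weight : ∀ w → w ∈ D → 4 ∣ wt w
  weight w w∈ = subst (4 ∣_) (trans (dH≡wt 𝟎 w) (cong wt (⊞-identityˡ w))) (div 𝟎 w zero∈ w∈)


-- Labels and signs

-- Modulo complementation, an even word of length four is zero or a partition of the four
-- positions into two pairs. The four classes are labelled by 0, 1, 2, 3, where k ≠ 0 stands
-- for the class of the pair of positions other than 0 and k. The word β k is the member of
-- class k with entry 0 in position 0. As a form on the field of four elements, β is the
-- nondegenerate alternating bilinear form.
β : Fin 4 → Fin 4 → 𝔽₂
β k j = if does (k ≟ 0F) ∨ does (j ≟ 0F) ∨ does (k ≟ j) then 0F else 1F

-- The label k is determined by β k 1 and β k 2.
label : 𝔽₂ → 𝔽₂ → Fin 4
label 0F 0F = 0F
label 0F 1F = 1F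
label 1F 0F = 2F
label 1F 1F = 3F

-- One label for each block
Glue : Set
Glue = Vec (Fin 4) 5

opaque
  -- The word with given labels in which the entry in position 0 of block i is a i. All words
  -- that are even on the blocks arise in this way from a unique pair. It is opaque so that the
  -- pair can be recovered by unification.
  word : Glue → Word 5 → Word 20
  word γ a = fromBlocks (λ i j → lookup a i ⊕ β (lookup γ i) j)

  at-word : ∀ γ a i j → at (word γ a) i j ≡ lookup a i ⊕ β (lookup γ i) j
  at-word γ a = at-fromBlocks (λ i j → lookup a i ⊕ β (lookup γ i) j)

-- The labels of a word and its entries in position 0 of the blocks, called its signs
glueOf : Word 20 → Glue
glueOf w = tabulate (λ i → label (at w i 0F ⊕ at w i 1F) (at w i 0F ⊕ at w i 2F))

signOf : Word 20 → Word 5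
signOf w = tabulate (λ i → at w i 0F)

word-glueOf-signOf : ∀ w → (∀ i → blockSum w i ≡ 0F) → word (glueOf w) (signOf w) ≡ w
word-glueOf-signOf w even = ≡-at λ i j → trans (at-word (glueOf w) (signOf w) i j)
  (trans (cong₂ (λ s k → s ⊕ β k j) (lookup∘tabulate (λ i → at w i 0F) i)
           (lookup∘tabulate (λ i → label (at w i 0F ⊕ at w i 1F) (at w i 0F ⊕ at w i 2F)) i))
    (recover (at w i) (even i) j))
  where
  table : ∀ a b c d → a ⊕ b ⊕ c ⊕ d ≡ 0F → ∀ j →
          a ⊕ β (label (a ⊕ b) (a ⊕ c)) j ≡ lookup (a ∷ b ∷ c ∷ d ∷ []) j
  table = from-yes (all? λ a → all? λ b → all? λ c → all? λ d → (a ⊕ b ⊕ c ⊕ d ≟ 0F) →-dec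
            all? λ j → a ⊕ β (label (a ⊕ b) (a ⊕ c)) j ≟ lookup (a ∷ b ∷ c ∷ d ∷ []) j)
  recover : ∀ (q : Fin 4 → 𝔽₂) → q 0F ⊕ q 1F ⊕ q 2F ⊕ q 3F ≡ 0F → ∀ j →
            q 0F ⊕ β (label (q 0F ⊕ q 1F) (q 0F ⊕ q 2F)) j ≡ q j
  recover q e j = trans (table (q 0F) (q 1F) (q 2F) (q 3F) e j) (entry j)
    where
    entry : ∀ j → lookup (q 0F ∷ q 1F ∷ q 2F ∷ q 3F ∷ []) j ≡ q j
    entry 0F = refl
    entry 1F = refl
    entry 2F = refl
    entry 3F = refl

glueOf-word : ∀ γ a → glueOf (word γ a) ≡ γ
glueOf-word γ a = trans (tabulate-cong λ i → trans
    (cong₂ label (cong₂ _⊕_ (at-word γ a i 0F) (at-word γ a i 1F)) (cong₂ _⊕_ (at-word γ a i 0F) (at-word γ a i 2F)))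
    (table (lookup a i) (lookup γ i)))
  (tabulate∘lookup γ)
  where
  table : ∀ a k → label ((a ⊕ β k 0F) ⊕ (a ⊕ β k 1F)) ((a ⊕ β k 0F) ⊕ (a ⊕ β k 2F)) ≡ k
  table = from-yes (all? λ a → all? λ k → label ((a ⊕ β k 0F) ⊕ (a ⊕ β k 1F)) ((a ⊕ β k 0F) ⊕ (a ⊕ β k 2F)) ≟ k)

signOf-word : ∀ γ a → signOf (word γ a) ≡ a
signOf-word γ a = trans (tabulate-cong λ i → trans (at-word γ a i 0F) (table (lookup a i) (lookup γ i))) (tabulate∘lookup a)
  where
  table : ∀ a k → a ⊕ β k 0F ≡ a
  table = from-yes (all? λ a → all? λ k → a ⊕ β k 0F ≟ a)

-- The distance of two even words of length four: distinct labels give 2, equal labels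
-- give 0 or 4 according to the signs.
quadDist : Fin 4 → 𝔽₂ → Fin 4 → 𝔽₂ → ℕ
quadDist k a k′ a′ = if does (k ≟ k′) then (if does (a ≟ a′) then 0 else 4) else 2

-- The distance of two words in terms of labels and signs
glueDist : ∀ {n} → Vec (Fin 4) n → Word n → Vec (Fin 4) n → Word n → ℕ
glueDist [] [] [] [] = 0
glueDist (k ∷ γ) (a ∷ as) (k′ ∷ γ′) (a′ ∷ as′) = quadDist k a k′ a′ ℕ.+ glueDist γ as γ′ as′

sum-++ : ∀ m n (f : Fin (m ℕ.+ n) → ℕ) →
         ℕΣ.sum f ≡ ℕΣ.sum (λ i → f (i ↑ˡ n)) ℕ.+ ℕΣ.sum (λ j → f (m ↑ʳ j))
sum-++ zero n f = refl
sum-++ (suc m) n f = trans (cong (f zero ℕ.+_) (sum-++ m n (f ∘ suc))) (sym (ℕₚ.+-assoc (f zero) _ _))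

sum-combine : ∀ m n (f : Fin (m ℕ.* n) → ℕ) → ℕΣ.sum f ≡ ℕΣ.sum (λ i → ℕΣ.sum (λ j → f (combine {m} {n} i j)))
sum-combine zero n f = refl
sum-combine (suc m) n f = trans (sum-++ n (m ℕ.* n) f)
  (cong (ℕΣ.sum (λ j → f (combine {suc m} zero j)) ℕ.+_) (sum-combine m n (λ p → f (n ↑ʳ p))))

glueDist-sum : ∀ {n} (γ : Vec (Fin 4) n) a γ′ a′ →
               ℕΣ.sum (λ i → quadDist (lookup γ i) (lookup a i) (lookup γ′ i) (lookup a′ i)) ≡ glueDist γ a γ′ a′
glueDist-sum [] [] [] [] = refl
glueDist-sum (k ∷ γ) (a ∷ as) (k′ ∷ γ′) (a′ ∷ as′) = cong (quadDist k a k′ a′ ℕ.+_) (glueDist-sum γ as γ′ as′)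

dH-word : ∀ γ a γ′ a′ → dH (word γ a) (word γ′ a′) ≡ glueDist γ a γ′ a′
dH-word γ a γ′ a′ = trans (dH≡wt (word γ a) (word γ′ a′)) (trans (wt-sum (word γ a ⊞ word γ′ a′))
  (trans (sum-combine 5 4 (λ p → toℕ (lookup (word γ a ⊞ word γ′ a′) p)))
  (trans (ℕΣ.sum-cong-≗ {5} λ i → trans
    (ℕΣ.sum-cong-≗ {4} λ j → cong toℕ (trans (at-⊞ (word γ a) (word γ′ a′) i j) (cong₂ _⊕_ (at-word γ a i j) (at-word γ′ a′ i j))))
    (table (lookup γ i) (lookup a i) (lookup γ′ i) (lookup a′ i)))
  (glueDist-sum γ a γ′ a′))))
  where
  table : ∀ k a k′ a′ → ℕΣ.sum {4} (λ j → toℕ ((a ⊕ β k j) ⊕ (a′ ⊕ β k′ j))) ≡ quadDist k a k′ a′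
  table = from-yes (all? λ k → all? λ a → all? λ k′ → all? λ a′ →
            ℕΣ.sum {4} (λ j → toℕ ((a ⊕ β k j) ⊕ (a′ ⊕ β k′ j))) ℕ.≟ quadDist k a k′ a′)

-- The Hamming distance of glue vectors
differ : Fin 4 → Fin 4 → ℕ
differ k k′ = if does (k ≟ k′) then 0 else 1

hamming : ∀ {n} → Vec (Fin 4) n → Vec (Fin 4) n → ℕ
hamming [] [] = 0
hamming (k ∷ γ) (k′ ∷ γ′) = differ k k′ ℕ.+ hamming γ γ′

hamming-≤ : ∀ {n} (γ γ′ : Vec (Fin 4) n) → hamming γ γ′ ℕ.≤ n
hamming-≤ [] [] = z≤n
hamming-≤ (k ∷ γ) (k′ ∷ γ′) = ℕₚ.+-mono-≤ (at-most-one (does (k ≟ k′))) (hamming-≤ γ γ′)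
  where
  at-most-one : ∀ b → (if b then 0 else 1) ℕ.≤ 1
  at-most-one true = z≤n
  at-most-one false = ℕₚ.≤-refl

-- The sum of the entries in the field of two elements
parity : ∀ {n} → Word n → 𝔽₂
parity [] = 0F
parity (b ∷ w) = b ⊕ parity w

parity-⊞ : ∀ {n} (u v : Word n) → parity (u ⊞ v) ≡ parity u ⊕ parity v
parity-⊞ [] [] = refl
parity-⊞ (a ∷ u) (b ∷ v) = trans (cong (a ⊕ b ⊕_) (parity-⊞ u v)) (table a b (parity u) (parity v))
  where
  table : ∀ a b p q → a ⊕ b ⊕ (p ⊕ q) ≡ (a ⊕ p) ⊕ (b ⊕ q)
  table = from-yes (all? λ a → all? λ b → all? λ p → all? λ q → a ⊕ b ⊕ (p ⊕ q) ≟ (a ⊕ p) ⊕ (b ⊕ q))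

glueDist-refl : ∀ {n} (γ : Vec (Fin 4) n) a → glueDist γ a γ a ≡ 0
glueDist-refl [] [] = refl
glueDist-refl (k ∷ γ) (a ∷ as) = cong₂ ℕ._+_ (table k a) (glueDist-refl γ as)
  where
  table : ∀ k a → quadDist k a k a ≡ 0
  table = from-yes (all? λ k → all? λ a → quadDist k a k a ℕ.≟ 0)

glueDist-same-signs : ∀ {n} (γ γ′ : Vec (Fin 4) n) a → glueDist γ a γ′ a ≡ 2 ℕ.* hamming γ γ′
glueDist-same-signs [] [] [] = refl
glueDist-same-signs (k ∷ γ) (k′ ∷ γ′) (a ∷ as) = trans (cong₂ ℕ._+_ (table k k′ a) (glueDist-same-signs γ γ′ as))
  (sym (ℕₚ.*-distribˡ-+ 2 (differ k k′) (hamming γ γ′)))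
  where
  table : ∀ k k′ a → quadDist k a k′ a ≡ 2 ℕ.* differ k k′
  table = from-yes (all? λ k → all? λ k′ → all? λ a → quadDist k a k′ a ℕ.≟ 2 ℕ.* differ k k′)

-- If two glue vectors differ, the sign in a block where they differ does not affect the
-- distance. Adjusting it, the least possible distance is reached with signs of any parity.
closest-signs : ∀ {n} (γ γ′ : Vec (Fin 4) n) → γ ≢ γ′ → ∀ a′ p →
                ∃[ a ] parity a ≡ p × glueDist γ a γ′ a′ ≡ 2 ℕ.* hamming γ γ′
closest-signs [] [] ne _ _ = contradiction refl ne
closest-signs (k ∷ γ) (k′ ∷ γ′) ne (x ∷ a′) p = by-cases (k ≟ k′)
  where
  table : ∀ k k′ b x → (k ≡ k′ → b ≡ x) → quadDist k b k′ x ≡ 2 ℕ.* differ k k′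
  table = from-yes (all? λ k → all? λ k′ → all? λ b → all? λ x →
            ((k ≟ k′) →-dec (b ≟ x)) →-dec (quadDist k b k′ x ℕ.≟ 2 ℕ.* differ k k′))
  extend : ∀ {b a} → (k ≡ k′ → b ≡ x) → glueDist γ a γ′ a′ ≡ 2 ℕ.* hamming γ γ′ →
           glueDist (k ∷ γ) (b ∷ a) (k′ ∷ γ′) (x ∷ a′) ≡ 2 ℕ.* hamming (k ∷ γ) (k′ ∷ γ′)
  extend {b} h d = trans (cong₂ ℕ._+_ (table k k′ b x h) d) (sym (ℕₚ.*-distribˡ-+ 2 (differ k k′) (hamming γ γ′)))
  by-cases : Dec (k ≡ k′) →
             ∃[ a ] parity a ≡ p × glueDist (k ∷ γ) a (k′ ∷ γ′) (x ∷ a′) ≡ 2 ℕ.* hamming (k ∷ γ) (k′ ∷ γ′)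
  by-cases (no k≢k′) = (p ⊕ parity a′ ∷ a′) , ⊕-cancelʳ p (parity a′) ,
    extend {p ⊕ parity a′} (λ e → contradiction e k≢k′) (glueDist-same-signs γ γ′ a′)
  by-cases (yes refl) with closest-signs γ γ′ (ne ∘ cong (k ∷_)) a′ (x ⊕ p)
  ... | a , e , d = (x ∷ a) , trans (cong (x ⊕_) e) (trans (sym (⊕-assoc x x p)) (cong (_⊕ p) (⊕-self x))) ,
    extend {x} {a} (λ _ → refl) d

-- The unit vectors
unit : Fin 5 → Word 5
unit i = tabulate (λ i′ → if does (i ≟ i′) then 1F else 0F)

word-flip : ∀ γ a i → word γ a ⊞ (𝟏 ⊞ block i) ≡ word γ (a ⊞ (𝟏 ⊞ unit i))
word-flip γ a i = ≡-at λ i′ j → trans (at-⊞ (word γ a) (𝟏 ⊞ block i) i′ j)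
  (trans (cong₂ _⊕_ (at-word γ a i′ j) (at-block i′ j))
  (trans (table (lookup a i′) (β (lookup γ i′) j) (lookup (𝟏 ⊞ unit i) i′))
  (sym (trans (at-word γ (a ⊞ (𝟏 ⊞ unit i)) i′ j)
    (cong (_⊕ β (lookup γ i′) j) (lookup-zipWith _⊕_ i′ a (𝟏 ⊞ unit i)))))))
  where
  table : ∀ a b c → (a ⊕ b) ⊕ c ≡ (a ⊕ c) ⊕ b
  table = from-yes (all? λ a → all? λ b → all? λ c → (a ⊕ b) ⊕ c ≟ (a ⊕ c) ⊕ b)
  at-block : ∀ i′ j → at (𝟏 ⊞ block i) i′ j ≡ lookup (𝟏 ⊞ unit i) i′
  at-block i′ j = trans (at-⊞ 𝟏 (block i) i′ j) (trans (cong₂ _⊕_ (lookup-replicate (combine i′ j) 1F)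
      (trans (at-fromBlocks (λ i′ _ → if does (i ≟ i′) then 1F else 0F) i′ j)
             (sym (lookup∘tabulate (λ i′ → if does (i ≟ i′) then 1F else 0F) i′))))
    (sym (trans (lookup-zipWith _⊕_ i′ 𝟏 (unit i)) (cong (_⊕ lookup (unit i) i′) (lookup-replicate i′ 1F)))))

module TetradicCode (D : Code 20) (tet : Tetradic D) where

  open Tetradic tet

  -- Words of signs that may be added without leaving the code
  SignShift : Word 5 → Set
  SignShift e = ∀ γ a → word γ a ∈ D → word γ (a ⊞ e) ∈ D

  shift-⊞ : ∀ e e′ → SignShift e → SignShift e′ → SignShift (e ⊞ e′)
  shift-⊞ e e′ s s′ γ a p = subst (λ x → word γ x ∈ D) (⊞-assoc a e e′) (s′ γ (a ⊞ e) (s γ a p))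

  -- The shift by the complement of block i, to be used or not. The complements of the unit
  -- vectors span the even words of length five.
  generator : Fin 5 → 𝔽₂ → Word 5
  generator i b = if does (b ≟ 1F) then 𝟏 ⊞ unit i else 𝟎

  shift-generator : ∀ i b → SignShift (generator i b)
  shift-generator i 0F γ a p = subst (λ x → word γ x ∈ D) (sym (trans (⊞-comm a 𝟎) (⊞-identityˡ a))) p
  shift-generator i 1F γ a p = subst (_∈ D) (word-flip γ a i) (closed i (word γ a) p)

  shift-even : ∀ e → parity e ≡ 0F → SignShift e
  shift-even e@(e₀ ∷ e₁ ∷ e₂ ∷ e₃ ∷ e₄ ∷ []) h = subst SignShift (table e₀ e₁ e₂ e₃ e₄ h)
    (shift-⊞ _ _ (shift-generator 0F e₀) (shift-⊞ _ _ (shift-generator 1F e₁) (shift-⊞ _ _ (shift-generator 2F e₂)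
      (shift-⊞ _ _ (shift-generator 3F e₃) (shift-generator 4F e₄)))))
    where
    table : ∀ e₀ e₁ e₂ e₃ e₄ → parity (e₀ ∷ e₁ ∷ e₂ ∷ e₃ ∷ e₄ ∷ []) ≡ 0F →
      generator 0F e₀ ⊞ (generator 1F e₁ ⊞ (generator 2F e₂ ⊞ (generator 3F e₃ ⊞ generator 4F e₄))) ≡ e₀ ∷ e₁ ∷ e₂ ∷ e₃ ∷ e₄ ∷ []
    table = from-yes (all? λ e₀ → all? λ e₁ → all? λ e₂ → all? λ e₃ → all? λ e₄ →
      (parity (e₀ ∷ e₁ ∷ e₂ ∷ e₃ ∷ e₄ ∷ []) ≟ 0F) →-dec
      (generator 0F e₀ ⊞ (generator 1F e₁ ⊞ (generator 2F e₂ ⊞ (generator 3F e₃ ⊞ generator 4F e₄))) ≟ʷ (e₀ ∷ e₁ ∷ e₂ ∷ e₃ ∷ e₄ ∷ [])))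

  -- Only the parity of the signs matters for membership.
  resign : ∀ γ a a′ → parity a′ ≡ parity a → word γ a ∈ D → word γ a′ ∈ D
  resign γ a a′ e p = subst (λ x → word γ x ∈ D) (⊞-cancel a a′)
    (shift-even (a ⊞ a′) (trans (parity-⊞ a a′) (trans (cong (parity a ⊕_) e) (⊕-self (parity a)))) γ a p)

  distance : ∀ γ a γ′ a′ → word γ a ∈ D → word γ′ a′ ∈ D → word γ a ≢ word γ′ a′ → 8 ℕ.≤ glueDist γ a γ′ a′
  distance γ a γ′ a′ p q ne = subst (8 ℕ.≤_) (dH-word γ a γ′ a′) (proj₁ good (word γ a) (word γ′ a′) p q ne)

  divisible : ∀ γ a γ′ a′ → word γ a ∈ D → word γ′ a′ ∈ D → 4 ∣ glueDist γ a γ′ a′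
  divisible γ a γ′ a′ p q = subst (4 ∣_) (dH-word γ a γ′ a′) (proj₂ (proj₂ good) (word γ a) (word γ′ a′) p q)

  -- Otherwise two codewords would have distance 4.
  same-glue⇒same-parity : ∀ γ a a′ → word γ a ∈ D → word γ a′ ∈ D → parity a ≡ parity a′
  same-glue⇒same-parity γ@(k ∷ γs) a a′@(x ∷ as) p q with parity a ≟ parity a′
  ... | yes e = e
  ... | no ne = contradiction (distance γ a″ γ a′ (resign γ a a″ (flipped x (parity as) (parity a) ne) p) q distinct)
                  (subst (λ d → ¬ 8 ℕ.≤ d) (sym (trans (cong₂ ℕ._+_ (table k x) (glueDist-refl γs as)) refl)) (from-no (8 ≤? 4)))
    where
    a″ : Word 5
    a″ = 1F ⊕ x ∷ as
    flipped : ∀ x y p → p ≢ x ⊕ y → 1F ⊕ x ⊕ y ≡ p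
    flipped = from-yes (all? λ x → all? λ y → all? λ p → ¬? (p ≟ x ⊕ y) →-dec (1F ⊕ x ⊕ y ≟ p))
    table : ∀ k x → quadDist k (1F ⊕ x) k x ≡ 4
    table = from-yes (all? λ k → all? λ x → quadDist k (1F ⊕ x) k x ℕ.≟ 4)
    distinct : word γ a″ ≢ word γ a′
    distinct eq = changed x (cong head (trans (sym (signOf-word γ a″)) (trans (cong signOf eq) (signOf-word γ a′))))
      where
      changed : ∀ x → 1F ⊕ x ≢ x
      changed 0F ()
      changed 1F ()

  -- With suitable signs the distance is 2 h, where h is the Hamming distance of the glue
  -- vectors. It is at least 8, at most 10 and divisible by 4.
  different-glue⇒hamming-4 : ∀ γ a γ′ a′ → word γ a ∈ D → word γ′ a′ ∈ D → γ ≢ γ′ → hamming γ γ′ ≡ 4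
  different-glue⇒hamming-4 γ a γ′ a′ p q ne = finish (closest-signs γ γ′ ne a′ (parity a))
    where
    only-4 : ∀ h → 8 ℕ.≤ 2 ℕ.* h → 4 ∣ 2 ℕ.* h → h ℕ.≤ 5 → h ≡ 4
    only-4 0 l _ _ = contradiction l (from-no (8 ≤? 0))
    only-4 1 l _ _ = contradiction l (from-no (8 ≤? 2))
    only-4 2 l _ _ = contradiction l (from-no (8 ≤? 4))
    only-4 3 l _ _ = contradiction l (from-no (8 ≤? 6))
    only-4 4 _ _ _ = refl
    only-4 5 _ d _ = contradiction d (from-no (4 ∣? 10))
    only-4 (suc (suc (suc (suc (suc (suc h)))))) _ _ u = contradiction (ℕₚ.≤-trans (ℕₚ.m≤m+n 6 h) u) (from-no (6 ≤? 5))
    finish : ∃[ b ] parity b ≡ parity a × glueDist γ b γ′ a′ ≡ 2 ℕ.* hamming γ γ′ → hamming γ γ′ ≡ 4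
    finish (b , e , d) = only-4 (hamming γ γ′)
      (subst (8 ℕ.≤_) d (distance γ b γ′ a′ b∈ q
        (λ eq → ne (trans (sym (glueOf-word γ b)) (trans (cong glueOf eq) (glueOf-word γ′ a′))))))
      (subst (4 ∣_) d (divisible γ b γ′ a′ b∈ q)) (hamming-≤ γ γ′)
      where
      b∈ : word γ b ∈ D
      b∈ = resign γ a b e p


-- Information set and relabelling

differ-refl : ∀ k → differ k k ≡ 0
differ-refl = from-yes (all? λ k → differ k k ℕ.≟ 0)

differ-≤ : ∀ k k′ → differ k k′ ℕ.≤ 1
differ-≤ = from-yes (all? λ k → all? λ k′ → differ k k′ ≤? 1)

opaque
  -- For a tetradic code, the first two labels and the first four signs, eight bits in all, form
  -- an information set.
  pack : Fin 4 → Fin 4 → 𝔽₂ → 𝔽₂ → 𝔽₂ → 𝔽₂ → Fin 256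
  pack k l a b c d = combine {4} {64} k (combine {4} {16} l (combine {2} {8} a (combine {2} {4} b (combine {2} {2} c d))))

  pack-injective : ∀ {k l a b c d k′ l′ a′ b′ c′ d′} → pack k l a b c d ≡ pack k′ l′ a′ b′ c′ d′ →
                   k ≡ k′ × l ≡ l′ × a ≡ a′ × b ≡ b′ × c ≡ c′ × d ≡ d′
  pack-injective {k} {l} {a} {b} {c} {d} {k′} {l′} {a′} {b′} {c′} {d′} eq
    with e₀ , r ← Finₚ.combine-injective {4} {64} k (combine {4} {16} l (combine {2} {8} a (combine {2} {4} b (combine {2} {2} c d)))) k′ _ eq
    with e₁ , r ← Finₚ.combine-injective {4} {16} l (combine {2} {8} a (combine {2} {4} b (combine {2} {2} c d))) l′ _ r
    with e₂ , r ← Finₚ.combine-injective {2} {8} a (combine {2} {4} b (combine {2} {2} c d)) a′ _ r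
    with e₃ , r ← Finₚ.combine-injective {2} {4} b (combine {2} {2} c d) b′ _ r
    with e₄ , e₅ ← Finₚ.combine-injective {2} {2} c d c′ d′ r = e₀ , e₁ , e₂ , e₃ , e₄ , e₅

module InformationSet (D : Code 20) (tet : Tetradic D) where

  open Tetradic tet
  open TetradicCode D tet

  as-word : ∀ {w} → w ∈ D → word (glueOf w) (signOf w) ∈ D
  as-word {w} w∈ = subst (_∈ D) (sym (word-glueOf-signOf w (block-even tet w w∈))) w∈

  -- The value of a word on the information set
  info : Word 20 → Fin 256
  info w = pack (lookup (glueOf w) 0F) (lookup (glueOf w) 1F)
    (lookup (signOf w) 0F) (lookup (signOf w) 1F) (lookup (signOf w) 2F) (lookup (signOf w) 3F)

  -- Glue vectors that agree in two blocks are at distance at most 3, hence equal.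
  two-agreements⇒equal : ∀ k₀ k₁ (γ γ′ : Vec (Fin 4) 3) a a′ →
    word (k₀ ∷ k₁ ∷ γ) a ∈ D → word (k₀ ∷ k₁ ∷ γ′) a′ ∈ D → γ ≡ γ′
  two-agreements⇒equal k₀ k₁ γ@(x ∷ y ∷ z ∷ []) γ′@(x′ ∷ y′ ∷ z′ ∷ []) a a′ p q with ≡-dec _≟_ γ γ′
  ... | yes e = e
  ... | no ne = contradiction (different-glue⇒hamming-4 (k₀ ∷ k₁ ∷ γ) a (k₀ ∷ k₁ ∷ γ′) a′ p q (ne ∘ cong (tail ∘ tail)))
    λ e → contradiction (ℕₚ.≤-trans (ℕₚ.≤-reflexive (trans (sym e)
        (cong₂ (λ d d′ → d ℕ.+ (d′ ℕ.+ hamming γ γ′)) (differ-refl k₀) (differ-refl k₁))))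
        (ℕₚ.+-mono-≤ (differ-≤ x x′) (ℕₚ.+-mono-≤ (differ-≤ y y′) (ℕₚ.+-mono-≤ (differ-≤ z z′) (z≤n {0})))))
      (from-no (4 ≤? 3))

  last-sign : ∀ b₀ b₁ b₂ b₃ x x′ → parity (b₀ ∷ b₁ ∷ b₂ ∷ b₃ ∷ x ∷ []) ≡ parity (b₀ ∷ b₁ ∷ b₂ ∷ b₃ ∷ x′ ∷ []) → x ≡ x′
  last-sign = from-yes (all? λ b₀ → all? λ b₁ → all? λ b₂ → all? λ b₃ → all? λ x → all? λ x′ →
    (parity (b₀ ∷ b₁ ∷ b₂ ∷ b₃ ∷ x ∷ []) ≟ parity (b₀ ∷ b₁ ∷ b₂ ∷ b₃ ∷ x′ ∷ [])) →-dec (x ≟ x′))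

  words-equal : ∀ (γ γ′ : Glue) (a a′ : Word 5) → word γ a ∈ D → word γ′ a′ ∈ D →
    lookup γ 0F ≡ lookup γ′ 0F → lookup γ 1F ≡ lookup γ′ 1F →
    lookup a 0F ≡ lookup a′ 0F → lookup a 1F ≡ lookup a′ 1F → lookup a 2F ≡ lookup a′ 2F → lookup a 3F ≡ lookup a′ 3F →
    word γ a ≡ word γ′ a′
  words-equal (k₀ ∷ k₁ ∷ γ) (.k₀ ∷ .k₁ ∷ γ′) a@(b₀ ∷ b₁ ∷ b₂ ∷ b₃ ∷ x ∷ []) a′@(.b₀ ∷ .b₁ ∷ .b₂ ∷ .b₃ ∷ x′ ∷ []) p q refl refl refl refl refl refl
    with refl ← two-agreements⇒equal k₀ k₁ γ γ′ a a′ p q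
    with refl ← last-sign b₀ b₁ b₂ b₃ x x′ (same-glue⇒same-parity (k₀ ∷ k₁ ∷ γ) a a′ p q) = refl

  info-injective : ∀ {w w′} → w ∈ D → w′ ∈ D → info w ≡ info w′ → w ≡ w′
  info-injective {w} {w′} w∈ w′∈ eq = finish (pack-injective eq)
    where
    Agree : Set
    Agree = lookup (glueOf w) 0F ≡ lookup (glueOf w′) 0F × lookup (glueOf w) 1F ≡ lookup (glueOf w′) 1F ×
      lookup (signOf w) 0F ≡ lookup (signOf w′) 0F × lookup (signOf w) 1F ≡ lookup (signOf w′) 1F ×
      lookup (signOf w) 2F ≡ lookup (signOf w′) 2F × lookup (signOf w) 3F ≡ lookup (signOf w′) 3F
    finish : Agree → w ≡ w′
    finish (e₀ , e₁ , e₂ , e₃ , e₄ , e₅) =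
      trans (sym (word-glueOf-signOf w (block-even tet w w∈)))
        (trans (words-equal (glueOf w) (glueOf w′) (signOf w) (signOf w′) (as-word w∈) (as-word w′∈) e₀ e₁ e₂ e₃ e₄ e₅)
               (word-glueOf-signOf w′ (block-even tet w′ w′∈)))

  -- A codeword beginning with two given labels
  Filled : Fin 4 → Fin 4 → Set
  Filled k₀ k₁ = Σ[ γ ∈ Vec (Fin 4) 3 ] Σ[ a ∈ Word 5 ] word (k₀ ∷ k₁ ∷ γ) a ∈ D

  opaque
    -- The information map is injective on the 256 codewords, hence onto.
    fill : ∀ k₀ k₁ → Filled k₀ k₁
    fill k₀ k₁ = from-hit (injective⇒hit composite-injective (pack k₀ k₁ 0F 0F 0F 0F))
      where
      size : HasSize D 256
      size = proj₁ (proj₂ good)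
      composite-injective : Injective _≡_ _≡_ (λ i → info (proj₁ (Inverse.to size i)))
      composite-injective {i} {j} eq = trans (sym (Inverse.strictlyInverseʳ size i)) (trans (cong (Inverse.from size)
        (member-≡ {C = D} (info-injective (proj₂ (Inverse.to size i)) (proj₂ (Inverse.to size j)) eq))) (Inverse.strictlyInverseʳ size j))
      reshape : ∀ (γ : Glue) (a : Word 5) → word γ a ∈ D → lookup γ 0F ≡ k₀ → lookup γ 1F ≡ k₁ → Filled k₀ k₁
      reshape (.k₀ ∷ .k₁ ∷ γ) a p refl refl = γ , a , p
      from-hit : ∃[ i ] info (proj₁ (Inverse.to size i)) ≡ pack k₀ k₁ 0F 0F 0F 0F → Filled k₀ k₁
      from-hit (i , eq) = reshape (glueOf (proj₁ (Inverse.to size i))) (signOf (proj₁ (Inverse.to size i)))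
        (as-word (proj₂ (Inverse.to size i))) (proj₁ (pack-injective eq)) (proj₁ (proj₂ (pack-injective eq)))

  zero-word : word (replicate 5 0F) 𝟎 ∈ D
  zero-word = subst (_∈ D) (≡-at λ i j → trans (lookup-replicate (combine i j) 0F) (sym (trans (at-word (replicate 5 0F) 𝟎 i j)
    (cong₂ (λ a k → a ⊕ β k j) (lookup-replicate i 0F) (lookup-replicate i 0F))))) zero∈

-- All permutations of the positions that fix position 0 preserve β.
β-permute : (π : Permutation′ 4) → π ⟨$⟩ʳ 0F ≡ 0F → ∀ k j → β k (π ⟨$⟩ʳ j) ≡ β (π ⟨$⟩ˡ k) j
β-permute π fix k j = cong (λ b → if b then 0F else 1F) (cong₂ _∨_
  (does-⇔ (mk⇔ (λ { refl → fix′ }) (λ e → trans (sym (inverseʳ π)) (trans (cong (π ⟨$⟩ʳ_) e) fix))) (k ≟ 0F) (π ⟨$⟩ˡ k ≟ 0F))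
  (cong₂ _∨_
    (does-⇔ (mk⇔ (λ e → trans (sym (inverseˡ π)) (trans (cong (π ⟨$⟩ˡ_) e) fix′)) (λ { refl → fix })) (π ⟨$⟩ʳ j ≟ 0F) (j ≟ 0F))
    (does-⇔ (mk⇔ (λ { refl → inverseˡ π }) (λ { refl → sym (inverseʳ π) })) (k ≟ π ⟨$⟩ʳ j) (π ⟨$⟩ˡ k ≟ j))))
  where
  fix′ : π ⟨$⟩ˡ 0F ≡ 0F
  fix′ = trans (cong (π ⟨$⟩ˡ_) (sym fix)) (inverseˡ π)

-- The coordinate permutation that moves whole blocks by ρ and permutes the positions within
-- the blocks by ψ. As ψ fixes position 0, signs are moved and labels are renamed.
module Relabelling (ρ : Permutation′ 5) (ψ : Fin 5 → Permutation′ 4) (fix : ∀ i → ψ i ⟨$⟩ʳ 0F ≡ 0F) where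

  move : Fin 20 → Fin 20
  move p = combine (ρ ⟨$⟩ʳ quotient 4 p) (ψ (quotient 4 p) ⟨$⟩ʳ remainder {5} 4 p)

  permutation-injective : ∀ {n} (π : Permutation′ n) {x y} → π ⟨$⟩ʳ x ≡ π ⟨$⟩ʳ y → x ≡ y
  permutation-injective π e = trans (sym (inverseˡ π)) (trans (cong (π ⟨$⟩ˡ_) e) (inverseˡ π))

  move-injective : Injective _≡_ _≡_ move
  move-injective {p} {q} eq = remQuot-injective {p} {q} same (inner (quotient 4 p) (quotient 4 q) same (proj₂ both))
    where
    both : ρ ⟨$⟩ʳ quotient 4 p ≡ ρ ⟨$⟩ʳ quotient 4 q ×
           ψ (quotient 4 p) ⟨$⟩ʳ remainder {5} 4 p ≡ ψ (quotient 4 q) ⟨$⟩ʳ remainder {5} 4 q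
    both = Finₚ.combine-injective (ρ ⟨$⟩ʳ quotient 4 p) (ψ (quotient 4 p) ⟨$⟩ʳ remainder {5} 4 p)
             (ρ ⟨$⟩ʳ quotient 4 q) (ψ (quotient 4 q) ⟨$⟩ʳ remainder {5} 4 q) eq
    same : quotient {5} 4 p ≡ quotient 4 q
    same = permutation-injective ρ (proj₁ both)
    inner : ∀ i i′ {j j′} → i ≡ i′ → ψ i ⟨$⟩ʳ j ≡ ψ i′ ⟨$⟩ʳ j′ → j ≡ j′
    inner i .i refl = permutation-injective (ψ i)

  σ : Permutation′ 20
  σ = injective⇒permutation move move-injective

  σ-combine : ∀ i j → σ ⟨$⟩ʳ combine i j ≡ combine (ρ ⟨$⟩ʳ i) (ψ i ⟨$⟩ʳ j)
  σ-combine i j = cong (λ p → combine (ρ ⟨$⟩ʳ proj₁ p) (ψ (proj₁ p) ⟨$⟩ʳ proj₂ p)) (remQuot-combine {5} {4} i j)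

  permute-at : ∀ w i j → at (permuteCoordinates σ w) i j ≡ at w (ρ ⟨$⟩ʳ i) (ψ i ⟨$⟩ʳ j)
  permute-at w i j = trans (permute-lookup σ w (combine i j)) (cong (lookup w) (σ-combine i j))

  relabelGlue : Glue → Glue
  relabelGlue γ = tabulate (λ i → ψ i ⟨$⟩ˡ lookup γ (ρ ⟨$⟩ʳ i))

  relabelSigns : Word 5 → Word 5
  relabelSigns a = tabulate (λ i → lookup a (ρ ⟨$⟩ʳ i))

  permute-word : ∀ γ a → permuteCoordinates σ (word γ a) ≡ word (relabelGlue γ) (relabelSigns a)
  permute-word γ a = ≡-at λ i j → trans (permute-at (word γ a) i j)
    (trans (at-word γ a (ρ ⟨$⟩ʳ i) (ψ i ⟨$⟩ʳ j))
    (trans (cong (lookup a (ρ ⟨$⟩ʳ i) ⊕_) (β-permute (ψ i) (fix i) (lookup γ (ρ ⟨$⟩ʳ i)) j))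
    (sym (trans (at-word (relabelGlue γ) (relabelSigns a) i j)
      (cong₂ (λ b k → b ⊕ β k j) (lookup∘tabulate (λ i → lookup a (ρ ⟨$⟩ʳ i)) i)
        (lookup∘tabulate (λ i → ψ i ⟨$⟩ˡ lookup γ (ρ ⟨$⟩ʳ i)) i))))))

  permute-block : ∀ i → permuteCoordinates σ (block (ρ ⟨$⟩ʳ i)) ≡ block i
  permute-block i = ≡-at λ i′ j → trans (permute-at (block (ρ ⟨$⟩ʳ i)) i′ j)
    (trans (at-fromBlocks (λ i′ _ → if does (ρ ⟨$⟩ʳ i ≟ i′) then 1F else 0F) (ρ ⟨$⟩ʳ i′) (ψ i′ ⟨$⟩ʳ j))
    (trans (cong (λ b → if b then 1F else 0F) (does-⇔ (mk⇔ (permutation-injective ρ) (cong (ρ ⟨$⟩ʳ_))) (ρ ⟨$⟩ʳ i ≟ ρ ⟨$⟩ʳ i′) (i ≟ i′)))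
           (sym (at-fromBlocks (λ i′ _ → if does (i ≟ i′) then 1F else 0F) i′ j))))

  isometry-σ : ∀ w → isometry σ 𝟎 w ≡ permuteCoordinates σ w
  isometry-σ w = trans (⊞-comm (permuteCoordinates σ w) 𝟎) (⊞-identityˡ (permuteCoordinates σ w))

  module _ (D : Code 20) (tet : Tetradic D) where

    relabelled : Code 20
    relabelled = image σ 𝟎 D

    D≈relabelled : D ≈ relabelled
    D≈relabelled = ≈-image σ 𝟎 D

    permuted∈ : ∀ w → w ∈ D → permuteCoordinates σ w ∈ relabelled
    permuted∈ w w∈ = subst (_∈ relabelled) (isometry-σ w) (subst T (cong D (sym (isometry-inverse′ σ 𝟎 w))) w∈)

    relabelled-word : ∀ γ a → word γ a ∈ D → word (relabelGlue γ) (relabelSigns a) ∈ relabelled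
    relabelled-word γ a p = subst (_∈ relabelled) (permute-word γ a) (permuted∈ (word γ a) p)

    relabelled-tetradic : Tetradic relabelled
    relabelled-tetradic = record
      { good = GoodCode-≈ D≈relabelled (Tetradic.good tet)
      ; zero∈ = subst (_∈ relabelled) (permute-𝟎 σ) (permuted∈ 𝟎 (Tetradic.zero∈ tet))
      ; closed = λ i v v∈ → subst (_∈ relabelled)
          (trans (permute-⊞ σ (Ψ v) (𝟏 ⊞ block (ρ ⟨$⟩ʳ i)))
            (cong₂ _⊞_ (trans (sym (isometry-σ (Ψ v))) (isometry-inverse σ 𝟎 v))
              (trans (permute-⊞ σ 𝟏 (block (ρ ⟨$⟩ʳ i))) (cong₂ _⊞_ (permute-𝟏 σ) (permute-block i)))))
          (permuted∈ (Ψ v ⊞ (𝟏 ⊞ block (ρ ⟨$⟩ʳ i))) (Tetradic.closed tet (ρ ⟨$⟩ʳ i) (Ψ v) v∈))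
      }
      where
      Ψ : Word 20 → Word 20
      Ψ = isometry (flip σ) (inverseWord σ 𝟎)


-- The shortened hexacode and the codes built from it

infixl 6 _+₄_

-- Addition in the field of four elements, whose nonzero elements are 1, 2 = ω, 3 = ω²
_+₄_ : Fin 4 → Fin 4 → Fin 4
0F +₄ l = l
k +₄ 0F = k
1F +₄ 1F = 0F
1F +₄ 2F = 3F
1F +₄ 3F = 2F
2F +₄ 1F = 3F
2F +₄ 2F = 0F
2F +₄ 3F = 1F
3F +₄ 1F = 2F
3F +₄ 2F = 1F
3F +₄ 3F = 0F

-- Multiplication by the primitive element ω
ω : Fin 4 → Fin 4
ω 0F = 0F
ω 1F = 2F
ω 2F = 3F
ω 3F = 1F

-- The sixteen glue vectors: the shortened hexacode, a linear code of length five and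
-- dimension two over the field of four elements in which nonzero words have weight four
row : Fin 4 → Fin 4 → Glue
row k l = k ∷ l ∷ (l +₄ k) ∷ (l +₄ ω k) ∷ (l +₄ ω (ω k)) ∷ []

-- The first two labels of a word
label₀ label₁ : Word 20 → Fin 4
label₀ w = lookup (glueOf w) 0F
label₁ w = lookup (glueOf w) 1F

-- The words with glue in the shortened hexacode whose signs have parity f of the glue. The
-- code codeOf f consists of these words.
data Codeword (f : Fin 4 → Fin 4 → 𝔽₂) : Word 20 → Set where
  mk : ∀ k l a → parity a ≡ f k l → Codeword f (word (row k l) a)

T-∧ : ∀ {x y} → T x → T y → T (x ∧ y)
T-∧ {true} {true} _ _ = _

opaque
  codeOf : (Fin 4 → Fin 4 → 𝔽₂) → Code 20
  codeOf f w = does (w ≟ʷ word (row (label₀ w) (label₁ w)) (signOf w)) ∧ does (parity (signOf w) ≟ f (label₀ w) (label₁ w))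

  ∈-codeOf : ∀ {f w} → Codeword f w → w ∈ codeOf f
  ∈-codeOf {f} (mk k l a h) = T-∧ (T-does (w ≟ʷ word (row (label₀ w) (label₁ w)) (signOf w)) (sym w≡))
      (T-does (parity (signOf w) ≟ f (label₀ w) (label₁ w))
        (trans (cong parity (signOf-word (row k l) a)) (trans h (sym (cong₂ f k≡ l≡)))))
    where
    w : Word 20
    w = word (row k l) a
    k≡ : label₀ w ≡ k
    k≡ = cong (λ γ → lookup γ 0F) (glueOf-word (row k l) a)
    l≡ : label₁ w ≡ l
    l≡ = cong (λ γ → lookup γ 1F) (glueOf-word (row k l) a)
    w≡ : word (row (label₀ w) (label₁ w)) (signOf w) ≡ w
    w≡ = cong₂ word (cong₂ row k≡ l≡) (signOf-word (row k l) a)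
    T-does : ∀ {P : Set} (d : Dec P) → P → T (does d)
    T-does (yes _) _ = _
    T-does (no ¬p) p = contradiction p ¬p

  codeOf-∈ : ∀ {f w} → w ∈ codeOf f → Codeword f w
  codeOf-∈ {f} {w} w∈ with w ≟ʷ word (row (label₀ w) (label₁ w)) (signOf w) | parity (signOf w) ≟ f (label₀ w) (label₁ w)
  ... | yes e | yes p = subst (Codeword f) (sym e) (mk (label₀ w) (label₁ w) (signOf w) p)

module GlueDistances (D : Code 20) (tet : Tetradic D) where

  open TetradicCode D tet public
  open InformationSet D tet public

  hamming-refl : ∀ {n} (γ : Vec (Fin 4) n) → hamming γ γ ≡ 0
  hamming-refl [] = refl
  hamming-refl (k ∷ γ) = cong₂ ℕ._+_ (differ-refl k) (hamming-refl γ)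

  hamming-0-or-4 : ∀ {γ a γ′ a′} → word γ a ∈ D → word γ′ a′ ∈ D → hamming γ γ′ ≡ 0 ⊎ hamming γ γ′ ≡ 4
  hamming-0-or-4 {γ} {a} {γ′} {a′} p q with ≡-dec _≟_ γ γ′
  ... | yes refl = inj₁ (hamming-refl γ)
  ... | no ne = inj₂ (different-glue⇒hamming-4 γ a γ′ a′ p q ne)

zeroOrFour? : ∀ (γ γ′ : Glue) → Dec (hamming γ γ′ ≡ 0 ⊎ hamming γ γ′ ≡ 4)
zeroOrFour? γ γ′ = (hamming γ γ′ ℕ.≟ 0) ⊎-dec (hamming γ γ′ ℕ.≟ 4)

-- Words at the maximal distance differ everywhere.
hamming-max : ∀ {n} (γ γ′ : Vec (Fin 4) n) → hamming γ γ′ ≡ n → ∀ i → lookup γ i ≢ lookup γ′ i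
hamming-max {suc n} (k ∷ γ) (k′ ∷ γ′) h i with k ≟ k′
... | yes _ = contradiction (subst (ℕ._≤ n) h (hamming-≤ γ γ′)) ℕₚ.1+n≰n
hamming-max {suc n} (k ∷ γ) (k′ ∷ γ′) h zero | no ne = ne
hamming-max {suc n} (k ∷ γ) (k′ ∷ γ′) h (suc i) | no ne = hamming-max γ γ′ (ℕₚ.suc-injective h) i


-- Normal form of the glue

-- Let (0, k, x, y, z) be the glue vector beginning with 0 and k. As k varies, each of x, y, z
-- runs through all labels, with value 0 at k = 0. Renaming the labels makes this vector
-- (0, k, k, k, k).
module FirstNormalisation (D : Code 20) (tet : Tetradic D) where

  open GlueDistances D tet

  rest : Fin 4 → Vec (Fin 4) 3
  rest k = proj₁ (fill 0F k)

  rest-zero : rest 0F ≡ 0F ∷ 0F ∷ 0F ∷ []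
  rest-zero = two-agreements⇒equal 0F 0F (rest 0F) (0F ∷ 0F ∷ 0F ∷ []) _ _ (proj₂ (proj₂ (fill 0F 0F))) zero-word

  -- The label in block i as a function of k
  φ : Fin 5 → Fin 4 → Fin 4
  φ zero k = k
  φ (suc i) k = lookup (k ∷ rest k) i

  φ-injective : ∀ i → Injective _≡_ _≡_ (φ i)
  φ-injective zero e = e
  φ-injective (suc i) {k} {l} e with k ≟ l
  ... | yes k≡l = k≡l
  ... | no k≢l = contradiction e (hamming-max (k ∷ rest k) (l ∷ rest l)
    (different-glue⇒hamming-4 (0F ∷ k ∷ rest k) _ (0F ∷ l ∷ rest l) _ (proj₂ (proj₂ (fill 0F k))) (proj₂ (proj₂ (fill 0F l)))
      (k≢l ∘ cong (λ γ → lookup γ 1F))) i)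

  φ-zero : ∀ i → φ i 0F ≡ 0F
  φ-zero zero = refl
  φ-zero (suc i) = trans (cong (λ γ → lookup (0F ∷ γ) i) rest-zero) (zeros i)
    where
    zeros : ∀ i → lookup (0F ∷ 0F ∷ 0F ∷ 0F ∷ []) i ≡ Fin.zero {3}
    zeros = from-yes (all? λ i → lookup (0F ∷ 0F ∷ 0F ∷ 0F ∷ []) i ≟ 0F)

  ψ : Fin 5 → Permutation′ 4
  ψ i = injective⇒permutation (φ i) (φ-injective i)

  open Relabelling Perm.id ψ φ-zero public using (relabelled; D≈relabelled; relabelled-tetradic)
  open Relabelling Perm.id ψ φ-zero using (relabelGlue; relabelSigns; relabelled-word)

  diagonal : ∀ k → ∃[ a ] word (0F ∷ k ∷ k ∷ k ∷ k ∷ []) a ∈ relabelled D tet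
  diagonal k = relabelSigns (proj₁ (proj₂ (fill 0F k))) ,
    subst (λ γ → word γ (relabelSigns (proj₁ (proj₂ (fill 0F k)))) ∈ relabelled D tet) glue≡
      (relabelled-word D tet (0F ∷ k ∷ rest k) (proj₁ (proj₂ (fill 0F k))) (proj₂ (proj₂ (fill 0F k))))
    where
    entry : ∀ i → ψ i ⟨$⟩ˡ lookup (0F ∷ k ∷ rest k) i ≡ lookup (0F ∷ k ∷ k ∷ k ∷ k ∷ []) i
    entry zero = inverseˡ (ψ zero) {0F}
    entry (suc i) = trans (inverseˡ (ψ (suc i)) {k}) (sym (constant i))
      where
      constant : ∀ i → lookup (k ∷ k ∷ k ∷ k ∷ []) i ≡ k
      constant i = lookup-replicate i k
    glue≡ : relabelGlue (0F ∷ k ∷ rest k) ≡ 0F ∷ k ∷ k ∷ k ∷ k ∷ []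
    glue≡ = trans (tabulate-cong entry) (tabulate∘lookup (0F ∷ k ∷ k ∷ k ∷ k ∷ []))

-- The code contains words with glue (0, k, k, k, k).
Diagonal : Code 20 → Set
Diagonal D = ∀ k → ∃[ a ] word (0F ∷ k ∷ k ∷ k ∷ k ∷ []) a ∈ D

-- The glue vectors beginning with k and 0 have a third entry depending bijectively on k.
-- Renaming the labels of the first block makes it equal to the first entry.
module SecondNormalisation (D : Code 20) (tet : Tetradic D) (diag : Diagonal D) where

  open GlueDistances D tet

  rest : Fin 4 → Vec (Fin 4) 3
  rest k = proj₁ (fill k 0F)

  -- The third entry of the glue vector beginning with k and 0
  third : Fin 4 → Fin 4
  third k = lookup (rest k) 0F

  third-injective : Injective _≡_ _≡_ third
  third-injective {k} {l} e with k ≟ l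
  ... | yes k≡l = k≡l
  ... | no k≢l = contradiction e (hamming-max (k ∷ rest k) (l ∷ rest l)
    (different-glue⇒hamming-4 (k ∷ 0F ∷ rest k) _ (l ∷ 0F ∷ rest l) _ (proj₂ (proj₂ (fill k 0F))) (proj₂ (proj₂ (fill l 0F)))
      (k≢l ∘ cong (λ γ → lookup γ 0F))) 1F)

  third-zero : third 0F ≡ 0F
  third-zero = cong (λ γ → lookup γ 0F)
    (two-agreements⇒equal 0F 0F (rest 0F) (0F ∷ 0F ∷ 0F ∷ []) _ _ (proj₂ (proj₂ (fill 0F 0F))) zero-word)

  π : Permutation′ 4
  π = injective⇒permutation third third-injective

  ψ : Fin 5 → Permutation′ 4
  ψ zero = flip π
  ψ (suc _) = Perm.id

  ψ-zero : ∀ i → ψ i ⟨$⟩ʳ 0F ≡ 0F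
  ψ-zero zero = trans (cong (π ⟨$⟩ˡ_) (sym third-zero)) (inverseˡ π {0F})
  ψ-zero (suc _) = refl

  open Relabelling Perm.id ψ ψ-zero public using (relabelled; D≈relabelled; relabelled-tetradic)
  open Relabelling Perm.id ψ ψ-zero using (relabelGlue; relabelSigns; relabelled-word)

  diagonal : Diagonal (relabelled D tet)
  diagonal k = relabelSigns (proj₁ (diag k)) ,
    subst (λ x → word (x ∷ k ∷ k ∷ k ∷ k ∷ []) (relabelSigns (proj₁ (diag k))) ∈ relabelled D tet) third-zero
      (relabelled-word D tet (0F ∷ k ∷ k ∷ k ∷ k ∷ []) (proj₁ (diag k)) (proj₂ (diag k)))

  Second : Fin 4 → Set
  Second k = Σ[ x ∈ Fin 4 ] Σ[ y ∈ Fin 4 ] Σ[ a ∈ Word 5 ] word (k ∷ 0F ∷ k ∷ x ∷ y ∷ []) a ∈ relabelled D tet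

  second : ∀ k → Second k
  second k = subst Second (inverseʳ π {k}) (from (π ⟨$⟩ˡ k))
    where
    shape : ∀ (l : Fin 4) (γ : Vec (Fin 4) 3) a → word (l ∷ 0F ∷ γ) a ∈ relabelled D tet → l ≡ lookup γ 0F → Second l
    shape l (.l ∷ x ∷ y ∷ []) a p refl = x , y , a , p
    from : ∀ l → Second (third l)
    from l = shape (third l) (rest l) (relabelSigns (proj₁ (proj₂ (fill l 0F))))
      (subst (λ γ → word (third l ∷ 0F ∷ γ) (relabelSigns (proj₁ (proj₂ (fill l 0F)))) ∈ relabelled D tet)
        (tabulate∘lookup (rest l))
        (relabelled-word D tet (l ∷ 0F ∷ rest l) (proj₁ (proj₂ (fill l 0F))) (proj₂ (proj₂ (fill l 0F))))) refl

-- The code contains words with second label 0 and glue in the shortened hexacode.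
Triangle : Code 20 → Set
Triangle D = ∀ k → ∃[ a ] word (row k 0F) a ∈ D

-- The glue vectors (k, 0, k, x, y) are (k, 0, k, ωk, ω²k) for all k or (k, 0, k, ω²k, ωk) for
-- all k. In the second case the last two blocks are exchanged.
module ThirdNormalisation (D : Code 20) (tet : Tetradic D) (diag : Diagonal D)
  (second : ∀ k → Σ[ x ∈ Fin 4 ] Σ[ y ∈ Fin 4 ] Σ[ a ∈ Word 5 ] word (k ∷ 0F ∷ k ∷ x ∷ y ∷ []) a ∈ D) where

  open GlueDistances D tet

  compatible? : ∀ k x y → Dec (∀ l → hamming (k ∷ 0F ∷ k ∷ x ∷ y ∷ []) (0F ∷ l ∷ l ∷ l ∷ l ∷ []) ≡ 0
                                   ⊎ hamming (k ∷ 0F ∷ k ∷ x ∷ y ∷ []) (0F ∷ l ∷ l ∷ l ∷ l ∷ []) ≡ 4)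
  compatible? k x y = all? λ l → zeroOrFour? (k ∷ 0F ∷ k ∷ x ∷ y ∷ []) (0F ∷ l ∷ l ∷ l ∷ l ∷ [])

  -- By comparison with the vectors (0, l, l, l, l)
  dichotomy : ∀ k x y → (∀ l → hamming (k ∷ 0F ∷ k ∷ x ∷ y ∷ []) (0F ∷ l ∷ l ∷ l ∷ l ∷ []) ≡ 0
                             ⊎ hamming (k ∷ 0F ∷ k ∷ x ∷ y ∷ []) (0F ∷ l ∷ l ∷ l ∷ l ∷ []) ≡ 4) →
              (x ≡ ω k × y ≡ ω (ω k)) ⊎ (x ≡ ω (ω k) × y ≡ ω k)
  dichotomy = from-yes (all? λ k → all? λ x → all? λ y → compatible? k x y →-dec
    (((x ≟ ω k) ×-dec (y ≟ ω (ω k))) ⊎-dec ((x ≟ ω (ω k)) ×-dec (y ≟ ω k))))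

  Aligned Crossed : Fin 4 → Set
  Aligned k = ∃[ a ] word (k ∷ 0F ∷ k ∷ ω k ∷ ω (ω k) ∷ []) a ∈ D
  Crossed k = ∃[ a ] word (k ∷ 0F ∷ k ∷ ω (ω k) ∷ ω k ∷ []) a ∈ D

  alternative : ∀ k → Aligned k ⊎ Crossed k
  alternative k = split (proj₁ (second k)) (proj₁ (proj₂ (second k))) (proj₂ (proj₂ (second k)))
    where
    classify : ∀ {x y} → (x ≡ ω k × y ≡ ω (ω k)) ⊎ (x ≡ ω (ω k) × y ≡ ω k) →
               ∃[ a ] word (k ∷ 0F ∷ k ∷ x ∷ y ∷ []) a ∈ D → Aligned k ⊎ Crossed k
    classify (inj₁ (refl , refl)) p = inj₁ p
    classify (inj₂ (refl , refl)) p = inj₂ p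
    split : ∀ x y → ∃[ a ] word (k ∷ 0F ∷ k ∷ x ∷ y ∷ []) a ∈ D → Aligned k ⊎ Crossed k
    split x y (a , p) = classify (dichotomy k x y λ l → hamming-0-or-4 p (proj₂ (diag l))) (a , p)

  not-mixed : ∀ k l → k ≢ 0F → l ≢ 0F → Aligned k → Crossed l → k ≡ l
  not-mixed k l k≢0 l≢0 (_ , p) (_ , q) = table k l k≢0 l≢0 (hamming-0-or-4 p q)
    where
    table : ∀ k l → k ≢ 0F → l ≢ 0F →
      hamming (k ∷ 0F ∷ k ∷ ω k ∷ ω (ω k) ∷ []) (l ∷ 0F ∷ l ∷ ω (ω l) ∷ ω l ∷ []) ≡ 0 ⊎
      hamming (k ∷ 0F ∷ k ∷ ω k ∷ ω (ω k) ∷ []) (l ∷ 0F ∷ l ∷ ω (ω l) ∷ ω l ∷ []) ≡ 4 → k ≡ l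
    table = from-yes (all? λ k → all? λ l → ¬? (k ≟ 0F) →-dec (¬? (l ≟ 0F) →-dec
      (zeroOrFour? (k ∷ 0F ∷ k ∷ ω k ∷ ω (ω k) ∷ []) (l ∷ 0F ∷ l ∷ ω (ω l) ∷ ω l ∷ []) →-dec (k ≟ l))))

  zero-aligned : Aligned 0F
  zero-aligned = 𝟎 , zero-word

  zero-crossed : Crossed 0F
  zero-crossed = 𝟎 , zero-word

  uniform : (∀ k → Aligned k) ⊎ (∀ k → Crossed k)
  uniform = decide (alternative 1F) (alternative 2F) (alternative 3F)
    where
    decide : Aligned 1F ⊎ Crossed 1F → Aligned 2F ⊎ Crossed 2F → Aligned 3F ⊎ Crossed 3F →
             (∀ k → Aligned k) ⊎ (∀ k → Crossed k)
    decide (inj₁ p₁) (inj₁ p₂) (inj₁ p₃) = inj₁ λ { 0F → zero-aligned ; 1F → p₁ ; 2F → p₂ ; 3F → p₃ }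
    decide (inj₂ p₁) (inj₂ p₂) (inj₂ p₃) = inj₂ λ { 0F → zero-crossed ; 1F → p₁ ; 2F → p₂ ; 3F → p₃ }
    decide (inj₁ p) (inj₂ q) _ = contradiction (not-mixed 1F 2F (λ ()) (λ ()) p q) λ ()
    decide (inj₂ q) (inj₁ p) _ = contradiction (not-mixed 2F 1F (λ ()) (λ ()) p q) λ ()
    decide (inj₁ p) (inj₁ _) (inj₂ q) = contradiction (not-mixed 1F 3F (λ ()) (λ ()) p q) λ ()
    decide (inj₂ q) (inj₂ _) (inj₁ p) = contradiction (not-mixed 3F 1F (λ ()) (λ ()) p q) λ ()

  Normalised : Set
  Normalised = Σ[ D′ ∈ Code 20 ] D ≈ D′ × Tetradic D′ × Diagonal D′ × Triangle D′

  triangle : (∀ k → Aligned k) → Triangle D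
  triangle al k = subst (λ γ → ∃[ a ] word γ a ∈ D) (table k) (al k)
    where
    table : ∀ k → k ∷ 0F ∷ k ∷ ω k ∷ ω (ω k) ∷ [] ≡ row k 0F
    table = from-yes (all? λ k → ≡-dec _≟_ (k ∷ 0F ∷ k ∷ ω k ∷ ω (ω k) ∷ []) (row k 0F))

  swapped : (∀ k → Crossed k) → Normalised
  swapped cr = relabelled D tet , D≈relabelled D tet , relabelled-tetradic D tet ,
    (λ k → relabelSigns (proj₁ (diag k)) , relabelled-word D tet (0F ∷ k ∷ k ∷ k ∷ k ∷ []) (proj₁ (diag k)) (proj₂ (diag k))) ,
    (λ k → relabelSigns (proj₁ (cr k)) , subst (λ γ → word γ (relabelSigns (proj₁ (cr k))) ∈ relabelled D tet) (table k)
       (relabelled-word D tet (k ∷ 0F ∷ k ∷ ω (ω k) ∷ ω k ∷ []) (proj₁ (cr k)) (proj₂ (cr k))))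
    where
    open Relabelling (transpose 3F 4F) (λ _ → Perm.id) (λ _ → refl)
    table : ∀ k → relabelGlue (k ∷ 0F ∷ k ∷ ω (ω k) ∷ ω k ∷ []) ≡ row k 0F
    table = from-yes (all? λ k → ≡-dec _≟_ (relabelGlue (k ∷ 0F ∷ k ∷ ω (ω k) ∷ ω k ∷ [])) (row k 0F))

  normalised : Normalised
  normalised = finish uniform
    where
    finish : (∀ k → Aligned k) ⊎ (∀ k → Crossed k) → Normalised
    finish (inj₁ al) = D , ≈-refl D , tet , diag , triangle al
    finish (inj₂ cr) = swapped cr

-- The words found so far determine the glue: the only vectors at distance 0 or 4 from all
-- of them are those of the shortened hexacode.
module Standard (D : Code 20) (tet : Tetradic D) (diag : Diagonal D) (tri : Triangle D) where

  open GlueDistances D tet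

  glue∈hexacode : ∀ γ a → word γ a ∈ D → γ ≡ row (lookup γ 0F) (lookup γ 1F)
  glue∈hexacode (k ∷ l ∷ x ∷ y ∷ z ∷ []) a p = table k l x y z
    (λ m → hamming-0-or-4 p (proj₂ (diag m))) (λ m → hamming-0-or-4 p (proj₂ (tri m)))
    where
    table : ∀ k l x y z →
      (∀ m → hamming (k ∷ l ∷ x ∷ y ∷ z ∷ []) (0F ∷ m ∷ m ∷ m ∷ m ∷ []) ≡ 0 ⊎ hamming (k ∷ l ∷ x ∷ y ∷ z ∷ []) (0F ∷ m ∷ m ∷ m ∷ m ∷ []) ≡ 4) →
      (∀ m → hamming (k ∷ l ∷ x ∷ y ∷ z ∷ []) (row m 0F) ≡ 0 ⊎ hamming (k ∷ l ∷ x ∷ y ∷ z ∷ []) (row m 0F) ≡ 4) →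
      k ∷ l ∷ x ∷ y ∷ z ∷ [] ≡ row k l
    table = from-yes (all? λ k → all? λ l → all? λ x → all? λ y → all? λ z →
      (all? λ m → zeroOrFour? (k ∷ l ∷ x ∷ y ∷ z ∷ []) (0F ∷ m ∷ m ∷ m ∷ m ∷ [])) →-dec
      ((all? λ m → zeroOrFour? (k ∷ l ∷ x ∷ y ∷ z ∷ []) (row m 0F)) →-dec
      ≡-dec _≟_ (k ∷ l ∷ x ∷ y ∷ z ∷ []) (row k l)))

  -- By same-glue⇒same-parity this does not depend on the chosen codeword.
  f : Fin 4 → Fin 4 → 𝔽₂
  f k l = parity (proj₁ (proj₂ (fill k l)))

  row∈ : ∀ k l → word (row k l) (proj₁ (proj₂ (fill k l))) ∈ D
  row∈ k l = subst (λ γ → word γ (proj₁ (proj₂ (fill k l))) ∈ D)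
    (glue∈hexacode (k ∷ l ∷ proj₁ (fill k l)) (proj₁ (proj₂ (fill k l))) (proj₂ (proj₂ (fill k l)))) (proj₂ (proj₂ (fill k l)))

  D≗codeOf : ∀ w → D w ≡ codeOf f w
  D≗codeOf w = T-≡ forth (λ w∈ → back (codeOf-∈ w∈))
    where
    back : ∀ {w} → Codeword f w → w ∈ D
    back (mk k l a h) = resign (row k l) (proj₁ (proj₂ (fill k l))) a h (row∈ k l)
    forth : w ∈ D → w ∈ codeOf f
    forth w∈ = subst (_∈ codeOf f) (trans (cong (λ γ → word γ (signOf w)) (sym γ≡)) (word-glueOf-signOf w (block-even tet w w∈)))
      (∈-codeOf {f} (mk (label₀ w) (label₁ w) (signOf w)
        (same-glue⇒same-parity (row (label₀ w) (label₁ w)) (signOf w) _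
          (subst (λ γ → word γ (signOf w) ∈ D) γ≡ (as-word w∈)) (row∈ (label₀ w) (label₁ w)))))
      where
      γ≡ : glueOf w ≡ row (label₀ w) (label₁ w)
      γ≡ = glue∈hexacode (glueOf w) (signOf w) (as-word w∈)


-- The codes codeOf f have the required parameters, and there are no others

-- Replacing the second code by a pointwise equal one
≈-cong : ∀ {n} {C D E : Code n} → C ≈ D → (∀ w → D w ≡ E w) → C ≈ E
≈-cong (iso σ a h) e = iso σ a λ w → trans (h w) (e (isometry σ a w))

-- All good codes arise: the chain of normalisations
good⇒codeOf : ∀ D → GoodCode 256 D → ∃[ f ] D ≈ codeOf f
good⇒codeOf D good = step₁ (normalise refl 0F D good)
  where
  Goal : Code 20 → Set
  Goal D = ∃[ f ] D ≈ codeOf f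
  along : ∀ {C D} → C ≈ D → Goal D → Goal C
  along e (f , e′) = f , ≈-trans e e′
  step₄ : ∀ D (tet : Tetradic D) → Diagonal D → Triangle D → Goal D
  step₄ D tet diag tri = Standard.f D tet diag tri ,
    ≈-cong (≈-refl D) (Standard.D≗codeOf D tet diag tri)
  step₃ : ∀ D (tet : Tetradic D) → Diagonal D →
    (∀ k → Σ[ x ∈ Fin 4 ] Σ[ y ∈ Fin 4 ] Σ[ a ∈ Word 5 ] word (k ∷ 0F ∷ k ∷ x ∷ y ∷ []) a ∈ D) → Goal D
  step₃ D tet diag second = continue (ThirdNormalisation.normalised D tet diag second)
    where
    continue : Σ[ D′ ∈ Code 20 ] D ≈ D′ × Tetradic D′ × Diagonal D′ × Triangle D′ → Goal D
    continue (D′ , e , tet′ , diag′ , tri′) = along e (step₄ D′ tet′ diag′ tri′)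
  step₂ : ∀ D → Tetradic D → Diagonal D → Goal D
  step₂ D tet diag = along (S.D≈relabelled D tet)
    (step₃ (S.relabelled D tet) (S.relabelled-tetradic D tet) S.diagonal S.second)
    where module S = SecondNormalisation D tet diag
  step₁ : ∃[ D′ ] D ≈ D′ × Tetradic D′ → Goal D
  step₁ (D′ , e , tet) = along e (along (F.D≈relabelled D′ tet)
      (step₂ (F.relabelled D′ tet) (F.relabelled-tetradic D′ tet) F.diagonal))
    where module F = FirstNormalisation D′ tet

hamming-row : ∀ k l k′ l′ → (k ≡ k′ × l ≡ l′) ⊎ hamming (row k l) (row k′ l′) ≡ 4
hamming-row = from-yes (all? λ k → all? λ l → all? λ k′ → all? λ l′ →
  ((k ≟ k′) ×-dec (l ≟ l′)) ⊎-dec (hamming (row k l) (row k′ l′) ℕ.≟ 4))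

glueDist-same-glue : ∀ {n} (γ : Vec (Fin 4) n) a a′ → glueDist γ a γ a′ ≡ 4 ℕ.* wt (a ⊞ a′)
glueDist-same-glue [] [] [] = refl
glueDist-same-glue (k ∷ γ) (x ∷ a) (x′ ∷ a′) = trans (cong₂ ℕ._+_ (table k x x′) (glueDist-same-glue γ a a′))
  (trans (sym (ℕₚ.*-distribˡ-+ 4 (toℕ (x ⊕ x′)) (wt (a ⊞ a′)))) (cong (4 ℕ.*_) (sym (wt-∷ (x ⊕ x′) (a ⊞ a′)))))
  where
  table : ∀ k x x′ → quadDist k x k x′ ≡ 4 ℕ.* toℕ (x ⊕ x′)
  table = from-yes (all? λ k → all? λ x → all? λ x′ → quadDist k x k x′ ℕ.≟ 4 ℕ.* toℕ (x ⊕ x′))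
  wt-∷ : ∀ {n} b (w : Word n) → wt (b ∷ w) ≡ toℕ b ℕ.+ wt w
  wt-∷ 0F w = refl
  wt-∷ 1F w = refl

glueDist-hamming : ∀ {n} (γ γ′ : Vec (Fin 4) n) a a′ → ∃[ q ] glueDist γ a γ′ a′ ≡ 2 ℕ.* hamming γ γ′ ℕ.+ q ℕ.* 4
glueDist-hamming [] [] [] [] = 0 , refl
glueDist-hamming (k ∷ γ) (k′ ∷ γ′) (x ∷ a) (x′ ∷ a′) = combined (glueDist-hamming γ γ′ a a′)
  where
  extra : Fin 4 → 𝔽₂ → Fin 4 → 𝔽₂ → ℕ
  extra k x k′ x′ = if does (k ≟ k′) then toℕ (x ⊕ x′) else 0
  table : ∀ k x k′ x′ → quadDist k x k′ x′ ≡ 2 ℕ.* differ k k′ ℕ.+ extra k x k′ x′ ℕ.* 4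
  table = from-yes (all? λ k → all? λ x → all? λ k′ → all? λ x′ → quadDist k x k′ x′ ℕ.≟ 2 ℕ.* differ k k′ ℕ.+ extra k x k′ x′ ℕ.* 4)
  collect : ∀ d e h q → 2 ℕ.* d ℕ.+ e ℕ.* 4 ℕ.+ (2 ℕ.* h ℕ.+ q ℕ.* 4) ≡ 2 ℕ.* (d ℕ.+ h) ℕ.+ (e ℕ.+ q) ℕ.* 4
  collect = solveℕ-∀
  combined : ∃[ q ] glueDist γ a γ′ a′ ≡ 2 ℕ.* hamming γ γ′ ℕ.+ q ℕ.* 4 →
             ∃[ q ] glueDist (k ∷ γ) (x ∷ a) (k′ ∷ γ′) (x′ ∷ a′) ≡ 2 ℕ.* hamming (k ∷ γ) (k′ ∷ γ′) ℕ.+ q ℕ.* 4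
  combined (q , e) = extra k x k′ x′ ℕ.+ q ,
    trans (cong₂ ℕ._+_ (table k x k′ x′) e) (collect (differ k k′) (extra k x k′ x′) (hamming γ γ′) q)

-- A natural number modulo two
bit : ℕ → 𝔽₂
bit zero = 0F
bit (suc n) = 1F ⊕ bit n

parity-wt : ∀ {n} (w : Word n) → parity w ≡ bit (wt w)
parity-wt [] = refl
parity-wt (0F ∷ w) = parity-wt w
parity-wt (1F ∷ w) = cong (1F ⊕_) (parity-wt w)

bit-even : ∀ n → bit n ≡ 0F → ∃[ q ] n ≡ 2 ℕ.* q
bit-even zero _ = 0 , refl
bit-even (suc zero) ()
bit-even (suc (suc n)) h with q , e ← bit-even n (trans (⊕-assoc 1F 1F (bit n)) h) =
  suc q , trans (cong (2 ℕ.+_) e) (sym (ℕₚ.*-distribˡ-+ 2 1 q))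

-- Two codewords with the same glue differ in an even number of blocks; two codewords with
-- different glue have distance 8 or 12.
codeword-distance : ∀ {f u v} → Codeword f u → Codeword f v → u ≡ v ⊎ ∃[ q ] dH u v ≡ 8 ℕ.+ q ℕ.* 4
codeword-distance {f} (mk k l a h) (mk k′ l′ a′ h′) with hamming-row k l k′ l′
... | inj₂ h4 = inj₂ (far (glueDist-hamming (row k l) (row k′ l′) a a′))
  where
  far : ∃[ q ] glueDist (row k l) a (row k′ l′) a′ ≡ 2 ℕ.* hamming (row k l) (row k′ l′) ℕ.+ q ℕ.* 4 →
        ∃[ q ] dH (word (row k l) a) (word (row k′ l′) a′) ≡ 8 ℕ.+ q ℕ.* 4
  far (q , e) = q , trans (dH-word (row k l) a (row k′ l′) a′) (trans e (cong (λ h → 2 ℕ.* h ℕ.+ q ℕ.* 4) h4))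
... | inj₁ (refl , refl) = near (bit-even (wt (a ⊞ a′)) (trans (sym (parity-wt (a ⊞ a′)))
    (trans (parity-⊞ a a′) (trans (cong₂ _⊕_ h h′) (⊕-self (f k l))))))
  where
  wt-zero : ∀ {n} (x y : Word n) → wt (x ⊞ y) ≡ 0 → x ≡ y
  wt-zero [] [] _ = refl
  wt-zero (0F ∷ x) (0F ∷ y) e = cong (0F ∷_) (wt-zero x y e)
  wt-zero (1F ∷ x) (1F ∷ y) e = cong (1F ∷_) (wt-zero x y e)
  wt-zero (0F ∷ x) (1F ∷ y) ()
  wt-zero (1F ∷ x) (0F ∷ y) ()
  dist : ∀ q → wt (a ⊞ a′) ≡ 2 ℕ.* q → dH (word (row k l) a) (word (row k l) a′) ≡ q ℕ.* 8
  dist q e = trans (dH-word (row k l) a (row k l) a′) (trans (glueDist-same-glue (row k l) a a′) (trans (cong (4 ℕ.*_) e) (eight q)))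
    where
    eight : ∀ q → 4 ℕ.* (2 ℕ.* q) ≡ q ℕ.* 8
    eight = solveℕ-∀
  near : ∃[ q ] wt (a ⊞ a′) ≡ 2 ℕ.* q →
         word (row k l) a ≡ word (row k l) a′ ⊎ ∃[ q ] dH (word (row k l) a) (word (row k l) a′) ≡ 8 ℕ.+ q ℕ.* 4
  near (zero , e) = inj₁ (cong (word (row k l)) (wt-zero a a′ e))
  near (suc q , e) = inj₂ (q ℕ.* 2 , trans (dist (suc q) e) (cong (8 ℕ.+_) (sym (ℕₚ.*-assoc q 2 4))))

opaque
  unfolding pack

  pack-surjective : ∀ p → Σ[ k ∈ Fin 4 ] Σ[ l ∈ Fin 4 ] Σ[ a ∈ 𝔽₂ ] Σ[ b ∈ 𝔽₂ ] Σ[ c ∈ 𝔽₂ ] Σ[ d ∈ 𝔽₂ ] pack k l a b c d ≡ p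
  pack-surjective p
    with k , p₁ , refl ← Finₚ.combine-surjective {4} {64} p
    with l , p₂ , refl ← Finₚ.combine-surjective {4} {16} p₁
    with a , p₃ , refl ← Finₚ.combine-surjective {2} {8} p₂
    with b , p₄ , refl ← Finₚ.combine-surjective {2} {4} p₃
    with c , d , refl ← Finₚ.combine-surjective {2} {2} p₄ = k , l , a , b , c , d , refl

codeOf-size : ∀ f → HasSize (codeOf f) 256
codeOf-size f = mk↔ₛ′ (λ p → encode (pack-surjective p)) (λ (w , _) → info w) to-from from-to
  where
  info : Word 20 → Fin 256
  info w = pack (label₀ w) (label₁ w) (lookup (signOf w) 0F) (lookup (signOf w) 1F) (lookup (signOf w) 2F) (lookup (signOf w) 3F)
  Preimage : Fin 256 → Set
  Preimage p = Σ[ k ∈ Fin 4 ] Σ[ l ∈ Fin 4 ] Σ[ a ∈ 𝔽₂ ] Σ[ b ∈ 𝔽₂ ] Σ[ c ∈ 𝔽₂ ] Σ[ d ∈ 𝔽₂ ] pack k l a b c d ≡ p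
  signs : 𝔽₂ → 𝔽₂ → 𝔽₂ → 𝔽₂ → 𝔽₂ → Word 5
  signs a b c d x = a ∷ b ∷ c ∷ d ∷ (a ⊕ b ⊕ c ⊕ d ⊕ x) ∷ []
  parity-signs : ∀ a b c d x → parity (signs a b c d x) ≡ x
  parity-signs = from-yes (all? λ a → all? λ b → all? λ c → all? λ d → all? λ x → parity (signs a b c d x) ≟ x)
  signs-parity : ∀ a b c d e x → parity (a ∷ b ∷ c ∷ d ∷ e ∷ []) ≡ x → signs a b c d x ≡ a ∷ b ∷ c ∷ d ∷ e ∷ []
  signs-parity a b c d e _ refl = table a b c d e
    where
    table : ∀ a b c d e → signs a b c d (parity (a ∷ b ∷ c ∷ d ∷ e ∷ [])) ≡ a ∷ b ∷ c ∷ d ∷ e ∷ []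
    table = from-yes (all? λ a → all? λ b → all? λ c → all? λ d → all? λ e →
      signs a b c d (parity (a ∷ b ∷ c ∷ d ∷ e ∷ [])) ≟ʷ (a ∷ b ∷ c ∷ d ∷ e ∷ []))
  encode : ∀ {p} → Preimage p → ∃[ w ] w ∈ codeOf f
  encode (k , l , a , b , c , d , _) = word (row k l) (signs a b c d (f k l)) ,
    ∈-codeOf (mk k l (signs a b c d (f k l)) (parity-signs a b c d (f k l)))
  info-word : ∀ k l s → info (word (row k l) s) ≡ pack k l (lookup s 0F) (lookup s 1F) (lookup s 2F) (lookup s 3F)
  info-word k l s = cong₂ (λ γ s → pack (lookup γ 0F) (lookup γ 1F) (lookup s 0F) (lookup s 1F) (lookup s 2F) (lookup s 3F))
    (glueOf-word (row k l) s) (signOf-word (row k l) s)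
  from-to : ∀ p → info (proj₁ (encode (pack-surjective p))) ≡ p
  from-to p = go (pack-surjective p)
    where
    go : (q : Preimage p) → info (proj₁ (encode q)) ≡ p
    go (k , l , a , b , c , d , e) = trans (info-word k l (signs a b c d (f k l))) e
  to-from : ∀ q → encode (pack-surjective (info (proj₁ q))) ≡ q
  to-from (w , w∈) = member-≡ {C = codeOf f} (go (codeOf-∈ w∈) (pack-surjective (info w)))
    where
    go : ∀ {w} → Codeword f w → (q : Preimage (info w)) → proj₁ (encode q) ≡ w
    go (mk k l s@(a ∷ b ∷ c ∷ d ∷ x ∷ []) h) (k′ , l′ , a′ , b′ , c′ , d′ , e) = finish (pack-injective (trans e (info-word k l s)))
      where
      finish : k′ ≡ k × l′ ≡ l × a′ ≡ a × b′ ≡ b × c′ ≡ c × d′ ≡ d → word (row k′ l′) (signs a′ b′ c′ d′ (f k′ l′)) ≡ word (row k l) s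
      finish (refl , refl , refl , refl , refl , refl) = cong (word (row k l)) (signs-parity a b c d x (f k l) h)

codeOf-good : ∀ f → GoodCode 256 (codeOf f)
codeOf-good f =
  (λ u v u∈ v∈ u≢v → min {u} {v} u≢v (codeword-distance (codeOf-∈ u∈) (codeOf-∈ v∈))) ,
  codeOf-size f ,
  (λ u v u∈ v∈ → div {u} {v} (codeword-distance (codeOf-∈ u∈) (codeOf-∈ v∈)))
  where
  min : ∀ {u v} → u ≢ v → u ≡ v ⊎ ∃[ q ] dH u v ≡ 8 ℕ.+ q ℕ.* 4 → 8 ℕ.≤ dH u v
  min u≢v (inj₁ e) = contradiction e u≢v
  min _ (inj₂ (q , e)) = subst (8 ℕ.≤_) (sym e) (ℕₚ.m≤m+n 8 (q ℕ.* 4))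
  div : ∀ {u v} → u ≡ v ⊎ ∃[ q ] dH u v ≡ 8 ℕ.+ q ℕ.* 4 → 4 ∣ dH u v
  div {u} (inj₁ refl) = subst (4 ∣_) (sym (trans (dH≡wt u u) (trans (cong wt (⊞-self u)) (wt-𝟎 20)))) (divides 0 refl)
  div (inj₂ (q , e)) = divides (2 ℕ.+ q) e

-- An isometry mapping one code into another one of the same finite size maps it onto that code.
inclusion⇒≈ : ∀ {n m} {C D : Code n} → HasSize C m → HasSize D m → ∀ σ a →
              (∀ w → w ∈ C → isometry σ a w ∈ D) → C ≈ D
inclusion⇒≈ {n} {m} {C} {D} sizeC sizeD σ a incl = iso σ a λ w → T-≡ (incl w) (back w)
  where
  Φ : Word n → Word n
  Φ = isometry σ a
  Φ-injective : ∀ {u v} → Φ u ≡ Φ v → u ≡ v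
  Φ-injective {u} {v} e = trans (sym (isometry-inverse′ σ a u)) (trans (cong (isometry (flip σ) (inverseWord σ a)) e) (isometry-inverse′ σ a v))
  cw : Fin m → ∃[ w ] w ∈ C
  cw = Inverse.to sizeC
  from-injective : ∀ {p q} → Inverse.from sizeD p ≡ Inverse.from sizeD q → proj₁ p ≡ proj₁ q
  from-injective {p} {q} e = cong proj₁ (trans (sym (Inverse.strictlyInverseˡ sizeD p))
    (trans (cong (Inverse.to sizeD) e) (Inverse.strictlyInverseˡ sizeD q)))
  map : Fin m → Fin m
  map i = Inverse.from sizeD (Φ (proj₁ (cw i)) , incl _ (proj₂ (cw i)))
  map-injective : Injective _≡_ _≡_ map
  map-injective {i} {j} e = trans (sym (Inverse.strictlyInverseʳ sizeC i))
    (trans (cong (Inverse.from sizeC) (member-≡ {C = C} (Φ-injective (from-injective e)))) (Inverse.strictlyInverseʳ sizeC j))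
  back : ∀ w → Φ w ∈ D → w ∈ C
  back w p = found (injective⇒hit map-injective (Inverse.from sizeD (Φ w , p)))
    where
    found : ∃[ i ] map i ≡ Inverse.from sizeD (Φ w , p) → w ∈ C
    found (i , e) = subst (_∈ C) (Φ-injective (from-injective e)) (proj₂ (cw i))


-- Equivalences between the codes codeOf f

-- Functions on the shortened hexacode, given in terms of the first two labels
Fun : Set
Fun = Fin 4 → Fin 4 → 𝔽₂

-- Since both codes have 256 words, it suffices that the isometry maps one into the other.
codeOf-≈ : ∀ {f g} σ a → (∀ k l s → parity s ≡ f k l → Codeword g (isometry σ a (word (row k l) s))) → codeOf f ≈ codeOf g
codeOf-≈ {f} {g} σ a h = inclusion⇒≈ (codeOf-size f) (codeOf-size g) σ a
  λ w w∈ → ∈-codeOf (image∈ (codeOf-∈ w∈))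
  where
  image∈ : ∀ {w} → Codeword f w → Codeword g (isometry σ a w)
  image∈ (mk k l s e) = h k l s e

codeOf-cong : ∀ {f g} → (∀ k l → f k l ≡ g k l) → codeOf f ≈ codeOf g
codeOf-cong {f} {g} h = ≈-cong (≈-refl (codeOf f)) λ w → T-≡
  (λ w∈ → ∈-codeOf (along h (codeOf-∈ w∈))) (λ w∈ → ∈-codeOf (along (λ k l → sym (h k l)) (codeOf-∈ w∈)))
  where
  along : ∀ {f g w} → (∀ k l → f k l ≡ g k l) → Codeword f w → Codeword g w
  along h (mk k l s e) = mk k l s (trans e (h k l))

infixl 6 _+ᵍ_
-- Addition of glue vectors
_+ᵍ_ : ∀ {n} → Vec (Fin 4) n → Vec (Fin 4) n → Vec (Fin 4) n
_+ᵍ_ = zipWith _+₄_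

word-+ : ∀ γ s γ′ s′ → word γ s ⊞ word γ′ s′ ≡ word (γ +ᵍ γ′) (s ⊞ s′)
word-+ γ s γ′ s′ = ≡-at λ i j → trans (at-⊞ (word γ s) (word γ′ s′) i j)
  (trans (cong₂ _⊕_ (at-word γ s i j) (at-word γ′ s′ i j))
  (trans (table (lookup s i) (lookup γ i) (lookup s′ i) (lookup γ′ i) j)
  (sym (trans (at-word (γ +ᵍ γ′) (s ⊞ s′) i j)
    (cong₂ (λ x k → x ⊕ β k j) (lookup-zipWith _⊕_ i s s′) (lookup-zipWith _+₄_ i γ γ′))))))
  where
  table : ∀ x k x′ k′ j → x ⊕ β k j ⊕ (x′ ⊕ β k′ j) ≡ x ⊕ x′ ⊕ β (k +₄ k′) j
  table = from-yes (all? λ x → all? λ k → all? λ x′ → all? λ k′ → all? λ j →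
    x ⊕ β k j ⊕ (x′ ⊕ β k′ j) ≟ x ⊕ x′ ⊕ β (k +₄ k′) j)

row-+ : ∀ k l k′ l′ → row k l +ᵍ row k′ l′ ≡ row (k +₄ k′) (l +₄ l′)
row-+ = from-yes (all? λ k → all? λ l → all? λ k′ → all? λ l′ → ≡-dec _≟_ (row k l +ᵍ row k′ l′) (row (k +₄ k′) (l +₄ l′)))

permute-id : ∀ {n} (w : Word n) → permuteCoordinates Perm.id w ≡ w
permute-id = tabulate∘lookup

-- Translation by a word with given glue
translate-≈ : ∀ k₀ l₀ f → codeOf (λ k l → f (k +₄ k₀) (l +₄ l₀)) ≈ codeOf f
translate-≈ k₀ l₀ f = codeOf-≈ Perm.id (word (row k₀ l₀) 𝟎) λ k l s e →
  subst (Codeword f) (sym (trans (cong (_⊞ word (row k₀ l₀) 𝟎) (permute-id (word (row k l) s)))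
    (trans (word-+ (row k l) s (row k₀ l₀) 𝟎)
      (cong₂ word (row-+ k l k₀ l₀) (trans (⊞-comm s 𝟎) (⊞-identityˡ s))))))
    (mk (k +₄ k₀) (l +₄ l₀) s e)

-- The affine functions over the field of two elements; β represents all linear forms.
affine : 𝔽₂ → Fin 4 → Fin 4 → Fun
affine c m₀ m₁ k l = c ⊕ β k m₀ ⊕ β l m₁

+₄-injective : ∀ m j j′ → j +₄ m ≡ j′ +₄ m → j ≡ j′
+₄-injective = from-yes (all? λ m → all? λ j → all? λ j′ → (j +₄ m ≟ j′ +₄ m) →-dec (j ≟ j′))

-- Adding m to the positions in a block keeps the label k and changes the sign by β k m.
-- Doing so in the first two blocks, and complementing the first block if c = 1, adds an
-- affine function to f.
affine-≈ : ∀ c m₀ m₁ f → codeOf f ≈ codeOf (λ k l → f k l ⊕ affine c m₀ m₁ k l)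
affine-≈ c m₀ m₁ f = codeOf-≈ σ offset λ k l s e →
  subst (Codeword _) (sym (≡-at (agree k l s))) (mk k l (signs k l s) (trans (parity-signs k l s) (cong (_⊕ affine c m₀ m₁ k l) e)))
  where
  shift : Fin 5 → Fin 4
  shift 0F = m₀
  shift 1F = m₁
  shift (suc (suc _)) = 0F
  place : Fin 20 → Fin 20
  place p = combine (quotient {5} 4 p) (remainder {5} 4 p +₄ shift (quotient 4 p))
  place-injective : Injective _≡_ _≡_ place
  place-injective {p} {q} e = remQuot-injective {p} {q} (proj₁ both) (inner (quotient 4 p) (quotient 4 q) (proj₁ both) (proj₂ both))
    where
    both : quotient {5} 4 p ≡ quotient 4 q × remainder {5} 4 p +₄ shift (quotient 4 p) ≡ remainder {5} 4 q +₄ shift (quotient 4 q)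
    both = Finₚ.combine-injective (quotient {5} 4 p) (remainder {5} 4 p +₄ shift (quotient 4 p))
             (quotient {5} 4 q) (remainder {5} 4 q +₄ shift (quotient 4 q)) e
    inner : ∀ i i′ {j j′} → i ≡ i′ → j +₄ shift i ≡ j′ +₄ shift i′ → j ≡ j′
    inner i .i refl h = +₄-injective (shift i) _ _ h
  σ : Permutation′ 20
  σ = injective⇒permutation place place-injective
  constants : Fin 5 → 𝔽₂
  constants 0F = c
  constants (suc _) = 0F
  offset : Word 20
  offset = fromBlocks (λ i _ → constants i)
  signs : Fin 4 → Fin 4 → Word 5 → Word 5
  signs k l (a₀ ∷ a₁ ∷ as) = (a₀ ⊕ β k m₀ ⊕ c) ∷ (a₁ ⊕ β l m₁) ∷ as
  parity-signs : ∀ k l s → parity (signs k l s) ≡ parity s ⊕ affine c m₀ m₁ k l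
  parity-signs k l (a₀ ∷ a₁ ∷ as) = table a₀ a₁ (parity as) (β k m₀) (β l m₁) c
    where
    table : ∀ a₀ a₁ p x y c → a₀ ⊕ x ⊕ c ⊕ (a₁ ⊕ y ⊕ p) ≡ a₀ ⊕ (a₁ ⊕ p) ⊕ (c ⊕ x ⊕ y)
    table = from-yes (all? λ a₀ → all? λ a₁ → all? λ p → all? λ x → all? λ y → all? λ c →
      a₀ ⊕ x ⊕ c ⊕ (a₁ ⊕ y ⊕ p) ≟ a₀ ⊕ (a₁ ⊕ p) ⊕ (c ⊕ x ⊕ y))
  lookup-signs : ∀ k l s i → lookup (signs k l s) i ≡ lookup s i ⊕ β (lookup (row k l) i) (shift i) ⊕ constants i
  lookup-signs k l (a₀ ∷ a₁ ∷ as) 0F = refl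
  lookup-signs k l (a₀ ∷ a₁ ∷ as) 1F = sym (⊕-zero (a₁ ⊕ β l m₁))
    where
    ⊕-zero : ∀ a → a ⊕ 0F ≡ a
    ⊕-zero a = ⊕-comm a 0F
  lookup-signs k l (a₀ ∷ a₁ ∷ as) (suc (suc i)) = table (lookup as i) (lookup (row k l) (suc (suc i)))
    where
    table : ∀ a m → a ≡ a ⊕ β m 0F ⊕ 0F
    table = from-yes (all? λ a → all? λ m → a ≟ a ⊕ β m 0F ⊕ 0F)
  agree : ∀ k l s i j → at (isometry σ offset (word (row k l) s)) i j ≡ at (word (row k l) (signs k l s)) i j
  agree k l s i j = trans (isometry-lookup σ offset (word (row k l) s) (combine i j))
    (trans (cong₂ _⊕_ (trans (cong (lookup (word (row k l) s)) (cong (λ p → combine (proj₁ p) (proj₂ p +₄ shift (proj₁ p))) (remQuot-combine {5} {4} i j)))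
                             (at-word (row k l) s i (j +₄ shift i)))
                      (at-fromBlocks (λ i _ → constants i) i j))
    (trans (table (lookup s i) (lookup (row k l) i) j (shift i) (constants i))
    (sym (trans (at-word (row k l) (signs k l s) i j) (cong (_⊕ β (lookup (row k l) i) j) (lookup-signs k l s i))))))
    where
    table : ∀ a m j t c → a ⊕ β m (j +₄ t) ⊕ c ≡ a ⊕ β m t ⊕ c ⊕ β m j
    table = from-yes (all? λ a → all? λ m → all? λ j → all? λ t → all? λ c → a ⊕ β m (j +₄ t) ⊕ c ≟ a ⊕ β m t ⊕ c ⊕ β m j)

module _ (ρ : Permutation′ 5) (ψ : Fin 5 → Permutation′ 4) (fix : ∀ i → ψ i ⟨$⟩ʳ 0F ≡ 0F) where

  open Relabelling ρ ψ fix using (σ; relabelGlue; relabelSigns; permute-word; isometry-σ)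

  -- Block permutations and renamings of labels that preserve the shortened hexacode
  automorphism-≈ : (α₀ α₁ : Fin 4 → Fin 4 → Fin 4) → (∀ k l → relabelGlue (row k l) ≡ row (α₀ k l) (α₁ k l)) →
                   ∀ f → codeOf (λ k l → f (α₀ k l) (α₁ k l)) ≈ codeOf f
  automorphism-≈ α₀ α₁ h f = codeOf-≈ σ 𝟎 λ k l s e → subst (Codeword f)
    (sym (trans (isometry-σ (word (row k l) s)) (trans (permute-word (row k l) s) (cong (λ γ → word γ (relabelSigns s)) (h k l)))))
    (mk (α₀ k l) (α₁ k l) (relabelSigns s) (trans (parity-permute s) e))
    where
    parity-permute : ∀ s → parity (permuteCoordinates ρ s) ≡ parity s
    parity-permute s = trans (parity-wt (permuteCoordinates ρ s)) (trans (cong bit (wt-permute ρ s)) (sym (parity-wt s)))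


-- Reduction to fifteen functions

-- The Frobenius automorphism of the field of four elements, or the identity
conjugate : Bool → Fin 4 → Fin 4
conjugate false k = k
conjugate true 0F = 0F
conjugate true 1F = 1F
conjugate true 2F = 3F
conjugate true 3F = 2F

-- Multiplication by a power of ω
ω^ : Fin 3 → Fin 4 → Fin 4
ω^ 0F k = k
ω^ 1F k = ω k
ω^ 2F k = ω (ω k)

-- The exponent of the inverse scalar
negate : Fin 3 → Fin 3
negate 0F = 0F
negate 1F = 2F
negate 2F = 1F

semilinear : Bool → Fin 3 → Fin 4 → Fin 4
semilinear c s k = ω^ s (conjugate c k)

semilinear⁻¹ : Bool → Fin 3 → Fin 4 → Fin 4
semilinear⁻¹ c s k = conjugate c (ω^ (negate s) k)

-- In Relabelling, labels are renamed by the inverse of the permutation of positions.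
labelPermutation : Bool → Fin 3 → Permutation′ 4
labelPermutation c s = permutation (semilinear⁻¹ c s) (semilinear c s) (left c s) (right c s)
  where
  left : ∀ c s k → semilinear⁻¹ c s (semilinear c s k) ≡ k
  left false = from-yes (all? λ s → all? λ k → semilinear⁻¹ false s (semilinear false s k) ≟ k)
  left true = from-yes (all? λ s → all? λ k → semilinear⁻¹ true s (semilinear true s k) ≟ k)
  right : ∀ c s k → semilinear c s (semilinear⁻¹ c s k) ≡ k
  right false = from-yes (all? λ s → all? λ k → semilinear false s (semilinear⁻¹ false s k) ≟ k)
  right true = from-yes (all? λ s → all? λ k → semilinear true s (semilinear⁻¹ true s k) ≟ k)

semilinear⁻¹-zero : ∀ c s → semilinear⁻¹ c s 0F ≡ 0F
semilinear⁻¹-zero false = from-yes (all? λ s → semilinear⁻¹ false s 0F ≟ 0F)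
semilinear⁻¹-zero true = from-yes (all? λ s → semilinear⁻¹ true s 0F ≟ 0F)

-- An affine semilinear map of the shortened hexacode: the blocks are permuted, the labels
-- are conjugated and scaled, and a vector is added.
record Move : Set where
  constructor move
  field
    k₀ l₀ : Fin 4
    conjugated : Bool
    blocks : Vec (Fin 5) 5
    scalars : Vec (Fin 3) 5

  -- The image of a glue vector before the translation
  moveRow : Fin 4 → Fin 4 → Glue
  moveRow k l = tabulate (λ i → semilinear conjugated (lookup scalars i) (lookup (row k l) (lookup blocks i)))

  move₀ move₁ : Fin 4 → Fin 4 → Fin 4
  move₀ k l = lookup (moveRow k l) 0F
  move₁ k l = lookup (moveRow k l) 1F

  pull : Fun → Fun
  pull f k l = f (move₀ k l +₄ k₀) (move₁ k l +₄ l₀)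

  -- The data define a permutation of the blocks that preserves the shortened hexacode.
  Valid : Set
  Valid = (∀ i j → lookup blocks i ≡ lookup blocks j → i ≡ j) × (∀ k l → moveRow k l ≡ row (move₀ k l) (move₁ k l))

  valid? : Dec Valid
  valid? = (all? λ i → all? λ j → (lookup blocks i ≟ lookup blocks j) →-dec (i ≟ j))
           ×-dec (all? λ k → all? λ l → ≡-dec _≟_ (moveRow k l) (row (move₀ k l) (move₁ k l)))

  pull-≈ : Valid → ∀ f → codeOf (pull f) ≈ codeOf f
  pull-≈ (inj , rows) f = ≈-trans
    (automorphism-≈ (injective⇒permutation (lookup blocks) (λ {i} {j} → inj i j))
      (λ i → labelPermutation conjugated (lookup scalars i)) (λ i → semilinear⁻¹-zero conjugated (lookup scalars i))
      move₀ move₁ rows g)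
    (translate-≈ k₀ l₀ f)
    where
    g : Fun
    g k l = f (k +₄ k₀) (l +₄ l₀)

-- Adding an affine function, values can be made 0 at (0,0), (0,1), (0,2), (1,0) and (2,0).
-- The remaining eleven values are the normal form modulo affine functions.
expand : Word 11 → Fun
expand (a ∷ b ∷ c ∷ d ∷ e ∷ f ∷ g ∷ h ∷ i ∷ j ∷ k ∷ []) x y = lookup (lookup
  ( (0F ∷ 0F ∷ 0F ∷ a ∷ []) ∷
    (0F ∷ b  ∷ c  ∷ d ∷ []) ∷
    (0F ∷ e  ∷ f  ∷ g ∷ []) ∷
    (h  ∷ i  ∷ j  ∷ k ∷ []) ∷ []) x) y

-- The affine function that agrees with g at these five points; label solves for the linear
-- form with given values at 1 and 2.
correction : Fun → Fun
correction g = affine (g 0F 0F) (label (g 1F 0F ⊕ g 0F 0F) (g 2F 0F ⊕ g 0F 0F)) (label (g 0F 1F ⊕ g 0F 0F) (g 0F 2F ⊕ g 0F 0F))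

-- The normal form of g
compress : Fun → Word 11
compress g = h 0F 3F ∷ h 1F 1F ∷ h 1F 2F ∷ h 1F 3F ∷ h 2F 1F ∷ h 2F 2F ∷ h 2F 3F ∷ h 3F 0F ∷ h 3F 1F ∷ h 3F 2F ∷ h 3F 3F ∷ []
  where
  h : Fun
  h k l = g k l ⊕ correction g k l

expand-compress : ∀ g k l → g k l ⊕ correction g k l ≡ expand (compress g) k l
expand-compress g = λ where
    0F 0F → table (g 0F 0F)
    0F 1F → table₁ (g 0F 0F) (g 0F 1F) (g 0F 2F)
    0F 2F → table₂ (g 0F 0F) (g 0F 1F) (g 0F 2F)
    0F 3F → refl
    1F 0F → table₃ (g 0F 0F) (g 1F 0F) (g 2F 0F)
    1F 1F → refl
    1F 2F → refl
    1F 3F → refl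
    2F 0F → table₄ (g 0F 0F) (g 1F 0F) (g 2F 0F)
    2F 1F → refl
    2F 2F → refl
    2F 3F → refl
    3F 0F → refl
    3F 1F → refl
    3F 2F → refl
    3F 3F → refl
  where
  table : ∀ x → x ⊕ (x ⊕ 0F ⊕ 0F) ≡ 0F
  table = from-yes (all? λ x → x ⊕ (x ⊕ 0F ⊕ 0F) ≟ 0F)
  table₁ : ∀ x y z → y ⊕ (x ⊕ 0F ⊕ β 1F (label (y ⊕ x) (z ⊕ x))) ≡ 0F
  table₁ = from-yes (all? λ x → all? λ y → all? λ z → y ⊕ (x ⊕ 0F ⊕ β 1F (label (y ⊕ x) (z ⊕ x))) ≟ 0F)
  table₂ : ∀ x y z → z ⊕ (x ⊕ 0F ⊕ β 2F (label (y ⊕ x) (z ⊕ x))) ≡ 0F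
  table₂ = from-yes (all? λ x → all? λ y → all? λ z → z ⊕ (x ⊕ 0F ⊕ β 2F (label (y ⊕ x) (z ⊕ x))) ≟ 0F)
  table₃ : ∀ x y z → y ⊕ (x ⊕ β 1F (label (y ⊕ x) (z ⊕ x)) ⊕ 0F) ≡ 0F
  table₃ = from-yes (all? λ x → all? λ y → all? λ z → y ⊕ (x ⊕ β 1F (label (y ⊕ x) (z ⊕ x)) ⊕ 0F) ≟ 0F)
  table₄ : ∀ x y z → z ⊕ (x ⊕ β 2F (label (y ⊕ x) (z ⊕ x)) ⊕ 0F) ≡ 0F
  table₄ = from-yes (all? λ x → all? λ y → all? λ z → z ⊕ (x ⊕ β 2F (label (y ⊕ x) (z ⊕ x)) ⊕ 0F) ≟ 0F)

compress-≈ : ∀ g → codeOf g ≈ codeOf (expand (compress g))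
compress-≈ g = ≈-trans
  (affine-≈ (g 0F 0F) (label (g 1F 0F ⊕ g 0F 0F) (g 2F 0F ⊕ g 0F 0F)) (label (g 0F 1F ⊕ g 0F 0F) (g 0F 2F ⊕ g 0F 0F)) g)
  (codeOf-cong (expand-compress g))

-- The affine semilinear group has order 5760. These sixteen elements are enough to lower
-- the value of each normal form that is not minimal in its orbit.
moves : Vec Move 16
moves =
  move 0F 1F true  (4F ∷ 1F ∷ 0F ∷ 2F ∷ 3F ∷ []) (0F ∷ 0F ∷ 1F ∷ 2F ∷ 1F ∷ []) ∷
  move 0F 0F true  (4F ∷ 2F ∷ 0F ∷ 3F ∷ 1F ∷ []) (0F ∷ 0F ∷ 2F ∷ 2F ∷ 1F ∷ []) ∷
  move 2F 0F true  (3F ∷ 0F ∷ 2F ∷ 4F ∷ 1F ∷ []) (2F ∷ 0F ∷ 2F ∷ 0F ∷ 1F ∷ []) ∷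
  move 0F 0F true  (0F ∷ 1F ∷ 2F ∷ 4F ∷ 3F ∷ []) (1F ∷ 1F ∷ 1F ∷ 1F ∷ 1F ∷ []) ∷
  move 0F 2F false (3F ∷ 2F ∷ 0F ∷ 4F ∷ 1F ∷ []) (1F ∷ 1F ∷ 0F ∷ 0F ∷ 2F ∷ []) ∷
  move 1F 0F false (3F ∷ 4F ∷ 2F ∷ 0F ∷ 1F ∷ []) (0F ∷ 1F ∷ 2F ∷ 1F ∷ 0F ∷ []) ∷
  move 1F 2F true  (2F ∷ 0F ∷ 4F ∷ 3F ∷ 1F ∷ []) (1F ∷ 0F ∷ 1F ∷ 2F ∷ 0F ∷ []) ∷
  move 0F 1F false (2F ∷ 1F ∷ 4F ∷ 3F ∷ 0F ∷ []) (2F ∷ 1F ∷ 0F ∷ 2F ∷ 1F ∷ []) ∷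
  move 2F 0F true  (0F ∷ 1F ∷ 3F ∷ 2F ∷ 4F ∷ []) (2F ∷ 0F ∷ 0F ∷ 0F ∷ 0F ∷ []) ∷
  move 0F 0F true  (2F ∷ 1F ∷ 0F ∷ 3F ∷ 4F ∷ []) (2F ∷ 2F ∷ 2F ∷ 1F ∷ 0F ∷ []) ∷
  move 0F 2F false (0F ∷ 2F ∷ 3F ∷ 1F ∷ 4F ∷ []) (0F ∷ 1F ∷ 1F ∷ 1F ∷ 1F ∷ []) ∷
  move 0F 1F false (0F ∷ 1F ∷ 3F ∷ 4F ∷ 2F ∷ []) (1F ∷ 0F ∷ 0F ∷ 0F ∷ 0F ∷ []) ∷
  move 0F 2F false (0F ∷ 4F ∷ 1F ∷ 3F ∷ 2F ∷ []) (0F ∷ 1F ∷ 1F ∷ 1F ∷ 1F ∷ []) ∷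
  move 0F 1F true  (0F ∷ 2F ∷ 1F ∷ 3F ∷ 4F ∷ []) (0F ∷ 0F ∷ 0F ∷ 0F ∷ 0F ∷ []) ∷
  move 0F 1F true  (0F ∷ 1F ∷ 2F ∷ 4F ∷ 3F ∷ []) (2F ∷ 2F ∷ 2F ∷ 2F ∷ 2F ∷ []) ∷
  move 1F 0F false (3F ∷ 1F ∷ 0F ∷ 2F ∷ 4F ∷ []) (0F ∷ 0F ∷ 1F ∷ 2F ∷ 1F ∷ []) ∷
  []

moves-valid : ∀ i → Move.Valid (lookup moves i)
moves-valid = from-yes (all? λ i → Move.valid? (lookup moves i))

-- The normal forms of least value in the fifteen orbits
representatives : Vec (Word 11) 15
representatives =
  (0F ∷ 0F ∷ 0F ∷ 0F ∷ 0F ∷ 0F ∷ 0F ∷ 0F ∷ 0F ∷ 0F ∷ 0F ∷ []) ∷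
  (1F ∷ 0F ∷ 0F ∷ 0F ∷ 0F ∷ 0F ∷ 0F ∷ 0F ∷ 0F ∷ 0F ∷ 0F ∷ []) ∷
  (1F ∷ 1F ∷ 0F ∷ 0F ∷ 0F ∷ 0F ∷ 0F ∷ 0F ∷ 0F ∷ 0F ∷ 0F ∷ []) ∷
  (1F ∷ 1F ∷ 1F ∷ 0F ∷ 0F ∷ 0F ∷ 0F ∷ 0F ∷ 0F ∷ 0F ∷ 0F ∷ []) ∷
  (0F ∷ 1F ∷ 1F ∷ 1F ∷ 0F ∷ 0F ∷ 0F ∷ 0F ∷ 0F ∷ 0F ∷ 0F ∷ []) ∷
  (1F ∷ 1F ∷ 1F ∷ 1F ∷ 0F ∷ 0F ∷ 0F ∷ 0F ∷ 0F ∷ 0F ∷ 0F ∷ []) ∷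
  (1F ∷ 1F ∷ 0F ∷ 1F ∷ 1F ∷ 0F ∷ 0F ∷ 0F ∷ 0F ∷ 0F ∷ 0F ∷ []) ∷
  (1F ∷ 1F ∷ 1F ∷ 1F ∷ 1F ∷ 0F ∷ 0F ∷ 0F ∷ 0F ∷ 0F ∷ 0F ∷ []) ∷
  (1F ∷ 1F ∷ 1F ∷ 1F ∷ 0F ∷ 1F ∷ 0F ∷ 0F ∷ 0F ∷ 0F ∷ 0F ∷ []) ∷
  (0F ∷ 1F ∷ 1F ∷ 0F ∷ 1F ∷ 1F ∷ 0F ∷ 0F ∷ 0F ∷ 0F ∷ 0F ∷ []) ∷
  (1F ∷ 1F ∷ 0F ∷ 1F ∷ 1F ∷ 1F ∷ 0F ∷ 0F ∷ 0F ∷ 0F ∷ 0F ∷ []) ∷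
  (1F ∷ 0F ∷ 1F ∷ 0F ∷ 1F ∷ 0F ∷ 0F ∷ 1F ∷ 0F ∷ 0F ∷ 0F ∷ []) ∷
  (1F ∷ 1F ∷ 1F ∷ 1F ∷ 0F ∷ 0F ∷ 1F ∷ 1F ∷ 0F ∷ 0F ∷ 0F ∷ []) ∷
  (1F ∷ 1F ∷ 1F ∷ 1F ∷ 0F ∷ 1F ∷ 0F ∷ 0F ∷ 1F ∷ 0F ∷ 0F ∷ []) ∷
  (0F ∷ 1F ∷ 0F ∷ 1F ∷ 0F ∷ 1F ∷ 1F ∷ 0F ∷ 1F ∷ 1F ∷ 0F ∷ []) ∷
  []

-- A normal form read as a binary number, least significant digit first
value : ∀ {n} → Word n → ℕ
value [] = 0
value (b ∷ w) = toℕ b ℕ.+ 2 ℕ.* value w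

-- The normal form after a move
reduce : Fin 16 → Word 11 → Word 11
reduce i v = compress (Move.pull (lookup moves i) (expand v))

-- A normal form is a representative, or some move lowers its value.
Reducible : Word 11 → Set
Reducible v = (∃[ i ] v ≡ lookup representatives i) ⊎ (∃[ i ] value (reduce i v) ℕ.< value v)

allWords? : ∀ {n} {P : Word n → Set} → (∀ w → Dec (P w)) → Dec (∀ w → P w)
allWords? {zero} P? with P? []
... | yes p = yes λ { [] → p }
... | no ¬p = no λ h → ¬p (h [])
allWords? {suc n} P? with allWords? (P? ∘ (0F ∷_)) | allWords? (P? ∘ (1F ∷_))
... | yes p | yes q = yes λ { (0F ∷ w) → p w ; (1F ∷ w) → q w }
... | no ¬p | _ = no λ h → ¬p (h ∘ (0F ∷_))
... | yes _ | no ¬q = no λ h → ¬q (h ∘ (1F ∷_))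

reducible? : ∀ v → Dec (Reducible v)
reducible? v = any? (λ i → v ≟ʷ lookup representatives i) ⊎-dec any? (λ i → value (reduce i v) ℕ.<? value v)

opaque
  -- Checked for all 2048 normal forms
  reducible : ∀ v → Reducible v
  reducible = from-yes (allWords? reducible?)

representative-≈ : ∀ v → ∃[ i ] codeOf (expand v) ≈ codeOf (expand (lookup representatives i))
representative-≈ v = descend (suc (value v)) v ℕₚ.≤-refl
  where
  Goal : Word 11 → Set
  Goal v = ∃[ i ] codeOf (expand v) ≈ codeOf (expand (lookup representatives i))
  step-≈ : ∀ i v → codeOf (expand v) ≈ codeOf (expand (reduce i v))
  step-≈ i v = ≈-trans
    (≈-sym (Move.pull-≈ (lookup moves i) (moves-valid i) (expand v)))
    (compress-≈ (Move.pull (lookup moves i) (expand v)))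
  descend : ∀ n v → value v ℕ.< n → Goal v
  descend (suc n) v (s≤s v≤n) = by-cases (reducible v)
    where
    extend : ∀ i → Goal (reduce i v) → Goal v
    extend i (j , e) = j , ≈-trans (step-≈ i v) e
    by-cases : Reducible v → Goal v
    by-cases (inj₁ (i , refl)) = i , ≈-refl (codeOf (expand (lookup representatives i)))
    by-cases (inj₂ (i , smaller)) = extend i (descend n (reduce i v) (ℕₚ.<-≤-trans smaller v≤n))

classification : ∀ D → GoodCode 256 D → ∃[ i ] codeOf (expand (lookup representatives i)) ≈ D
classification D good = from (good⇒codeOf D good)
  where
  from : ∃[ f ] D ≈ codeOf f → ∃[ i ] codeOf (expand (lookup representatives i)) ≈ D
  from (f , D≈) = proj₁ rep , ≈-sym (≈-trans D≈ (≈-trans (compress-≈ f) (proj₂ rep)))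
    where
    rep : ∃[ i ] codeOf (expand (compress f)) ≈ codeOf (expand (lookup representatives i))
    rep = representative-≈ (compress f)


-- An invariant

-- The words of weight four are the complements of the unit vectors.
allOnes-unit : ∀ (w : Word 5) → wt w ≡ 4 → ∃[ i ] w ≡ 𝟏 ⊞ unit i
allOnes-unit = from-yes (allWords? λ w → (wt w ℕ.≟ 4) →-dec any? λ i → w ≟ʷ (𝟏 ⊞ unit i))

glueDist-≤ : ∀ {n} (γ γ′ : Vec (Fin 4) n) a a′ → glueDist γ a γ′ a′ ℕ.+ 2 ℕ.* hamming γ γ′ ℕ.≤ n ℕ.* 4
glueDist-≤ [] [] [] [] = z≤n
glueDist-≤ (k ∷ γ) (k′ ∷ γ′) (x ∷ a) (x′ ∷ a′) = ℕₚ.≤-trans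
  (ℕₚ.≤-reflexive (collect (quadDist k x k′ x′) (glueDist γ a γ′ a′) (differ k k′) (hamming γ γ′)))
  (ℕₚ.+-mono-≤ (table k x k′ x′) (glueDist-≤ γ γ′ a a′))
  where
  table : ∀ k x k′ x′ → quadDist k x k′ x′ ℕ.+ 2 ℕ.* differ k k′ ℕ.≤ 4
  table = from-yes (all? λ k → all? λ x → all? λ k′ → all? λ x′ → quadDist k x k′ x′ ℕ.+ 2 ℕ.* differ k k′ ≤? 4)
  collect : ∀ q g d h → q ℕ.+ g ℕ.+ 2 ℕ.* (d ℕ.+ h) ≡ q ℕ.+ 2 ℕ.* d ℕ.+ (g ℕ.+ 2 ℕ.* h)
  collect = solveℕ-∀

word-⊞ : ∀ γ a a′ i → a ⊞ a′ ≡ 𝟏 ⊞ unit i → word γ a ⊞ word γ a′ ≡ 𝟏 ⊞ block i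
word-⊞ γ a a′ i e = trans (cong (word γ a ⊞_) (trans (cong (word γ) (trans (sym (⊞-cancel a a′)) (cong (a ⊞_) e))) (sym (word-flip γ a i))))
  (⊞-cancel (word γ a) (𝟏 ⊞ block i))

-- Codewords at distance 16 differ in all blocks but one.
distance-16 : ∀ {f u v} → Codeword f u → Codeword f v → dH u v ≡ 16 → ∃[ i ] u ⊞ v ≡ 𝟏 ⊞ block i
distance-16 {f} (mk k l a h) (mk k′ l′ a′ h′) d = by-cases (hamming-row k l k′ l′)
  where
  by-cases : (k ≡ k′ × l ≡ l′) ⊎ hamming (row k l) (row k′ l′) ≡ 4 → ∃[ i ] word (row k l) a ⊞ word (row k′ l′) a′ ≡ 𝟏 ⊞ block i
  by-cases (inj₂ h4) = contradiction
    (subst₂ (λ x y → x ℕ.+ 2 ℕ.* y ℕ.≤ 20) (trans (sym (dH-word (row k l) a (row k′ l′) a′)) d) h4 (glueDist-≤ (row k l) (row k′ l′) a a′))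
    (from-no (24 ≤? 20))
  by-cases (inj₁ (refl , refl)) = proj₁ found , word-⊞ (row k l) a a′ (proj₁ found) (proj₂ found)
    where
    found : ∃[ i ] a ⊞ a′ ≡ 𝟏 ⊞ unit i
    found = allOnes-unit (a ⊞ a′) (ℕₚ.*-cancelˡ-≡ (wt (a ⊞ a′)) 4 4
      (trans (sym (glueDist-same-glue (row k l) a a′)) (trans (sym (dH-word (row k l) a (row k l) a′)) d)))

-- The glue and the parity of a codeword given by labels and signs
codeword-labels : ∀ {f γ s} → word γ s ∈ codeOf f → γ ≡ row (lookup γ 0F) (lookup γ 1F) × parity s ≡ f (lookup γ 0F) (lookup γ 1F)
codeword-labels {f} {γ} {s} p = from (codeOf-∈ p) (glueOf-word γ s) (signOf-word γ s)
  where
  from : ∀ {w} → Codeword f w → glueOf w ≡ γ → signOf w ≡ s → γ ≡ row (lookup γ 0F) (lookup γ 1F) × parity s ≡ f (lookup γ 0F) (lookup γ 1F)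
  from (mk k l a h) e e′ with refl ← trans (sym (glueOf-word (row k l) a)) e with refl ← trans (sym (signOf-word (row k l) a)) e′ = refl , h

-- The labels and signs of a codeword
codeword-representation : ∀ {f w} → w ∈ codeOf f → w ≡ word (row (label₀ w) (label₁ w)) (signOf w) × parity (signOf w) ≡ f (label₀ w) (label₁ w)
codeword-representation {f} p = from (codeOf-∈ p)
  where
  from : ∀ {w} → Codeword f w → w ≡ word (row (label₀ w) (label₁ w)) (signOf w) × parity (signOf w) ≡ f (label₀ w) (label₁ w)
  from (mk k l a h) = sym (cong₂ word (cong₂ row k≡ l≡) (signOf-word (row k l) a)) , trans (cong parity (signOf-word (row k l) a)) (trans h (sym (cong₂ f k≡ l≡)))
    where
    k≡ : label₀ (word (row k l) a) ≡ k
    k≡ = cong (λ γ → lookup γ 0F) (glueOf-word (row k l) a)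
    l≡ : label₁ (word (row k l) a) ≡ l
    l≡ = cong (λ γ → lookup γ 1F) (glueOf-word (row k l) a)

-- A word is constant on a block.
Constant : Fin 5 → Word 20 → Set
Constant i w = ∀ j → at w i j ≡ at w i 0F

-- The sum of two words is constant on a block if and only if the labels agree there.
constant⇔ : ∀ γ a γ′ a′ i → Constant i (word γ a ⊞ word γ′ a′) ⇔ lookup γ i ≡ lookup γ′ i
constant⇔ γ a γ′ a′ i = mk⇔
  (λ c → table (lookup γ i) (lookup a i) (lookup γ′ i) (lookup a′ i) λ j → trans (sym (entry j)) (trans (c j) (entry 0F)))
  (λ e j → trans (entry j) (trans (table′ (lookup γ i) (lookup a i) (lookup γ′ i) (lookup a′ i) e j) (sym (entry 0F))))
  where
  entry : ∀ j → at (word γ a ⊞ word γ′ a′) i j ≡ lookup a i ⊕ β (lookup γ i) j ⊕ (lookup a′ i ⊕ β (lookup γ′ i) j)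
  entry j = trans (at-⊞ (word γ a) (word γ′ a′) i j) (cong₂ _⊕_ (at-word γ a i j) (at-word γ′ a′ i j))
  table : ∀ k x k′ x′ → (∀ j → x ⊕ β k j ⊕ (x′ ⊕ β k′ j) ≡ x ⊕ β k 0F ⊕ (x′ ⊕ β k′ 0F)) → k ≡ k′
  table = from-yes (all? λ k → all? λ x → all? λ k′ → all? λ x′ →
    (all? λ j → x ⊕ β k j ⊕ (x′ ⊕ β k′ j) ≟ x ⊕ β k 0F ⊕ (x′ ⊕ β k′ 0F)) →-dec (k ≟ k′))
  table′ : ∀ k x k′ x′ → k ≡ k′ → ∀ j → x ⊕ β k j ⊕ (x′ ⊕ β k′ j) ≡ x ⊕ β k 0F ⊕ (x′ ⊕ β k′ 0F)
  table′ = from-yes (all? λ k → all? λ x → all? λ k′ → all? λ x′ → (k ≟ k′) →-dec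
    all? λ j → x ⊕ β k j ⊕ (x′ ⊕ β k′ j) ≟ x ⊕ β k 0F ⊕ (x′ ⊕ β k′ 0F))

-- The sixteen glue vectors are numbered, with their first two labels as digits.
first second : Fin 16 → Fin 4
first g = quotient {4} 4 g
second g = remainder {4} 4 g

glue : Fin 16 → Glue
glue g = row (first g) (second g)

-- The value of a function at a numbered glue vector
_✦_ : Fun → Fin 16 → 𝔽₂
f ✦ g = f (first g) (second g)

-- The sum of f over the quadruple completed from g, h, k to have sum zero. It vanishes for
-- affine functions.
quad : Fun → Fin 16 → Fin 16 → Fin 16 → 𝔽₂
quad f g h k = f ✦ g ⊕ f ✦ h ⊕ f ✦ k ⊕ f (first g +₄ first h +₄ first k) (second g +₄ second h +₄ second k)

-- Three glue vectors have a common entry in some block. The glue vectors with a given entry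
-- in a given block form an affine line over the field of four elements.
Collinear : Fin 16 → Fin 16 → Fin 16 → Set
Collinear g h k = ∃[ i ] lookup (glue g) i ≡ lookup (glue h) i × lookup (glue g) i ≡ lookup (glue k) i

collinear? : ∀ g h k → Dec (Collinear g h k)
collinear? g h k = any? λ i → (lookup (glue g) i ≟ lookup (glue h) i) ×-dec (lookup (glue g) i ≟ lookup (glue k) i)

-- Triples with quad equal to 1 are counted, the collinear ones five times; with this weight
-- the invariant separates the fifteen representatives.
weight : 𝔽₂ → Bool → ℕ
weight 0F _ = 0
weight 1F c = if c then 5 else 1

opaque
  -- Opaque, to keep the 4096 terms of the invariant from being written out
  total : ∀ {n} → (Fin n → ℕ) → ℕ
  total = ℕΣ.sum

  total-cong : ∀ {n} {F G : Fin n → ℕ} → (∀ x → F x ≡ G x) → total F ≡ total G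
  total-cong = ℕΣ.sum-cong-≗

  total-permute : ∀ {n} (F : Fin n → ℕ) (π : Permutation′ n) → total (λ x → F (π ⟨$⟩ʳ x)) ≡ total F
  total-permute F π = sym (ℕΣ.sum-permute F π)

invariant : Fun → ℕ
invariant f = total {16} λ g → total {16} λ h → total {16} λ k → weight (quad f g h k) (does (collinear? g h k))

iff⇒≡ : ∀ {p q : 𝔽₂} → (p ≡ 0F → q ≡ 0F) → (q ≡ 0F → p ≡ 0F) → p ≡ q
iff⇒≡ {0F} f _ = sym (f refl)
iff⇒≡ {1F} {0F} _ g = g refl
iff⇒≡ {1F} {1F} _ _ = refl

⊕-zero⇒≡ : ∀ p q → p ⊕ q ≡ 0F → p ≡ q
⊕-zero⇒≡ = from-yes (all? λ p → all? λ q → (p ⊕ q ≟ 0F) →-dec (p ≟ q))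

-- The sum of three codewords is a codeword if and only if quad vanishes at their glue.
triple-sum : ∀ f x y z s t u → parity s ≡ f ✦ x → parity t ≡ f ✦ y → parity u ≡ f ✦ z →
             word (glue x) s ⊞ word (glue y) t ⊞ word (glue z) u ∈ codeOf f ⇔ quad f x y z ≡ 0F
triple-sum f x y z s t u hs ht hu = mk⇔
  (λ p → trans (cong (_⊕ f k l) (sym parity≡)) (trans (cong (_⊕ f k l) (proj₂ (codeword-labels (subst (_∈ codeOf f) sum≡ p)))) (⊕-self (f k l))))
  (λ e → subst (_∈ codeOf f) (sym sum≡) (∈-codeOf (mk k l (s ⊞ t ⊞ u) (trans parity≡ (⊕-zero⇒≡ (f ✦ x ⊕ f ✦ y ⊕ f ✦ z) (f k l) e)))))
  where
  k l : Fin 4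
  k = first x +₄ first y +₄ first z
  l = second x +₄ second y +₄ second z
  sum≡ : word (glue x) s ⊞ word (glue y) t ⊞ word (glue z) u ≡ word (row k l) (s ⊞ t ⊞ u)
  sum≡ = trans (cong (_⊞ word (glue z) u) (trans (word-+ (glue x) s (glue y) t) (cong (λ γ → word γ (s ⊞ t)) (row-+ (first x) (second x) (first y) (second y)))))
    (trans (word-+ (row (first x +₄ first y) (second x +₄ second y)) (s ⊞ t) (glue z) u)
           (cong (λ γ → word γ (s ⊞ t ⊞ u)) (row-+ (first x +₄ first y) (second x +₄ second y) (first z) (second z))))
  parity≡ : parity (s ⊞ t ⊞ u) ≡ f ✦ x ⊕ f ✦ y ⊕ f ✦ z
  parity≡ = trans (parity-⊞ (s ⊞ t) u) (cong₂ _⊕_ (trans (parity-⊞ s t) (cong₂ _⊕_ hs ht)) hu)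

lookup-block : ∀ i p → lookup (block i) p ≡ (if does (i ≟ quotient 4 p) then 1F else 0F)
lookup-block i p = lookup∘tabulate (λ p → if does (i ≟ quotient 4 p) then 1F else 0F) p

lookup-block-1 : ∀ i p → lookup (block i) p ≡ 1F → i ≡ quotient 4 p
lookup-block-1 i p h = from (i ≟ quotient 4 p) (trans (sym (lookup-block i p)) h)
  where
  from : (d : Dec (i ≡ quotient 4 p)) → (if does d then 1F else 0F) ≡ (Fin.suc {1} zero) → i ≡ quotient 4 p
  from (yes e) _ = e
  from (no _) ()

lookup-own-block : ∀ p → lookup (block (quotient 4 p)) p ≡ 1F
lookup-own-block p = trans (lookup-block (quotient 4 p) p)
  (cong (λ b → if b then 1F else 0F) (dec-true (quotient {5} 4 p ≟ quotient 4 p) refl))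

-- An equivalence between two of the codes induces a bijection of the glue vectors that
-- preserves quad and collinearity.
module Comparison (f g : Fun) (equivalence : codeOf f ≈ codeOf g) where

  open _≈_ equivalence

  Φ : Word 20 → Word 20
  Φ = isometry σ a

  Φ∈ : ∀ {w} → w ∈ codeOf f → Φ w ∈ codeOf g
  Φ∈ {w} = subst T (agree w)

  Φ⁻¹∈ : ∀ {w} → Φ w ∈ codeOf g → w ∈ codeOf f
  Φ⁻¹∈ {w} = subst T (sym (agree w))

  -- Signs of the required parity
  signs : Fin 16 → Word 5
  signs x = 0F ∷ 0F ∷ 0F ∷ 0F ∷ f ✦ x ∷ []

  parity-signs : ∀ x → parity (signs x) ≡ f ✦ x
  parity-signs x = ⊕-comm (f ✦ x) 0F

  -- A codeword with given glue
  encode : Fin 16 → Word 20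
  encode x = word (glue x) (signs x)

  encode∈ : ∀ x → encode x ∈ codeOf f
  encode∈ x = ∈-codeOf (mk (first x) (second x) (signs x) (parity-signs x))

  opaque
    -- The isometry preserves distance 16, hence maps blocks to blocks.
    block-image : ∀ i → ∃[ j ] permuteCoordinates σ (block i) ≡ block j
    block-image i = proj₁ image≡ , trans (sym (⊞-cancel 𝟏 (permuteCoordinates σ (block i))))
      (trans (cong (𝟏 ⊞_) (trans (sym permute≡) (proj₂ image≡))) (⊞-cancel 𝟏 (block (proj₁ image≡))))
      where
      u v : Word 20
      u = encode 0F
      v = u ⊞ (𝟏 ⊞ block i)
      even : ∀ i → parity (𝟏 ⊞ unit i) ≡ 0F
      even = from-yes (all? λ i → parity (𝟏 ⊞ unit i) ≟ 0F)
      v∈ : v ∈ codeOf f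
      v∈ = subst (_∈ codeOf f) (sym (word-flip (glue 0F) (signs 0F) i))
        (∈-codeOf (mk 0F 0F (signs 0F ⊞ (𝟏 ⊞ unit i)) (trans (parity-⊞ (signs 0F) (𝟏 ⊞ unit i))
          (trans (cong₂ _⊕_ (parity-signs 0F) (even i)) (⊕-comm (f ✦ 0F) 0F)))))
      sixteen : ∀ i → wt (𝟏 ⊞ block i) ≡ 16
      sixteen = from-yes (all? λ i → wt (𝟏 ⊞ block i) ℕ.≟ 16)
      d : dH (Φ u) (Φ v) ≡ 16
      d = trans (dH-isometry σ a u v) (trans (dH≡wt u v) (trans (cong wt (⊞-cancel u (𝟏 ⊞ block i))) (sixteen i)))
      image≡ : ∃[ j ] Φ u ⊞ Φ v ≡ 𝟏 ⊞ block j
      image≡ = distance-16 (codeOf-∈ (Φ∈ (encode∈ 0F))) (codeOf-∈ (Φ∈ v∈)) d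
      permute≡ : Φ u ⊞ Φ v ≡ 𝟏 ⊞ permuteCoordinates σ (block i)
      permute≡ = trans (isometry-⊞ σ a u v) (trans (cong (permuteCoordinates σ) (⊞-cancel u (𝟏 ⊞ block i)))
        (trans (permute-⊞ σ 𝟏 (block i)) (cong (_⊞ permuteCoordinates σ (block i)) (permute-𝟏 σ))))

  -- The blocks are permuted by κ and, inversely, by ρ.
  κ : Fin 5 → Fin 5
  κ i = proj₁ (block-image i)

  κ-quotient : ∀ p → κ (quotient 4 (σ ⟨$⟩ʳ p)) ≡ quotient 4 p
  κ-quotient p = lookup-block-1 (κ i) p (trans (sym (cong (λ w → lookup w p) (proj₂ (block-image i))))
    (trans (permute-lookup σ (block i) p) (lookup-own-block (σ ⟨$⟩ʳ p))))
    where
    i : Fin 5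
    i = quotient 4 (σ ⟨$⟩ʳ p)

  ρ : Fin 5 → Fin 5
  ρ i = quotient 4 (σ ⟨$⟩ʳ combine i (Fin.zero {3}))

  κ-combine : ∀ i j → κ (quotient 4 (σ ⟨$⟩ʳ combine {5} {4} i j)) ≡ i
  κ-combine i j = trans (κ-quotient (combine i j)) (cong proj₁ (remQuot-combine {5} {4} i j))

  κ-ρ : ∀ i → κ (ρ i) ≡ i
  κ-ρ i = κ-combine i 0F

  ρ-injective : Injective _≡_ _≡_ ρ
  ρ-injective {i} {j} e = trans (sym (κ-ρ i)) (trans (cong κ e) (κ-ρ j))

  ρ-κ : ∀ i → ρ (κ i) ≡ i
  ρ-κ i = from (injective⇒hit ρ-injective i)
    where
    from : ∃[ j ] ρ j ≡ i → ρ (κ i) ≡ i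
    from (j , refl) = cong ρ (κ-ρ j)

  ρ-combine : ∀ i j → quotient 4 (σ ⟨$⟩ʳ combine {5} {4} i j) ≡ ρ i
  ρ-combine i j = trans (sym (ρ-κ (quotient 4 (σ ⟨$⟩ʳ combine i j)))) (cong ρ (κ-combine i j))

  constant-lookup : ∀ {b} w → Constant b w → ∀ p → quotient 4 p ≡ b → lookup w p ≡ at w b 0F
  constant-lookup w c p refl = trans (cong (lookup w) (sym (combine-remQuot {5} 4 p))) (c (remainder {5} 4 p))

  constant-transport : ∀ i w → Constant (ρ i) w ⇔ Constant i (permuteCoordinates σ w)
  constant-transport i w = mk⇔
    (λ c j → trans (forward c j) (sym (forward c 0F)))
    (λ c j → trans (backward c j) (sym (backward c 0F)))
    where
    forward : Constant (ρ i) w → ∀ j → at (permuteCoordinates σ w) i j ≡ at w (ρ i) 0F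
    forward c j = trans (permute-lookup σ w (combine i j)) (constant-lookup w c (σ ⟨$⟩ʳ combine i j) (ρ-combine i j))
    backward : Constant i (permuteCoordinates σ w) → ∀ j → at w (ρ i) j ≡ at (permuteCoordinates σ w) i 0F
    backward c j = trans (cong (lookup w) (sym (inverseʳ σ {combine (ρ i) j})))
      (trans (sym (permute-lookup σ w (σ ⟨$⟩ˡ combine (ρ i) j)))
        (constant-lookup (permuteCoordinates σ w) c (σ ⟨$⟩ˡ combine (ρ i) j)
          (trans (sym (κ-quotient (σ ⟨$⟩ˡ combine (ρ i) j))) (trans (cong (κ ∘ quotient 4) (inverseʳ σ {combine (ρ i) j}))
            (trans (cong (κ ∘ proj₁) (remQuot-combine {5} {4} (ρ i) j)) (κ-ρ i))))))

  -- The induced map of glue vectors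
  φ : Fin 16 → Fin 16
  φ x = combine (label₀ (Φ (encode x))) (label₁ (Φ (encode x)))

  first-φ : ∀ x → first (φ x) ≡ label₀ (Φ (encode x))
  first-φ x = cong proj₁ (remQuot-combine {4} {4} (label₀ (Φ (encode x))) (label₁ (Φ (encode x))))

  second-φ : ∀ x → second (φ x) ≡ label₁ (Φ (encode x))
  second-φ x = cong proj₂ (remQuot-combine {4} {4} (label₀ (Φ (encode x))) (label₁ (Φ (encode x))))

  newSigns : Fin 16 → Word 5
  newSigns x = signOf (Φ (encode x))

  Φ-encode : ∀ x → Φ (encode x) ≡ word (glue (φ x)) (newSigns x)
  Φ-encode x = trans (proj₁ (codeword-representation (Φ∈ (encode∈ x))))
    (cong (λ γ → word γ (newSigns x)) (sym (cong₂ row (first-φ x) (second-φ x))))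

  parity-newSigns : ∀ x → parity (newSigns x) ≡ g ✦ φ x
  parity-newSigns x = trans (proj₂ (codeword-representation (Φ∈ (encode∈ x)))) (sym (cong₂ g (first-φ x) (second-φ x)))

  agree-transport : ∀ i x y → lookup (glue x) (ρ i) ≡ lookup (glue y) (ρ i) ⇔ lookup (glue (φ x)) i ≡ lookup (glue (φ y)) i
  agree-transport i x y = mk⇔
    (λ e → Equivalence.to new (subst (Constant i) image≡ (Equivalence.to transport (Equivalence.from old e))))
    (λ e → Equivalence.to old (Equivalence.from transport (subst (Constant i) (sym image≡) (Equivalence.from new e))))
    where
    old : Constant (ρ i) (encode x ⊞ encode y) ⇔ lookup (glue x) (ρ i) ≡ lookup (glue y) (ρ i)
    old = constant⇔ (glue x) (signs x) (glue y) (signs y) (ρ i)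
    new : Constant i (word (glue (φ x)) (newSigns x) ⊞ word (glue (φ y)) (newSigns y)) ⇔ lookup (glue (φ x)) i ≡ lookup (glue (φ y)) i
    new = constant⇔ (glue (φ x)) (newSigns x) (glue (φ y)) (newSigns y) i
    transport : Constant (ρ i) (encode x ⊞ encode y) ⇔ Constant i (permuteCoordinates σ (encode x ⊞ encode y))
    transport = constant-transport i (encode x ⊞ encode y)
    image≡ : permuteCoordinates σ (encode x ⊞ encode y) ≡ word (glue (φ x)) (newSigns x) ⊞ word (glue (φ y)) (newSigns y)
    image≡ = trans (sym (isometry-⊞ σ a (encode x) (encode y))) (cong₂ _⊞_ (Φ-encode x) (Φ-encode y))

  φ-injective : Injective _≡_ _≡_ φ
  φ-injective {x} {y} e = trans (sym (combine-remQuot {4} 4 x)) (trans (cong₂ combine (entry 0F) (entry 1F)) (combine-remQuot {4} 4 y))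
    where
    entry : ∀ i → lookup (glue x) i ≡ lookup (glue y) i
    entry i = subst (λ j → lookup (glue x) j ≡ lookup (glue y) j) (ρ-κ i)
      (Equivalence.from (agree-transport (κ i) x y) (cong (λ z → lookup (glue z) (κ i)) e))

  collinear-transport : ∀ x y z → Collinear x y z ⇔ Collinear (φ x) (φ y) (φ z)
  collinear-transport x y z = mk⇔
    (λ (i , p , q) → κ i , Equivalence.to (agree-transport (κ i) x y) (back x y i p) , Equivalence.to (agree-transport (κ i) x z) (back x z i q))
    (λ (i , p , q) → ρ i , Equivalence.from (agree-transport i x y) p , Equivalence.from (agree-transport i x z) q)
    where
    back : ∀ x y i → lookup (glue x) i ≡ lookup (glue y) i → lookup (glue x) (ρ (κ i)) ≡ lookup (glue y) (ρ (κ i))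
    back x y i = subst (λ j → lookup (glue x) j ≡ lookup (glue y) j) (sym (ρ-κ i))

  Φ-triple : ∀ u v w → Φ (u ⊞ v ⊞ w) ≡ Φ u ⊞ Φ v ⊞ Φ w
  Φ-triple u v w = trans (cong (_⊞ a) (permute-⊞ σ (u ⊞ v) w))
    (trans (⊞-assoc (permuteCoordinates σ (u ⊞ v)) (permuteCoordinates σ w) a) (cong (_⊞ Φ w) (sym (isometry-⊞ σ a u v))))

  quad-transport : ∀ x y z → quad f x y z ≡ quad g (φ x) (φ y) (φ z)
  quad-transport x y z = iff⇒≡
    (λ e → Equivalence.to new (subst (_∈ codeOf g) image≡ (Φ∈ (Equivalence.from old e))))
    (λ e → Equivalence.to old (Φ⁻¹∈ (subst (_∈ codeOf g) (sym image≡) (Equivalence.from new e))))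
    where
    old : encode x ⊞ encode y ⊞ encode z ∈ codeOf f ⇔ quad f x y z ≡ 0F
    old = triple-sum f x y z (signs x) (signs y) (signs z) (parity-signs x) (parity-signs y) (parity-signs z)
    new : word (glue (φ x)) (newSigns x) ⊞ word (glue (φ y)) (newSigns y) ⊞ word (glue (φ z)) (newSigns z) ∈ codeOf g ⇔
          quad g (φ x) (φ y) (φ z) ≡ 0F
    new = triple-sum g (φ x) (φ y) (φ z) (newSigns x) (newSigns y) (newSigns z) (parity-newSigns x) (parity-newSigns y) (parity-newSigns z)
    image≡ : Φ (encode x ⊞ encode y ⊞ encode z) ≡
             word (glue (φ x)) (newSigns x) ⊞ word (glue (φ y)) (newSigns y) ⊞ word (glue (φ z)) (newSigns z)
    image≡ = trans (Φ-triple (encode x) (encode y) (encode z)) (cong₂ _⊞_ (cong₂ _⊞_ (Φ-encode x) (Φ-encode y)) (Φ-encode z))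

  term-transport : ∀ x y z → weight (quad f x y z) (does (collinear? x y z)) ≡
                             weight (quad g (φ x) (φ y) (φ z)) (does (collinear? (φ x) (φ y) (φ z)))
  term-transport x y z = cong₂ weight (quad-transport x y z)
    (does-⇔ (collinear-transport x y z) (collinear? x y z) (collinear? (φ x) (φ y) (φ z)))

  total-φ : ∀ (F : Fin 16 → ℕ) → total (λ x → F (φ x)) ≡ total F
  total-φ F = total-permute F (injective⇒permutation φ φ-injective)

  invariant-≡ : invariant f ≡ invariant g
  invariant-≡ = trans (total-cong λ x → trans (total-cong λ y →
        trans (total-cong (term-transport x y))
              (total-φ λ z → weight (quad g (φ x) (φ y) z) (does (collinear? (φ x) (φ y) z))))
      (total-φ λ y → total λ z → weight (quad g (φ x) y z) (does (collinear? (φ x) y z))))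
    (total-φ λ x → total λ y → total λ z → weight (quad g x y z) (does (collinear? x y z)))


-- The classification

-- The values of the invariant at the representatives
invariants : Vec ℕ 15
invariants = 0 ∷ 1320 ∷ 2112 ∷ 2472 ∷ 2856 ∷ 2880 ∷ 2496 ∷ 3048 ∷ 2664 ∷ 2304 ∷ 2280 ∷ 3072 ∷ 3456 ∷ 2688 ∷ 1920 ∷ []

representativeCode : Fin 15 → Code 20
representativeCode i = codeOf (expand (lookup representatives i))

opaque
  unfolding total

  invariant-representative : ∀ i → invariant (expand (lookup representatives i)) ≡ lookup invariants i
  invariant-representative = from-yes (all? λ i → invariant (expand (lookup representatives i)) ℕ.≟ lookup invariants i)

invariants-distinct : ∀ i j → lookup invariants i ≡ lookup invariants j → i ≡ j
invariants-distinct = from-yes (all? λ i → all? λ j → (lookup invariants i ℕ.≟ lookup invariants j) →-dec (i ≟ j))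

representatives-inequivalent : ∀ i j → representativeCode i ≈ representativeCode j → i ≡ j
representatives-inequivalent i j e = invariants-distinct i j
  (trans (sym (invariant-representative i))
    (trans (Comparison.invariant-≡ (expand (lookup representatives i)) (expand (lookup representatives j)) e)
      (invariant-representative j)))

proposition5p4 : ExactlyUpToEquivalence {20} 15 (λ C → MinDistanceAtLeast C 8 × HasSize C 256 × DistancesDivisibleBy 4 C)
proposition5p4 =
  representativeCode ,
  (λ i → codeOf-good (expand (lookup representatives i))) ,
  (λ i j e → representatives-inequivalent i j (Equivalent⇒≈ e)) ,
  (λ D good → proj₁ (classification D good) , ≈⇒Equivalent (proj₂ (classification D good)))
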